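{- For every integer $n\geq 134$ there exists a planar $K_2$-hypohamiltonian graph of order $n$.
   Context: All graphs are finite, simple and connected. A graph is hamiltonian if it has a cycle through all its vertices. A graph $G$ is $K_2$-hamiltonian if for every pair of adjacent vertices $u,v$ the graph $G-u-v$ is hamiltonian; it is $K_2$-hypohamiltonian if it is $K_2$-hamiltonian and not hamiltonian. -}

module Defs where

open import Data.Nat using (ℕ; zero; suc; _+_; _*_; _≤_; _≤ᵇ_)
open import Data.Fin using (Fin; toℕ)
open import Data.Bool using (Bool; true; false; T; _∧_; if_then_else_)
open import Data.List using (List; []; _∷_; _++_; [_]; length; allFin; concatMap; map; upTo)
open import Data.List.Relation.Unary.Linked using (Linked)
open import Data.List.Relation.Unary.Unique.Propositional using (Unique)
open import Data.List.Membership.Propositional using (_∈_)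
open import Data.Product using (Σ; ∃; ∃-syntax; _×_; _,_)
open import Data.Sum using (_⊎_)
open import Relation.Binary.PropositionalEquality using (_≡_; _≢_)
open import Relation.Nullary using (¬_)

record Graph (n : ℕ) : Set where
  field
    adj    : Fin n → Fin n → Bool
    sym    : ∀ u v → adj u v ≡ adj v u
    irrefl : ∀ u → adj u u ≡ false

open Graph public

Adj : ∀ {n} → Graph n → Fin n → Fin n → Set
Adj G u v = T (adj G u v)

Connected : ∀ {n} → Graph n → Set
Connected {n} G = ∀ (u v : Fin n) →
  u ≡ v ⊎ (∃[ xs ] Linked (Adj G) (u ∷ xs ++ [ v ]))

record IsHamCycleOn {n} (G : Graph n) (P : Fin n → Set)
                    (x : Fin n) (xs : List (Fin n)) : Set where
  field
    atLeast3 : 3 ≤ length (x ∷ xs)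
    distinct : Unique (x ∷ xs)
    edges    : Linked (Adj G) (x ∷ xs ++ [ x ])
    inside   : ∀ w → w ∈ (x ∷ xs) → P w
    covers   : ∀ w → P w → w ∈ (x ∷ xs)

HamiltonianOn : ∀ {n} → Graph n → (Fin n → Set) → Set
HamiltonianOn {n} G P = Σ (Fin n) λ x → Σ (List (Fin n)) λ xs → IsHamCycleOn G P x xs

Hamiltonian : ∀ {n} → Graph n → Set
Hamiltonian G = HamiltonianOn G (λ _ → Data.Unit.⊤)
  where import Data.Unit

HamiltonianMinus2 : ∀ {n} → Graph n → Fin n → Fin n → Set
HamiltonianMinus2 G u v = HamiltonianOn G (λ w → w ≢ u × w ≢ v)

K2-Hamiltonian : ∀ {n} → Graph n → Set
K2-Hamiltonian {n} G = ∀ (u v : Fin n) → Adj G u v → HamiltonianMinus2 G u v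

K2-Hypohamiltonian : ∀ {n} → Graph n → Set
K2-Hypohamiltonian G = K2-Hamiltonian G × ¬ Hamiltonian G

-- Planarity via combinatorial embeddings (rotation systems).
-- A connected graph is planar iff it admits a rotation system whose
-- face count F satisfies Euler's formula V - E + F = 2
-- (Heffter–Edmonds–Ringel; genus-0 embedding).

-- ρ u v : the neighbour of u following v in the cyclic order around u
Rotation : ℕ → Set
Rotation n = Fin n → Fin n → Fin n

iterate : ∀ {A : Set} → (A → A) → ℕ → A → A
iterate f zero    a = a
iterate f (suc k) a = f (iterate f k a)

IsRotationSystem : ∀ {n} → Graph n → Rotation n → Set
IsRotationSystem {n} G ρ =
  (∀ u v → Adj G u v → Adj G u (ρ u v)) ×
  -- ρ u is a single cycle on the neighbourhood of u
  (∀ u v w → Adj G u v → Adj G u w → ∃[ k ] iterate (ρ u) k v ≡ w)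

Dart : ℕ → Set
Dart n = Fin n × Fin n

faceStep : ∀ {n} → Rotation n → Dart n → Dart n
faceStep ρ (u , v) = (v , ρ v u)

key : ∀ {n} → Dart n → ℕ
key {n} (u , v) = toℕ u * n + toℕ v

allDarts : ∀ n → List (Dart n)
allDarts n = concatMap (λ u → map (λ v → (u , v)) (allFin n)) (allFin n)

isDart : ∀ {n} → Graph n → Dart n → Bool
isDart G (u , v) = adj G u v

allB : ∀ {A : Set} → (A → Bool) → List A → Bool
allB p []       = true
allB p (x ∷ xs) = p x ∧ allB p xs

-- d is the key-minimal dart of its face (orbit of faceStep); orbits have
-- length at most n*n, so checking iterates k < n*n suffices
isFaceRep : ∀ {n} → Graph n → Rotation n → Dart n → Bool
isFaceRep {n} G ρ d =
  isDart G d ∧ allB (λ k → key d ≤ᵇ key (iterate (faceStep ρ) k d)) (upTo (n * n))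

count : ∀ {A : Set} → (A → Bool) → List A → ℕ
count p []       = 0
count p (x ∷ xs) = (if p x then 1 else 0) + count p xs

numDarts : ∀ {n} → Graph n → ℕ
numDarts {n} G = count (isDart G) (allDarts n)

numFaces : ∀ {n} → Graph n → Rotation n → ℕ
numFaces {n} G ρ = count (isFaceRep G ρ) (allDarts n)

-- Euler's formula V - E + F = 2 with E = numDarts / 2, multiplied by 2
Planar : ∀ {n} → Graph n → Set
Planar {n} G = ∃[ ρ ] (IsRotationSystem G ρ ×
  2 * n + 2 * numFaces G ρ ≡ 4 + numDarts G)

{-# OPTIONS --safe #-}
module Submission where

-- Deleting a cubic vertex x of G and a cubic vertex y of H and identifying
-- their neighbours pairwise gives a plane graph of order |G| + |H| - 5.  Its
-- Hamiltonian cycles would split at the three identified vertices into one of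
-- G or of H, so it is non-hamiltonian if G and H are.  A Hamiltonian cycle of
-- G - u - v that passes x from one neighbour to another covers or avoids the third
-- one a, and extends to the product by a Hamiltonian cycle of H - b, b the vertex
-- identified with a.  So the product inherits K₂-hamiltonicity if also H - b is
-- hamiltonian for the neighbours b of y, and similarly for G.  Edges at x and y
-- play no role, hence they may violate K₂-hamiltonicity in the factors.
--
-- The factors, of orders between 34 and 82, are explicit plane graphs whose face
-- lengths are all 2 modulo 3 but for one triangle, so that they are
-- non-hamiltonian by Grinberg's criterion.  Products of them cover the orders 134
-- to 162, and a further factor of order 34 adds 29.

open import Defs using (Graph; Adj; Connected; IsHamCycleOn; Hamiltonian; Rotation;
  IsRotationSystem; iterate; faceStep; key; isDart; allB; isFaceRep; count; numDarts; numFaces;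
  Planar; K2-Hypohamiltonian)
open import Data.Bool using (Bool; true; false; not; T; _∧_)
open import Data.Bool.Properties as Bool using (T-∧)
open import Data.Empty using (⊥; ⊥-elim)
open import Data.Fin using (Fin; zero; suc; toℕ; fromℕ<; combine)
open import Data.Fin.Patterns using (0F; 1F; 2F)
open import Data.Fin.Properties as Fin using (toℕ-injective; toℕ<n; toℕ-fromℕ<; toℕ-combine;
  combine-injective)
open import Data.List using (List; []; _∷_; _++_; [_]; length; map; reverse; concat; initLast;
  _∷ʳ′_; filter; upTo; concatMap; allFin; cartesianProduct; drop)
import Data.List.Membership.DecPropositional as DecMembership
open import Data.List.Membership.Propositional using (_∈_; _∉_)
open import Data.List.Membership.Propositional.Properties using (∈-∃++; ∈-map⁺; ∈-map⁻; ∈-++⁺ˡ;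
  ∈-++⁺ʳ; ∈-++⁻; ∈-filter⁺; ∈-filter⁻; ∈-concat⁻′; ∈-concat⁺′; ∈-upTo⁺; ∈-upTo⁻; ∈-allFin;
  ∈-cartesianProduct⁺)
open import Data.List.Membership.Propositional.Properties.WithK using (unique∧set⇒bag)
open import Data.List.Properties as List using (unfold-reverse; ++-assoc; length-++; map-++;
  reverse-++; length-map; concat-map; concat-++; map-id; length-upTo; filter-++; filter-all;
  filter-none; ∷-injectiveʳ)
open import Data.List.Relation.Binary.BagAndSetEquality using (∼bag⇒↭)
open import Data.List.Relation.Binary.Permutation.Propositional using (_↭_; ↭-sym; ↭-trans; prep;
  ↭⇒↭ₛ; ↭-reflexive)
open import Data.List.Relation.Binary.Permutation.Propositional.Properties using (∈-resp-↭;
  ↭-length; ++-comm; ↭-reverse; shift; ++-commutativeMonoid; ++⁺ˡ; filter-↭)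
import Data.List.Relation.Binary.Permutation.Setoid.Properties as PermS
open import Data.List.Relation.Binary.Pointwise as Pointwise using (Pointwise; []; _∷_)
open import Data.List.Relation.Unary.All as All using (All; []; _∷_)
import Data.List.Relation.Unary.All.Properties as All
open import Data.List.Relation.Unary.AllPairs using ([]; _∷_)
open import Data.List.Relation.Unary.Any using (here; there)
open import Data.List.Relation.Unary.Linked as Linked using (Linked; []; [-]; _∷_)
import Data.List.Relation.Unary.Linked.Properties as Linked
import Data.List.Relation.Unary.Unique.DecPropositional as UniqueDec
open import Data.List.Relation.Unary.Unique.Propositional using (Unique)
import Data.List.Relation.Unary.Unique.Propositional.Properties as Unique
open import Data.Nat using (ℕ; zero; suc; _+_; _*_; _≤_; _<_; z≤n; s≤s; _∸_; _≟_; _<?_; _/_; _%_;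
  _≤ᵇ_; _≤?_; _≡ᵇ_; _<ᵇ_; _≥_)
open import Data.Nat.DivMod using (m≡m%n+[m/n]*n; [m+kn]%n≡m%n; m%n<n)
open import Data.Nat.ListAction using (sum)
open import Data.Nat.Properties using (m+n≮m; +-cancelˡ-≡; m+[n∸m]≡n; ≮⇒≥; <-≤-trans; ≤-trans;
  m≤m+n; +-monoʳ-<; <-irrefl; +-cancelˡ-<; +-suc; +-cancelʳ-≡; ≤-refl; ≤-antisym; ≤-reflexive;
  +-mono-≤; <-asym; +-identityʳ; 1+n≰n; +-comm; +-cancelʳ-≤; suc-injective; <-cmp; +-assoc;
  *-comm; ≤-total; ≤ᵇ⇒≤; ≤⇒≤ᵇ; ≡ᵇ⇒≡; ≡⇒≡ᵇ; <ᵇ⇒<)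
open import Data.Nat.Tactic.RingSolver using (solve-∀)
open import Data.Product using (Σ; ∃; ∃-syntax; _×_; _,_; proj₁; proj₂)
open import Data.Product.Properties using (≡-dec)
open import Data.Sum as Sum using (_⊎_; inj₁; inj₂)
open import Data.Unit using (tt; ⊤)
open import Function using (_⟨_⟩_)
open import Function.Bundles using (mk⇔; Equivalence)
open import Relation.Binary.Definitions using (Symmetric; DecidableEquality; tri<; tri≈; tri>)
open import Relation.Binary.PropositionalEquality using (_≡_; _≢_; refl; sym; trans; cong; subst;
  setoid; subst₂; cong₂)
open import Relation.Nullary using (¬_; yes; no; Dec; does)
open import Relation.Nullary.Decidable using (toWitness; _→-dec_; ¬?; _⊎-dec_; _×-dec_; does-⇔;
  dec-false; T?; map′)

-- Walks and cycles

-- Three identified vertices cut a Hamiltonian cycle of the product into three arcs. Each arc stays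
-- on one side, so two of them lie on the same side, and if the third lies on the other, the deleted
-- cubic vertex can replace it. An arc that is a single edge must also be assigned to a side;
-- therefore the neighbours of y are required to be pairwise non-adjacent, which also keeps the
-- product simple.
--
-- For repeated products the second factor carries another cubic vertex, which then takes over the
-- role of x. Of all these special vertices only one in the first and one in the last factor of a
-- chain survive. So only the end factors must be K₂-hamiltonian around a special vertex, and the
-- inner ones may fail around both.
--
-- By Grinberg's formula the sum of |f| - 2 is the same on both sides of a Hamiltonian cycle. Here
-- the summands are 0 modulo 3, but 1 for the triangle, so the sides cannot agree. The sides
-- themselves are obtained without the Jordan curve theorem: Euler's formula leaves too few links
-- between darts to connect all of them.

Unique-resp-↭ : {A : Set} {xs ys : List A} → xs ↭ ys → Unique xs → Unique ys
Unique-resp-↭ {A} p = PermS.Unique-resp-↭ (setoid A) (↭⇒↭ₛ p)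

unique-↭ : {A : Set} {xs ys : List A} → Unique xs → Unique ys →
           (∀ {x} → x ∈ xs → x ∈ ys) → (∀ {x} → x ∈ ys → x ∈ xs) → xs ↭ ys
unique-↭ ux uy f g = ∼bag⇒↭ (unique∧set⇒bag ux uy (mk⇔ f g))

-- The list holds only the inner vertices; a closed walk is a Walk R x zs x.
data Walk {A : Set} (R : A → A → Set) : A → List A → A → Set where
  step : ∀ {x y} → R x y → Walk R x [] y
  _∷_  : ∀ {x y z zs} → R x z → Walk R z zs y → Walk R x (z ∷ zs) y

module _ {A : Set} {R : A → A → Set} where

  _▷_ : ∀ {x y z xs ys} → Walk R x xs y → Walk R y ys z → Walk R x (xs ++ y ∷ ys) z
  step r  ▷ w = r ∷ w
  (r ∷ v) ▷ w = r ∷ (v ▷ w)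

  split : ∀ {x y z} xs {ys} → Walk R x (xs ++ y ∷ ys) z → Walk R x xs y × Walk R y ys z
  split []       (r ∷ w) = step r , w
  split (_ ∷ xs) (r ∷ w) with split xs w
  ... | w₁ , w₂ = r ∷ w₁ , w₂

  reverseʷ : Symmetric R → ∀ {x y xs} → Walk R x xs y → Walk R y (reverse xs) x
  reverseʷ s (step r) = step (s r)
  reverseʷ s {x} {y} (_∷_ {z = z} {zs} r w) rewrite unfold-reverse z zs =
    reverseʷ s w ▷ step (s r)

  toLinked : ∀ {x xs y} → Walk R x xs y → Linked R (x ∷ xs ++ [ y ])
  toLinked (step r) = r ∷ [-]
  toLinked (r ∷ w)  = r ∷ toLinked w

  fromLinked : ∀ {x} xs {y} → Linked R (x ∷ xs ++ [ y ]) → Walk R x xs y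
  fromLinked []       (r ∷ _) = step r
  fromLinked (_ ∷ xs) (r ∷ l) = r ∷ fromLinked xs l

  mapʷ : {B : Set} {S : B → B → Set} {f : A → B} {P : A → Set} →
         (∀ {u v} → P u → P v → R u v → S (f u) (f v)) →
         ∀ {x xs y} → P x → All P xs → P y → Walk R x xs y → Walk S (f x) (map f xs) (f y)
  mapʷ h px ps        py (step r) = step (h px py r)
  mapʷ h px (pz ∷ ps) py (r ∷ w)  = h px pz r ∷ mapʷ h pz ps py w

-- Vertices are plain numbers, so that factors and products share one vertex type and no casts
-- between `Fin` types arise. The list `ds` holds the deleted vertices: none for a Hamiltonian cycle
-- of the graph itself, one for `HamNbs`, two for an edge.
record Cycle (n : ℕ) (E : ℕ → ℕ → Set) (ds : List ℕ) (x : ℕ) (xs : List ℕ) : Set where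
  field
    closed   : Walk E x xs x
    unique   : Unique (x ∷ xs)
    long     : 2 ≤ length xs
    sound    : ∀ {w} → w ∈ x ∷ xs → w < n × w ∉ ds
    complete : ∀ {w} → w < n → w ∉ ds → w ∈ x ∷ xs

open Cycle public

Ham : ℕ → (ℕ → ℕ → Set) → List ℕ → Set
Ham n E ds = ∃[ x ] ∃[ xs ] Cycle n E ds x xs

module _ {n : ℕ} {E : ℕ → ℕ → Set} {ds : List ℕ} where

  resp-↭ : ∀ {x xs y ys} → x ∷ xs ↭ y ∷ ys → Walk E y ys y → Cycle n E ds x xs → Cycle n E ds y ys
  resp-↭ p w c .closed = w
  resp-↭ p w c .unique = Unique-resp-↭ p (unique c)
  resp-↭ {xs = xs} {ys = ys} p w c .long with ↭-length p
  ... | eq = subst (2 ≤_) (cong (λ { zero → zero ; (suc k) → k }) eq) (long c)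
  resp-↭ p w c .sound v∈ = sound c (∈-resp-↭ (↭-sym p) v∈)
  resp-↭ p w c .complete v< v∉ = ∈-resp-↭ p (complete c v< v∉)

  rotate : ∀ {x xs w} → Cycle n E ds x xs → w ∈ x ∷ xs → ∃[ ys ] Cycle n E ds w ys
  rotate c (here refl) = _ , c
  rotate {x} c (there w∈) with ∈-∃++ w∈
  ... | as , bs , refl with split as (closed c)
  ... | w₁ , w₂ = bs ++ x ∷ as , resp-↭ (++-comm (x ∷ as) _) (w₂ ▷ w₁) c

  flip : Symmetric E → ∀ {x xs} → Cycle n E ds x xs → Cycle n E ds x (reverse xs)
  flip s {x} {xs} c = resp-↭ (prep x (↭-sym (↭-reverse xs))) (reverseʷ s (closed c)) c

-- Products of graphs with rotations

unique-map : {A B : Set} {P : A → Set} (f : A → B) →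
             (∀ {x y} → P x → P y → f x ≡ f y → x ≡ y) →
             ∀ {xs} → All P xs → Unique xs → Unique (map f xs)
unique-map f inj []       []       = []
unique-map f inj (p ∷ ps) (x∉ ∷ u) =
  All.map⁺ (All.zipWith (λ { (q , x≢y) eq → x≢y (inj p q eq) }) (ps , x∉)) ∷ unique-map f inj ps u

head∉ : {A : Set} {x : A} {xs : List A} → Unique (x ∷ xs) → x ∉ xs
head∉ = Unique.Unique[x∷xs]⇒x∉xs

-- A simple graph on the vertices 0, …, order - 1 in which rot u lists the
-- neighbours of u in their cyclic order.
record Net : Set where
  field
    order  : ℕ
    rot    : ℕ → List ℕ
    bound  : ∀ {u v} → v ∈ rot u → u < order
    symm   : ∀ {u v} → v ∈ rot u → u ∈ rot v
    irrefl : ∀ {u} → u ∉ rot u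
    uniq   : ∀ u → Unique (rot u)

  Edge : ℕ → ℕ → Set
  Edge u v = v ∈ rot u

open Net public

-- Every neighbour lists `x` first, so that `tl` is its rotation cut open at `x`. The product
-- concatenates two such opened rotations.
record Apex (G : Net) (x : ℕ) : Set where
  field
    nb     : Fin 3 → ℕ
    nb-inj : ∀ {i j} → nb i ≡ nb j → i ≡ j
    rot-x  : rot G x ≡ nb 0F ∷ nb 1F ∷ nb 2F ∷ []
    tl     : Fin 3 → List ℕ
    rot-nb : ∀ i → rot G (nb i) ≡ x ∷ tl i

  nb∈ : ∀ i → nb i ∈ rot G x
  nb∈ i rewrite rot-x with i
  ... | 0F = here refl
  ... | 1F = there (here refl)
  ... | 2F = there (there (here refl))

  ∈nb : ∀ {v} → v ∈ rot G x → ∃[ i ] v ≡ nb i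
  ∈nb v∈ rewrite rot-x with v∈
  ... | here eq                 = 0F , eq
  ... | there (here eq)         = 1F , eq
  ... | there (there (here eq)) = 2F , eq

  nb≢ : ∀ i → nb i ≢ x
  nb≢ i eq = irrefl G (subst (_∈ rot G x) eq (nb∈ i))

  tl⊆ : ∀ i {v} → v ∈ tl i → v ∈ rot G (nb i)
  tl⊆ i v∈ rewrite rot-nb i = there v∈

  ∈tl : ∀ i {v} → v ≢ x → v ∈ rot G (nb i) → v ∈ tl i
  ∈tl i v≢x v∈ rewrite rot-nb i with v∈
  ... | here eq  = ⊥-elim (v≢x eq)
  ... | there v∈′ = v∈′

  unique-tl : ∀ i → Unique (x ∷ tl i)
  unique-tl i = subst Unique (rot-nb i) (uniq G (nb i))

  tl≢ : ∀ i {v} → v ∈ tl i → v ≢ x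
  tl≢ i v∈ refl = head∉ (unique-tl i) v∈

  onlyNb : ∀ {v} → x ∈ rot G v → ∃[ i ] v ≡ nb i
  onlyNb x∈ = ∈nb (symm G x∈)

open Apex public

-- The reflection of the three apex neighbours: seen from the other side of the
-- cut, the cyclic order is reversed.
opp : Fin 3 → Fin 3
opp 0F = 0F
opp 1F = 2F
opp 2F = 1F

opp-opp : ∀ i → opp (opp i) ≡ i
opp-opp 0F = refl
opp-opp 1F = refl
opp-opp 2F = refl

terminal : Fin 3 → ℕ
terminal 0F = 2
terminal 1F = 3
terminal 2F = 4

-- The second factor of a product.  Vertex 0 is the apex that is cut off, with
-- neighbours 2, 3, 4; vertex 1 becomes the apex of the product.
record Link (k : ℕ) : Set where
  field
    net    : Net
    size   : order net ≡ 5 + k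
    base   : Apex net 0
    std    : ∀ i → nb base i ≡ terminal i
    next   : Apex net 1
    far    : ∀ i → 5 ≤ nb next i
    indep  : ∀ i j → terminal j ∉ rot net (terminal i)

module Glue (G : Net) (A : Apex G 0) {k : ℕ} (L : Link k) where

  open Link L renaming (net to H; base to B; next to C)

  m : ℕ
  m = order G

  a : Fin 3 → ℕ
  a = nb A

  a<m : ∀ i → a i < m
  a<m i = bound G (symm G (nb∈ A i))

  a≢0 : ∀ i → a i ≢ 0
  a≢0 = nb≢ A

  0<m : 0 < m
  0<m = bound G (nb∈ A 0F)

  -- The names of the vertices of `H` in the product. The label 0, freed by the apex of `G`, goes to
  -- vertex 1, so that the product can be glued at 0 again; 3 and 4 are exchanged as prescribed by
  -- `opp`. The value at 0 is a default for the deleted apex, excluded by a hypothesis wherever `σ`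
  -- is inverted.
  σ : ℕ → ℕ
  σ 0 = 0
  σ 1 = 0
  σ 2 = a 0F
  σ 3 = a 2F
  σ 4 = a 1F
  σ (suc (suc (suc (suc (suc j))))) = m + j

  σ-term : ∀ i → σ (terminal i) ≡ a (opp i)
  σ-term 0F = refl
  σ-term 1F = refl
  σ-term 2F = refl

  data Src : ℕ → Set where
    apex  : Src 1
    term  : ∀ i → Src (terminal i)
    inner : ∀ j → Src (5 + j)

  src : ∀ v → v ≢ 0 → Src v
  src 0 ≢0 = ⊥-elim (≢0 refl)
  src 1 _  = apex
  src 2 _  = term 0F
  src 3 _  = term 1F
  src 4 _  = term 2F
  src (suc (suc (suc (suc (suc j))))) _ = inner j

  src≢0 : ∀ {v} → Src v → v ≢ 0
  src≢0 (term 0F) ()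
  src≢0 (term 1F) ()
  src≢0 (term 2F) ()

  0≢m+ : ∀ j → 0 ≢ m + j
  0≢m+ j eq = <-irrefl eq (<-≤-trans 0<m (m≤m+n m j))

  a≢m+ : ∀ i j → a i ≢ m + j
  a≢m+ i j eq = m+n≮m m j (subst (_< m) eq (a<m i))

  opp-inj : ∀ {i j} → opp i ≡ opp j → i ≡ j
  opp-inj {i} {j} eq = trans (sym (opp-opp i)) (trans (cong opp eq) (opp-opp j))

  σ-inj′ : ∀ {u v} → Src u → Src v → σ u ≡ σ v → u ≡ v
  σ-inj′ apex apex _ = refl
  σ-inj′ apex (term i) eq = ⊥-elim (a≢0 (opp i) (trans (sym (σ-term i)) (sym eq)))
  σ-inj′ apex (inner j) eq = ⊥-elim (0≢m+ j eq)
  σ-inj′ (term i) apex eq = ⊥-elim (a≢0 (opp i) (trans (sym (σ-term i)) eq))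
  σ-inj′ (term i) (term j) eq =
    cong terminal (opp-inj (nb-inj A (trans (sym (σ-term i)) (trans eq (σ-term j)))))
  σ-inj′ (term i) (inner j) eq = ⊥-elim (a≢m+ (opp i) j (trans (sym (σ-term i)) eq))
  σ-inj′ (inner j) apex eq = ⊥-elim (0≢m+ j (sym eq))
  σ-inj′ (inner j) (term i) eq = ⊥-elim (a≢m+ (opp i) j (trans (sym (σ-term i)) (sym eq)))
  σ-inj′ (inner i) (inner j) eq = cong (5 +_) (+-cancelˡ-≡ m i j eq)

  σ-inj : ∀ {u v} → u ≢ 0 → v ≢ 0 → σ u ≡ σ v → u ≡ v
  σ-inj u≢ v≢ = σ-inj′ (src _ u≢) (src _ v≢)

  data View (v : ℕ) : Set where
    apex  : v ≡ 0 → View v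
    term  : ∀ i → v ≡ a i → View v
    left  : v ≢ 0 → v < m → (∀ i → v ≢ a i) → View v
    right : ∀ j → v ≡ m + j → View v

  view : ∀ v → View v
  view v with v ≟ 0 | v ≟ a 0F | v ≟ a 1F | v ≟ a 2F | v <? m
  ... | yes p | _     | _     | _     | _     = apex p
  ... | no _  | yes p | _     | _     | _     = term 0F p
  ... | no _  | no _  | yes p | _     | _     = term 1F p
  ... | no _  | no _  | no _  | yes p | _     = term 2F p
  ... | no q  | no p₀ | no p₁ | no p₂ | yes l = left q l (λ { 0F → p₀ ; 1F → p₁ ; 2F → p₂ })
  ... | no _  | no _  | no _  | no _  | no ≮m = right (v ∸ m) (sym (m+[n∸m]≡n (≮⇒≥ ≮m)))

  -- At an identified vertex the neighbours from `G` form one interval of the cyclic order and those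
  -- from `H` the other: each interval fills the gap that the deleted apex leaves in the other
  -- rotation.
  rotᵛ : ∀ {v} → View v → List ℕ
  rotᵛ (apex _)         = map σ (rot H 1)
  rotᵛ (term i _)       = tl A i ++ map σ (tl B (opp i))
  rotᵛ {v} (left _ _ _) = rot G v
  rotᵛ (right j _)      = map σ (rot H (5 + j))

  rotP : ℕ → List ℕ
  rotP v = rotᵛ (view v)

  rotP-apex : rotP 0 ≡ map σ (rot H 1)
  rotP-apex with view 0
  ... | apex _ = refl
  ... | term i eq = ⊥-elim (a≢0 i (sym eq))
  ... | left q _ _ = ⊥-elim (q refl)
  ... | right j eq = ⊥-elim (0≢m+ j eq)

  rotP-term : ∀ i → rotP (a i) ≡ tl A i ++ map σ (tl B (opp i))
  rotP-term i with view (a i)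
  ... | apex eq = ⊥-elim (a≢0 i eq)
  ... | term j eq with nb-inj A eq
  ...   | refl = refl
  rotP-term i | left _ _ q = ⊥-elim (q i refl)
  rotP-term i | right j eq = ⊥-elim (a≢m+ i j eq)

  rotP-left : ∀ {v} → v ≢ 0 → v < m → (∀ i → v ≢ a i) → rotP v ≡ rot G v
  rotP-left {v} v≢0 v<m v≢a with view v
  ... | apex eq = ⊥-elim (v≢0 eq)
  ... | term j eq = ⊥-elim (v≢a j eq)
  ... | left _ _ _ = refl
  ... | right j refl = ⊥-elim (m+n≮m m j v<m)

  rotP-right : ∀ j → rotP (m + j) ≡ map σ (rot H (5 + j))
  rotP-right j with view (m + j)
  ... | apex eq = ⊥-elim (0≢m+ j (sym eq))
  ... | term i eq = ⊥-elim (a≢m+ i j (sym eq))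
  ... | left _ l _ = ⊥-elim (m+n≮m m j l)
  ... | right j′ eq with +-cancelˡ-≡ m j j′ eq
  ...   | refl = refl

  EP : ℕ → ℕ → Set
  EP u v = v ∈ rotP u

  data Origin (u v : ℕ) : Set where
    inG : u ≢ 0 → v ≢ 0 → Edge G u v → Origin u v
    inH : ∀ {u′ v′} → u′ ≢ 0 → v′ ≢ 0 → Edge H u′ v′ → u ≡ σ u′ → v ≡ σ v′ → Origin u v

  far′ : ∀ {v} → v ∈ rot H 1 → 5 ≤ v
  far′ v∈ with ∈nb C v∈
  ... | i , refl = far i

  5≤⇒≢0 : ∀ {v} → 5 ≤ v → v ≢ 0
  5≤⇒≢0 () refl

  near0 : ∀ {v} → 0 ∈ rot H v → ∃[ i ] v ≡ terminal i
  near0 0∈ with onlyNb B 0∈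
  ... | i , eq = i , trans eq (std i)

  inner≢0 : ∀ j {v} → v ∈ rot H (5 + j) → v ≢ 0
  inner≢0 j v∈ refl with near0 v∈
  ... | 0F , ()
  ... | 1F , ()
  ... | 2F , ()

  origin : ∀ {u v} → EP u v → Origin u v
  origin {u} v∈ with view u
  ... | apex refl with ∈-map⁻ σ v∈
  ...   | v′ , v′∈ , refl = inH {u′ = 1} (λ ()) (5≤⇒≢0 (far′ v′∈)) v′∈ refl refl
  origin {u} v∈ | term i refl with ∈-++⁻ (tl A i) v∈
  ...   | inj₁ v∈G = inG (a≢0 i) (tl≢ A i v∈G) (tl⊆ A i v∈G)
  ...   | inj₂ v∈H with ∈-map⁻ σ v∈H
  ...     | v′ , v′∈ , refl = inH (src≢0 (term (opp i))) (tl≢ B (opp i) v′∈)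
              (subst (λ t → v′ ∈ rot H t) (std (opp i)) (tl⊆ B (opp i) v′∈))
              (sym (trans (σ-term (opp i)) (cong a (opp-opp i)))) refl
  origin {u} {v} v∈ | left u≢0 _ u≢a = inG u≢0 v≢0 v∈
    where
    v≢0 : v ≢ 0
    v≢0 refl with onlyNb A v∈
    ... | i , eq = u≢a i eq
  origin {u} v∈ | right j refl with ∈-map⁻ σ v∈
  ...   | v′ , v′∈ , refl = inH {u′ = 5 + j} (λ ()) (inner≢0 j v′∈) v′∈ refl refl

  fromG : ∀ {u v} → u ≢ 0 → v ≢ 0 → Edge G u v → EP u v
  fromG {u} u≢0 v≢0 v∈ with view u
  ... | apex eq = ⊥-elim (u≢0 eq)
  ... | term i refl = ∈-++⁺ˡ (∈tl A i v≢0 v∈)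
  ... | left _ _ _ = v∈
  ... | right j refl = ⊥-elim (m+n≮m m j (bound G v∈))

  fromH : ∀ {u v} → u ≢ 0 → v ≢ 0 → Edge H u v → EP (σ u) (σ v)
  fromH {u} {v} u≢0 v≢0 v∈ with src u u≢0
  ... | apex = subst (σ v ∈_) (sym rotP-apex) (∈-map⁺ σ v∈)
  ... | term i = subst (λ t → σ v ∈ rotP t) (sym (σ-term i))
      (subst (σ v ∈_) (sym (rotP-term (opp i)))
        (∈-++⁺ʳ (tl A (opp i)) (∈-map⁺ σ
          (subst (λ t → v ∈ tl B t) (sym (opp-opp i))
            (∈tl B i v≢0 (subst (λ t → v ∈ rot H t) (sym (std i)) v∈))))))
  ... | inner j = subst (σ v ∈_) (sym (rotP-right j)) (∈-map⁺ σ v∈)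

  σ<k : ∀ {v} → v ≢ 0 → v < order H → σ v < m + k
  σ<k {v} v≢0 v< with src v v≢0
  ... | apex = <-≤-trans 0<m (m≤m+n m k)
  ... | term i = <-≤-trans (subst (_< m) (sym (σ-term i)) (a<m (opp i))) (m≤m+n m k)
  ... | inner j = +-monoʳ-< m (+-cancelˡ-< 5 j k (subst (5 + j <_) size v<))

  boundP : ∀ {u v} → EP u v → u < m + k
  boundP e with origin e
  ... | inG _ _ e′ = <-≤-trans (bound G e′) (m≤m+n m k)
  ... | inH u≢0 _ e′ refl _ = σ<k u≢0 (bound H e′)

  symmP : ∀ {u v} → EP u v → EP v u
  symmP e with origin e
  ... | inG u≢0 v≢0 e′ = fromG v≢0 u≢0 (symm G e′)
  ... | inH u≢0 v≢0 e′ refl refl = fromH v≢0 u≢0 (symm H e′)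

  irreflP : ∀ {u} → ¬ EP u u
  irreflP e with origin e
  ... | inG _ _ e′ = irrefl G e′
  ... | inH {u′} u≢0 v≢0 e′ refl eq = irrefl H (subst (Edge H u′) (sym (σ-inj u≢0 v≢0 eq)) e′)

  data Interior : ℕ → Set where
    apex  : Interior 1
    inner : ∀ j → Interior (5 + j)

  interior≢0 : ∀ {v} → Interior v → v ≢ 0
  interior≢0 apex ()
  interior≢0 (inner j) ()

  interior≢term : ∀ {v} → Interior v → ∀ i → v ≢ terminal i
  interior≢term apex 0F ()
  interior≢term apex 1F ()
  interior≢term apex 2F ()
  interior≢term (inner j) 0F ()
  interior≢term (inner j) 1F ()
  interior≢term (inner j) 2F ()

  classify : ∀ v → v ≢ 0 → (∃[ i ] v ≡ terminal i) ⊎ Interior v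
  classify v v≢0 with src v v≢0
  ... | apex = inj₂ apex
  ... | term i = inj₁ (i , refl)
  ... | inner j = inj₂ (inner j)

  -- Interior vertices of `H` are sent to 0 or to numbers from `m` on, whereas what remains of `G`
  -- lies strictly between 0 and `m`. Most disjointness arguments below end here.
  σ-interior : ∀ {v w} → Interior v → w ≢ 0 → w < m → w ≢ σ v
  σ-interior apex w≢0 _ eq = w≢0 eq
  σ-interior (inner j) _ w<m refl = m+n≮m m j w<m

  uniqᵛ : ∀ {v} (q : View v) → Unique (rotᵛ q)
  uniqᵛ (apex _) = unique-map σ σ-inj (All.tabulate (λ v∈ → 5≤⇒≢0 (far′ v∈))) (uniq H 1)
  uniqᵛ (term i _) = Unique.++⁺ (drop1 (unique-tl A i))
    (unique-map σ σ-inj (All.tabulate (tl≢ B (opp i))) (drop1 (unique-tl B (opp i)))) disj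
    where
    drop1 : ∀ {x} {xs : List ℕ} → Unique (x ∷ xs) → Unique xs
    drop1 (_ ∷ u) = u
    disj : ∀ {w} → ¬ (w ∈ tl A i × w ∈ map σ (tl B (opp i)))
    disj (w∈ , w∈σ) with ∈-map⁻ σ w∈σ
    ... | w′ , w′∈ , refl with classify w′ (tl≢ B (opp i) w′∈)
    -- A neighbour supplied by both factors could only be an identified vertex, so two terminals of
    -- `H` would be adjacent.
    ...   | inj₁ (j , refl) = indep (opp i) j (subst (λ t → terminal j ∈ rot H t) (std (opp i)) (tl⊆ B (opp i) w′∈))
    ...   | inj₂ int = σ-interior int (tl≢ A i w∈) (bound G (symm G (tl⊆ A i w∈))) refl
  uniqᵛ {v} (left _ _ _) = uniq G v
  uniqᵛ (right j _) = unique-map σ σ-inj (All.tabulate (inner≢0 j)) (uniq H (5 + j))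

  P : Net
  P = record { order = m + k ; rot = rotP ; bound = boundP ; symm = symmP
             ; irrefl = irreflP ; uniq = λ v → uniqᵛ (view v) }

  next≢0 : ∀ i → nb C i ≢ 0
  next≢0 i = 5≤⇒≢0 (far i)

  rotP-next : ∀ {v} → 5 ≤ v → rotP (σ v) ≡ map σ (rot H v)
  rotP-next {suc (suc (suc (suc (suc j))))} _ = rotP-right j
  rotP-next {1} (s≤s ())
  rotP-next {2} (s≤s (s≤s ()))
  rotP-next {3} (s≤s (s≤s (s≤s ())))
  rotP-next {4} (s≤s (s≤s (s≤s (s≤s ()))))

  -- By `far` no neighbour of vertex 1 is identified with a vertex of `G`. The rotations of the new
  -- apex and its neighbours are therefore merely renamed, and the apex stays first in the latter.
  apexP : Apex P 0
  apexP = record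
    { nb = λ i → σ (nb C i)
    ; nb-inj = λ {i} {j} eq → nb-inj C (σ-inj (next≢0 i) (next≢0 j) eq)
    ; rot-x = trans rotP-apex (cong (map σ) (rot-x C))
    ; tl = λ i → map σ (tl C i)
    ; rot-nb = λ i → trans (rotP-next (far i)) (cong (map σ) (rot-nb C i))
    }

-- Hamiltonian cycles of a product

third : ∀ (i j : Fin 3) → i ≢ j → ∃[ k ] (k ≢ i × k ≢ j)
third = toWitness {a? = Fin.all? λ i → Fin.all? λ j → ¬? (i Fin.≟ j) →-dec
  Fin.any? λ k → ¬? (k Fin.≟ i) ×-dec ¬? (k Fin.≟ j)} tt

exhaust : ∀ (i j k : Fin 3) → i ≢ j → k ≢ i → k ≢ j → ∀ l → l ≡ i ⊎ l ≡ j ⊎ l ≡ k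
exhaust = toWitness {a? = Fin.all? λ i → Fin.all? λ j → Fin.all? λ k → ¬? (i Fin.≟ j) →-dec
  (¬? (k Fin.≟ i) →-dec (¬? (k Fin.≟ j) →-dec
  Fin.all? λ l → (l Fin.≟ i) ⊎-dec ((l Fin.≟ j) ⊎-dec (l Fin.≟ k))))} tt

unique-prefix : {A : Set} (xs : List A) {ys : List A} → Unique (xs ++ ys) → Unique xs
unique-prefix []       u        = []
unique-prefix (x ∷ xs) (x∉ ∷ u) = All.++⁻ˡ xs x∉ ∷ unique-prefix xs u

unique-suffix : {A : Set} (xs : List A) {ys : List A} → Unique (xs ++ ys) → Unique ys
unique-suffix []       u       = u
unique-suffix (_ ∷ xs) (_ ∷ u) = unique-suffix xs u

weakenʷ : {A : Set} {R S : A → A → Set} {P : A → Set} → (∀ {u v} → P u → P v → R u v → S u v) →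
          ∀ {x xs y} → P x → All P xs → P y → Walk R x xs y → Walk S x xs y
weakenʷ h px []        py (step r) = step (h px py r)
weakenʷ h px (pz ∷ ps) py (r ∷ w)  = h px pz r ∷ weakenʷ h pz ps py w

-- A Hamiltonian cycle read from the apex on: it leaves to `nb A i` and returns from `nb A j`.
-- Removing the apex leaves the Hamiltonian path `path`.
record Through (G : Net) (A : Apex G 0) (ds : List ℕ) (i j : Fin 3) : Set where
  field
    mid   : List ℕ
    cycle : Cycle (order G) (Edge G) ds 0 (nb A i ∷ mid ++ [ nb A j ])

  path : Walk (Edge G) (nb A i) mid (nb A j)
  path with closed cycle
  ... | _ ∷ w = proj₁ (split mid w)

open Through public

module _ {G : Net} (A : Apex G 0) where

  last-edge : ∀ xs {y z w} → Walk (Edge G) z (xs ++ [ y ]) w → Edge G y w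
  last-edge xs w with split xs w
  ... | _ , step r = r

  through : ∀ {ds} → Ham (order G) (Edge G) ds → 0 < order G → 0 ∉ ds →
            ∃[ i ] ∃[ j ] (i ≢ j × Through G A ds i j)
  through (_ , _ , c) 0< 0∉ with rotate c (complete c 0< 0∉)
  ... | [] , c′ with long c′
  ...   | ()
  through (_ , _ , c) 0< 0∉ | (x ∷ xs) , c′ with initLast xs
  through (_ , _ , c) 0< 0∉ | (x ∷ .[]) , c′ | [] with long c′
  ... | s≤s ()
  through (_ , _ , c) 0< 0∉ | (x ∷ .(xs ++ [ y ])) , c′ | xs ∷ʳ′ y with closed c′
  ... | r ∷ w with ∈nb A r | ∈nb A (symm G (last-edge xs w))
  ...   | i , refl | j , refl = i , j , i≢j , record { mid = xs ; cycle = c′ }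
    where
    i≢j : i ≢ j
    i≢j refl with unique c′
    ... | _ ∷ u = head∉ u (∈-++⁺ʳ xs (here refl))

  turn-round : ∀ {ds i j} → Through G A ds i j → Through G A ds j i
  turn-round {i = i} {j} t = record { mid = reverse (mid t)
    ; cycle = subst (Cycle _ _ _ 0) eq (flip (symm G) (cycle t)) }
    where
    eq : reverse (nb A i ∷ mid t ++ [ nb A j ]) ≡ nb A j ∷ reverse (mid t) ++ [ nb A i ]
    eq = trans (unfold-reverse (nb A i) (mid t ++ [ nb A j ])) (cong (_++ [ nb A i ]) (reverse-++ (mid t) [ nb A j ]))

  avoids₁ : ∀ {ds i j} → Through G A ds i j → nb A i ∉ ds
  avoids₁ t = proj₂ (sound (cycle t) (there (here refl)))

  avoids₂ : ∀ {ds i j} → Through G A ds i j → nb A j ∉ ds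
  avoids₂ t = proj₂ (sound (cycle t) (there (there (∈-++⁺ʳ (mid t) (here refl)))))

  mid≢ : ∀ {ds i j v} → (t : Through G A ds i j) → v ∈ mid t → v ≢ 0 × v ≢ nb A i × v ≢ nb A j
  mid≢ {i = i} {j} t v∈ with unique (cycle t)
  ... | u₀ ∷ u₁ ∷ u₂ =
      (λ { refl → head∉ (u₀ ∷ u₁ ∷ u₂) (there (∈-++⁺ˡ v∈)) })
    , (λ { refl → head∉ (u₁ ∷ u₂) (∈-++⁺ˡ v∈) })
    , λ { refl → head∉ (Unique-resp-↭ (++-comm (mid t) [ nb A j ]) u₂) v∈ }

module _ (G : Net) (A : Apex G 0) where

  NonHam : Set
  NonHam = ¬ Ham (order G) (Edge G) []

  HamEdges : (ℕ → Set) → Set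
  HamEdges Q = ∀ {u v} → Q u → Q v → Edge G u v → Ham (order G) (Edge G) (u ∷ v ∷ [])

  HamNbs : ∀ {x} → Apex G x → Set
  HamNbs B = ∀ i → Ham (order G) (Edge G) [ nb B i ]

module Splice (G : Net) (A : Apex G 0) {k : ℕ} (L : Link k) where

  open Link L renaming (net to H; base to B; next to C)
  open Glue G A L

  InG : ℕ → Set
  InG v = v ≢ 0 × v < m

  in-G : ∀ i → InG (a i)
  in-G i = a≢0 i , a<m i

  locate : ∀ {w} → w < m + k → InG w ⊎ ∃[ w′ ] (Interior w′ × w ≡ σ w′ × w′ < order H)
  locate {w} w< with view w
  ... | apex refl = inj₂ (1 , apex , refl , subst (1 <_) (sym size) (s≤s (s≤s z≤n)))
  ... | term i refl = inj₁ (in-G i)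
  ... | left q l _ = inj₁ (q , l)
  ... | right j refl = inj₂ (5 + j , inner j , refl , subst (5 + j <_) (sym size) (+-monoʳ-< 5 (+-cancelˡ-< m j k w<)))

  t≡ : ∀ i → σ (nb B i) ≡ a (opp i)
  t≡ i = trans (cong σ (std i)) (σ-term i)

  module _ {dG dH : List ℕ} {i j : Fin 3} (p : Through G A dG i j) (q : Through H B dH (opp j) (opp i)) where

    mid-q≢0 : All (_≢ 0) (mid q)
    mid-q≢0 = All.tabulate λ v∈ → proj₁ (mid≢ B q v∈)

    p∈ : ∀ {w} → w ∈ a i ∷ mid p ++ [ a j ] → InG w × w ∉ dG
    p∈ w∈ with sound (cycle p) (there w∈)
    ... | w<m , w∉ = ((λ { refl → head∉ (unique (cycle p)) w∈ }) , w<m) , w∉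

    -- The cycle follows the path of `p` from `a i` to `a j` and returns along that of `q`. By `dis`
    -- the third identified vertex is deleted in at least one factor, so the two paths share only
    -- their ends; by `cov` each vertex to be visited is present in one of the factors and not
    -- deleted there.
    splice : ∀ {ds} →
      (∀ {w} → w ∈ a i ∷ mid p ++ [ a j ] → w ∉ ds) →
      (∀ {w} → w ∈ mid q → σ w ∉ ds) →
      (∀ l → l ≢ i → l ≢ j → a l ∈ dG ⊎ nb B (opp l) ∈ dH) →
      (∀ {w} → w < m + k → w ∉ ds →
        (InG w × w ∉ dG) ⊎ ∃[ w′ ] (w′ ≢ 0 × w ≡ σ w′ × w′ < order H × w′ ∉ dH)) →
      Ham (m + k) EP ds
    splice {ds} s₁ s₂ dis cov = a i , mid p ++ a j ∷ map σ (mid q) , record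
      { closed = weakenʷ {P = InG} (λ pu pv e → fromG (proj₁ pu) (proj₁ pv) e) (in-G i)
          (All.tabulate λ v∈ → proj₁ (p∈ (there (∈-++⁺ˡ v∈)))) (in-G j) (path p)
          ▷ subst₂ (λ x y → Walk EP x (map σ (mid q)) y) (nbσ j) (nbσ i)
              (mapʷ fromH (nb≢ B (opp j)) mid-q≢0 (nb≢ B (opp i)) (path q))
      ; unique = subst Unique eq (Unique.++⁺ uniq-p (unique-map σ σ-inj mid-q≢0 uniq-q) disj)
      ; long = long′ (mid p) (mid q) (path q)
      ; sound = λ {w} w∈ → snd (subst (w ∈_) (sym eq) w∈)
      ; complete = λ {w} w< w∉ → subst (w ∈_) eq (cpl (cov w< w∉))
      }
      where
      pl = a i ∷ mid p ++ [ a j ]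
      eq : pl ++ map σ (mid q) ≡ a i ∷ mid p ++ a j ∷ map σ (mid q)
      eq = cong (a i ∷_) (++-assoc (mid p) [ a j ] (map σ (mid q)))
      nbσ : ∀ l → σ (nb B (opp l)) ≡ a l
      nbσ l = trans (t≡ (opp l)) (cong a (opp-opp l))
      uniq-p : Unique pl
      uniq-p with unique (cycle p)
      ... | _ ∷ u = u
      uniq-q : Unique (mid q)
      uniq-q with unique (cycle q)
      ... | _ ∷ _ ∷ u = unique-prefix (mid q) u
      q∈ : ∀ {w} → w ∈ mid q → w < order H × w ∉ dH
      q∈ w∈ = sound (cycle q) (there (there (∈-++⁺ˡ w∈)))
      disj : ∀ {w} → ¬ (w ∈ pl × w ∈ map σ (mid q))
      disj (w∈p , w∈q) with ∈-map⁻ σ w∈q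
      ... | w′ , w′∈ , refl with mid≢ B q w′∈
      ...   | w′≢0 , w′≢j , w′≢i with classify w′ w′≢0
      ...     | inj₂ int = σ-interior int (proj₁ (proj₁ (p∈ w∈p))) (proj₂ (proj₁ (p∈ w∈p))) refl
      ...     | inj₁ (l , refl) with dis (opp l) (λ { refl → w′≢i (trans (cong terminal (sym (opp-opp l))) (sym (std (opp (opp l))))) })
                                        (λ { refl → w′≢j (trans (cong terminal (sym (opp-opp l))) (sym (std (opp (opp l))))) })
      ...       | inj₁ al∈ = proj₂ (p∈ w∈p) (subst (_∈ dG) (sym (σ-term l)) al∈)
      ...       | inj₂ tl∈ = proj₂ (q∈ w′∈) (subst (_∈ dH) (trans (std (opp (opp l))) (cong terminal (opp-opp l))) tl∈)
      long′ : ∀ xs ys → Walk (Edge H) (nb B (opp j)) ys (nb B (opp i)) → 2 ≤ length (xs ++ a j ∷ map σ ys)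
      -- An empty inner path in `H` would be an edge between two terminals, so the way back supplies
      -- a third vertex.
      long′ xs [] (step r) = ⊥-elim (indep (opp j) (opp i) (subst₂ (λ s t → t ∈ rot H s) (std (opp j)) (std (opp i)) r))
      long′ [] (_ ∷ _) _ = s≤s (s≤s z≤n)
      long′ (_ ∷ []) (_ ∷ _) _ = s≤s (s≤s z≤n)
      long′ (_ ∷ _ ∷ _) (_ ∷ _) _ = s≤s (s≤s z≤n)
      snd : ∀ {w} → w ∈ pl ++ map σ (mid q) → w < m + k × w ∉ ds
      snd w∈ with ∈-++⁻ pl w∈
      ... | inj₁ w∈p = <-≤-trans (proj₂ (proj₁ (p∈ w∈p))) (m≤m+n m k) , s₁ w∈p
      ... | inj₂ w∈q with ∈-map⁻ σ w∈q
      ...   | w′ , w′∈ , refl = σ<k (proj₁ (mid≢ B q w′∈)) (proj₁ (q∈ w′∈)) , s₂ w′∈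
      cpl : ∀ {w} → (InG w × w ∉ dG) ⊎ ∃[ w′ ] (w′ ≢ 0 × w ≡ σ w′ × w′ < order H × w′ ∉ dH) →
            w ∈ pl ++ map σ (mid q)
      cpl (inj₁ ((w≢0 , w<m) , w∉)) with complete (cycle p) w<m w∉
      ... | here w≡0 = ⊥-elim (w≢0 w≡0)
      ... | there w∈ = ∈-++⁺ˡ w∈
      cpl (inj₂ (w′ , w′≢0 , refl , w′< , w′∉)) with complete (cycle q) w′< w′∉
      ... | here w≡0 = ⊥-elim (w′≢0 w≡0)
      ... | there (here refl) = ∈-++⁺ˡ (subst (_∈ pl) (sym (nbσ j)) (there (∈-++⁺ʳ (mid p) (here refl))))
      ... | there (there w∈) with ∈-++⁻ (mid q) w∈
      ...   | inj₁ w∈q = ∈-++⁺ʳ pl (∈-map⁺ σ w∈q)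
      ...   | inj₂ (here refl) = ∈-++⁺ˡ (subst (_∈ pl) (sym (nbσ i)) (here refl))

  0<order : 0 < order H
  0<order = subst (0 <_) (sym size) (s≤s z≤n)

  -- Both pairs of ends avoid the third terminal, so they agree up to order.
  opaque
    align : ∀ {i j l i′ j′} → i ≢ j → l ≢ i → l ≢ j → i′ ≢ j′ → opp l ≢ i′ → opp l ≢ j′ →
            ∀ {dH} → Through H B dH i′ j′ → Through H B dH (opp j) (opp i)
    align {i} {j} {l} {i′} {j′} i≢j l≢i l≢j i′≢j′ ol≢i′ ol≢j′ t
      with exhaust i j l i≢j l≢i l≢j (opp i′) | exhaust i j l i≢j l≢i l≢j (opp j′)
    ... | inj₁ refl | inj₁ eq = ⊥-elim (i′≢j′ (sym (opp-inj eq)))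
    ... | inj₁ refl | inj₂ (inj₁ refl) = subst₂ (Through H B _) (sym (opp-opp j′)) (sym (opp-opp i′)) (turn-round B t)
    ... | inj₂ (inj₁ refl) | inj₁ refl = subst₂ (Through H B _) (sym (opp-opp i′)) (sym (opp-opp j′)) t
    ... | inj₂ (inj₁ refl) | inj₂ (inj₁ eq) = ⊥-elim (i′≢j′ (sym (opp-inj eq)))
    ... | inj₂ (inj₂ refl) | _ = ⊥-elim (ol≢i′ (opp-opp i′))
    ... | _ | inj₂ (inj₂ refl) = ⊥-elim (ol≢j′ (opp-opp j′))

  nb-opp : ∀ {x y} → opp x ≡ y → nb B (opp y) ≡ terminal x
  nb-opp {x} refl = trans (std (opp (opp x))) (cong terminal (opp-opp x))

  which : ∀ {i j l} → i ≢ j → l ≢ i → l ≢ j → ∀ x →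
          nb B (opp i) ≡ terminal x ⊎ nb B (opp j) ≡ terminal x ⊎ opp x ≡ l
  which {i} {j} {l} i≢j l≢i l≢j x =
    Sum.map nb-opp (Sum.map₁ nb-opp) (exhaust i j l i≢j l≢i l≢j (opp x))

  other : ∀ {i j l} → i ≢ j → l ≢ i → l ≢ j → ∀ x → x ≢ i → x ≢ j → x ≡ l
  other {i} {j} {l} i≢j l≢i l≢j x x≢i x≢j =
    Sum.[ (λ eq → ⊥-elim (x≢i eq)) , Sum.[ (λ eq → ⊥-elim (x≢j eq)) , (λ eq → eq) ]′ ]′
      (exhaust i j l i≢j l≢i l≢j x)

  spliceG : ∀ {u v i j l} → u ≢ 0 → v ≢ 0 → u < m → v < m → i ≢ j → l ≢ i → l ≢ j →
            Through G A (u ∷ v ∷ []) i j → Through H B [ nb B (opp l) ] (opp j) (opp i) →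
            Ham (m + k) EP (u ∷ v ∷ [])
  spliceG {u} {v} {i} {j} {l} u≢0 v≢0 u<m v<m i≢j l≢i l≢j p q = splice p q s₁ s₂ dis cov
    where
    s₁ : ∀ {w} → w ∈ a i ∷ mid p ++ [ a j ] → w ∉ u ∷ v ∷ []
    s₁ w∈ = proj₂ (p∈ p q w∈)
    uv-G : ∀ {w} → w ∈ u ∷ v ∷ [] → InG w
    uv-G (here refl) = u≢0 , u<m
    uv-G (there (here refl)) = v≢0 , v<m
    s₂ : ∀ {w} → w ∈ mid q → σ w ∉ u ∷ v ∷ []
    s₂ {w} w∈ σw∈ with mid≢ B q w∈
    ... | w≢0 , w≢j , w≢i with classify w w≢0
    ...   | inj₂ int = σ-interior int (proj₁ (uv-G σw∈)) (proj₂ (uv-G σw∈)) refl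
    ...   | inj₁ (x , refl) = Sum.[ (λ eq → w≢i (sym eq)) , Sum.[ (λ eq → w≢j (sym eq))
              , (λ eq → proj₂ (sound (cycle q) (there (there (∈-++⁺ˡ w∈)))) (here (sym (nb-opp eq)))) ]′ ]′
              (which i≢j l≢i l≢j x)
    dis : ∀ x → x ≢ i → x ≢ j → a x ∈ u ∷ v ∷ [] ⊎ nb B (opp x) ∈ [ nb B (opp l) ]
    dis x x≢i x≢j = inj₂ (here (cong (λ y → nb B (opp y)) (other i≢j l≢i l≢j x x≢i x≢j)))
    cov : ∀ {w} → w < m + k → w ∉ u ∷ v ∷ [] →
          (InG w × w ∉ u ∷ v ∷ []) ⊎ ∃[ w′ ] (w′ ≢ 0 × w ≡ σ w′ × w′ < order H × w′ ∉ [ nb B (opp l) ])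
    cov w< w∉ with locate w<
    ... | inj₁ w∈G = inj₁ (w∈G , w∉)
    ... | inj₂ (w′ , int , eq , w′<) = inj₂ (w′ , interior≢0 int , eq , w′< ,
            λ { (here eq′) → interior≢term int (opp l) (trans eq′ (std (opp l))) })

  hamG : HamNbs H B B → ∀ {u v} → u ≢ 0 → v ≢ 0 → u < m → v < m →
         Ham m (Edge G) (u ∷ v ∷ []) → Ham (m + k) EP (u ∷ v ∷ [])
  hamG k1 {u} {v} u≢0 v≢0 u<m v<m h with through A h 0<m (λ { (here eq) → u≢0 (sym eq) ; (there (here eq)) → v≢0 (sym eq) })
  ... | i , j , i≢j , p with third i j i≢j
  ...   | l , l≢i , l≢j with through B (k1 (opp l)) 0<order (λ { (here eq) → nb≢ B (opp l) (sym eq) })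
  ...     | i′ , j′ , i′≢j′ , q = spliceG u≢0 v≢0 u<m v<m i≢j l≢i l≢j p
              (align i≢j l≢i l≢j i′≢j′ (λ { refl → avoids₁ B q (here refl) }) (λ { refl → avoids₂ B q (here refl) }) q)

  spliceH : ∀ {dH i j l} → 0 ∉ dH → i ≢ j → l ≢ i → l ≢ j →
            Through G A [ a l ] i j → Through H B dH (opp j) (opp i) → Ham (m + k) EP (map σ dH)
  spliceH {dH} {i} {j} {l} 0∉ i≢j l≢i l≢j p q = splice p q s₁ s₂ dis cov
    where
    d≢0 : ∀ {d} → d ∈ dH → d ≢ 0
    d≢0 d∈ refl = 0∉ d∈
    s₁ : ∀ {w} → w ∈ a i ∷ mid p ++ [ a j ] → w ∉ map σ dH
    s₁ w∈ w∈σ with ∈-map⁻ σ w∈σ | p∈ p q w∈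
    ... | d , d∈ , refl | (w≢0 , w<m) , w∉ with classify d (d≢0 d∈)
    ...   | inj₂ int = σ-interior int w≢0 w<m refl
    ...   | inj₁ (x , refl) = Sum.[ (λ eq → avoids₂ B q (subst (_∈ dH) (sym eq) d∈))
              , Sum.[ (λ eq → avoids₁ B q (subst (_∈ dH) (sym eq) d∈))
              , (λ eq → w∉ (here (trans (σ-term x) (cong a eq)))) ]′ ]′ (which i≢j l≢i l≢j x)
    s₂ : ∀ {w} → w ∈ mid q → σ w ∉ map σ dH
    s₂ w∈ w∈σ with ∈-map⁻ σ w∈σ
    ... | d , d∈ , eq with σ-inj (proj₁ (mid≢ B q w∈)) (d≢0 d∈) eq
    ...   | refl = proj₂ (sound (cycle q) (there (there (∈-++⁺ˡ w∈)))) d∈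
    dis : ∀ x → x ≢ i → x ≢ j → a x ∈ [ a l ] ⊎ nb B (opp x) ∈ dH
    dis x x≢i x≢j = inj₁ (here (cong a (other i≢j l≢i l≢j x x≢i x≢j)))
    cov : ∀ {w} → w < m + k → w ∉ map σ dH →
          (InG w × w ∉ [ a l ]) ⊎ ∃[ w′ ] (w′ ≢ 0 × w ≡ σ w′ × w′ < order H × w′ ∉ dH)
    cov {w} w< w∉ with locate w<
    ... | inj₂ (w′ , int , refl , w′<) = inj₂ (w′ , interior≢0 int , refl , w′< , λ d∈ → w∉ (∈-map⁺ σ d∈))
    ... | inj₁ w∈G with w ≟ a l
    ...   | no w≢ = inj₁ (w∈G , λ { (here eq) → w≢ eq })
    -- The third identified vertex is missing from the path in `G`, but the cycle of `H` visits its
    -- copy unless that is deleted.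
    ...   | yes refl = inj₂ (terminal (opp l) , src≢0 (term (opp l)) , σl , bound H (symm H tm∈) , λ d∈ → w∉ (subst (_∈ map σ dH) (sym σl) (∈-map⁺ σ d∈)))
      where
      σl : a l ≡ σ (terminal (opp l))
      σl = sym (trans (σ-term (opp l)) (cong a (opp-opp l)))
      tm∈ : terminal (opp l) ∈ rot H 0
      tm∈ = subst (_∈ rot H 0) (std (opp l)) (nb∈ B (opp l))

  -- Stated for any list of deletions because it serves twice: with two entries for the edges of
  -- `H`, with one for the neighbours of the new apex.
  hamH : HamNbs G A A → ∀ {dH} → 0 ∉ dH → Ham (order H) (Edge H) dH → Ham (m + k) EP (map σ dH)
  hamH k1 {dH} 0∉ h with through B h 0<order 0∉
  ... | i′ , j′ , i′≢j′ , q with third i′ j′ i′≢j′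
  ...   | l , l≢i′ , l≢j′ with through A (k1 (opp l)) 0<m (λ { (here eq) → a≢0 (opp l) (sym eq) })
  ...     | i , j , i≢j , p = spliceH 0∉ i≢j l≢i l≢j p
              (align i≢j l≢i l≢j i′≢j′ (λ eq → l≢i′ (trans (sym (opp-opp l)) eq)) (λ eq → l≢j′ (trans (sym (opp-opp l)) eq)) q)
    where
    l≢i : opp l ≢ i
    l≢i refl = avoids₁ A p (here refl)
    l≢j : opp l ≢ j
    l≢j refl = avoids₂ A p (here refl)

  -- Arcs of a Hamiltonian cycle between the identified vertices

  GOnly : ℕ → Set
  GOnly w = InG w × ∀ i → w ≢ a i

  HOnly : ℕ → Set
  HOnly w = ∃[ w′ ] (Interior w′ × w ≡ σ w′)

  stepG : ∀ {u v} → EP u v → GOnly u → (∀ i → v ≢ a i) → GOnly v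
  stepG {u} {v} e ((u≢0 , u<m) , u≢a) v≢a with origin {u} {v} e
  ... | inG _ v≢0 e′ = (v≢0 , bound G (symm G e′)) , v≢a
  ... | inH {u′} u′≢0 _ _ refl _ with classify u′ u′≢0
  ...   | inj₁ (i , refl) = ⊥-elim (u≢a (opp i) (σ-term i))
  ...   | inj₂ int = ⊥-elim (σ-interior int u≢0 u<m refl)

  stepH : ∀ {u v} → EP u v → HOnly u → (∀ i → v ≢ a i) → HOnly v
  stepH {u} {v} e (u′ , int , refl) v≢a with origin {u} {v} e
  ... | inG u≢0 _ e′ = ⊥-elim (σ-interior int u≢0 (bound G e′) refl)
  ... | inH {v′ = v′} _ v′≢0 _ _ refl with classify v′ v′≢0
  ...   | inj₁ (i , refl) = ⊥-elim (v≢a (opp i) (σ-term i))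
  ...   | inj₂ int′ = v′ , int′ , refl

  NonTerm : ℕ → Set
  NonTerm w = w < m + k × (∀ i → w ≢ a i)

  -- Edges connect the two sides only through identified vertices, so an arc that avoids these keeps
  -- the side on which it starts.
  spread : {Q : ℕ → Set} → (∀ {u v} → EP u v → Q u → (∀ i → v ≢ a i) → Q v) →
           ∀ {x xs y} → Q x → All NonTerm xs → Walk EP x xs y → All Q xs
  spread f qx []              (step _) = []
  spread f qx ((_ , nt) ∷ ns) (e ∷ w)  = f e qx nt ∷ spread f (f e qx nt) ns w

  -- An empty arc is counted on the side of `G`: by `indep` an edge between two identified vertices
  -- cannot come from `H`. Arcs on the side of `H` are recorded as non-empty, because `lift` needs
  -- an interior end at each of their edges.
  pure : ∀ {x xs y} → Walk EP x xs y → All NonTerm xs → All GOnly xs ⊎ (All HOnly xs × xs ≢ [])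
  pure (step _) [] = inj₁ []
  pure (_ ∷ w) ((z< , nt) ∷ ns) with locate z<
  ... | inj₁ z∈G = inj₁ ((z∈G , nt) ∷ spread stepG (z∈G , nt) ns w)
  ... | inj₂ (z′ , int , eq , _) = inj₂ ((z′ , int , eq) ∷ spread stepH (z′ , int , eq) ns w , λ ())

  record Cut (i j l : Fin 3) (X Y Z : List ℕ) : Set where
    field
      i≢j : i ≢ j
      l≢i : l ≢ i
      l≢j : l ≢ j
      whole : Cycle (m + k) EP [] (a i) (X ++ a j ∷ Y ++ a l ∷ Z)

  open Cut

  -- Turning the cycle lets `closeG` and `closeH` assume that `Z` is the arc on the other side.
  turn-cut : ∀ {i j l X Y Z} → Cut i j l X Y Z → Cut j l i Y Z X
  turn-cut c .i≢j eq = l≢j c (sym eq)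
  turn-cut c .l≢i = i≢j c
  turn-cut c .l≢j eq = l≢i c (sym eq)
  turn-cut {i} {j} {l} {X} {Y} {Z} c .whole with split X (closed (whole c))
  ... | w₁ , w₂ with split Y w₂
  ...   | w₃ , w₄ = resp-↭ perm (w₃ ▷ (w₄ ▷ w₁)) (whole c)
    where
    perm : a i ∷ X ++ a j ∷ Y ++ a l ∷ Z ↭ a j ∷ Y ++ a l ∷ Z ++ a i ∷ X
    perm = ↭-trans (++-comm (a i ∷ X) (a j ∷ Y ++ a l ∷ Z))
             (↭-reflexive (cong (a j ∷_) (++-assoc Y (a l ∷ Z) (a i ∷ X))))

  module _ {i j l X Y Z} (c : Cut i j l X Y Z) where

    all-edges : Walk EP (a i) X (a j) × Walk EP (a j) Y (a l) × Walk EP (a l) Z (a i)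
    all-edges with split X (closed (whole c))
    ... | w₁ , w₂ with split Y w₂
    ...   | w₃ , w₄ = w₁ , w₃ , w₄

    nonTerm : All NonTerm X
    nonTerm = All.tabulate λ {w} w∈ → proj₁ (sound (whole c) (there (∈-++⁺ˡ w∈))) , ne w∈
      where
      ne : ∀ {w} → w ∈ X → ∀ x → w ≢ a x
      ne w∈ x refl with unique (whole c)
      ... | u₀ ∷ u₁ with exhaust i j l (i≢j c) (l≢i c) (l≢j c) x
      ...   | inj₁ refl = head∉ (u₀ ∷ u₁) (∈-++⁺ˡ w∈)
      ...   | inj₂ (inj₁ refl) = head∉ (Unique-resp-↭ (shift (a j) X (Y ++ a l ∷ Z)) u₁) (∈-++⁺ˡ w∈)
      ...   | inj₂ (inj₂ refl) = head∉ (Unique-resp-↭ (shift (a l) (X ++ a j ∷ Y) Z)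
                (subst Unique (sym (++-assoc X (a j ∷ Y) (a l ∷ Z))) u₁)) (∈-++⁺ˡ (∈-++⁺ˡ w∈))

    arcs : List ℕ
    arcs = a i ∷ X ++ a j ∷ Y ++ [ a l ]

    arcs-eq : arcs ++ Z ≡ a i ∷ X ++ a j ∷ Y ++ a l ∷ Z
    arcs-eq = cong (a i ∷_) (trans (++-assoc X (a j ∷ Y ++ [ a l ]) Z)
      (cong (λ t → X ++ a j ∷ t) (++-assoc Y [ a l ] Z)))

    unique-arcs : Unique arcs
    unique-arcs = unique-prefix arcs (subst Unique (sym arcs-eq) (unique (whole c)))

    on-cycle : ∀ {w} → w < m + k → w ∈ arcs ⊎ w ∈ Z
    on-cycle {w} w< = ∈-++⁻ arcs (subst (w ∈_) (sym arcs-eq) (complete (whole c) w< (λ ())))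

    arcs-all : {Q : ℕ → Set} → All Q X → All Q Y → (∀ x → Q (a x)) → All Q arcs
    arcs-all qX qY qa = qa i ∷ All.++⁺ qX (qa j ∷ All.++⁺ qY (qa l ∷ []))

    long-arcs : ∀ (xs ys : List ℕ) (y : ℕ) → 2 ≤ suc (length (xs ++ y ∷ ys))
    long-arcs []      ys y = s≤s (s≤s z≤n)
    long-arcs (_ ∷ _) ys y = s≤s (s≤s z≤n)

    -- The arc `Z` through `H` is replaced by the passage from `a l` over the apex 0 of `G` to
    -- `a i`.
    closeG : All GOnly X → All GOnly Y → All HOnly Z → Ham m (Edge G) []
    closeG gX gY hZ = 0 , arcs , record
      { closed = nb∈ A i ∷ (weakenʷ {P = InG} toG (in-G i) (All.map proj₁ gX) (in-G j) (proj₁ all-edges)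
          ▷ (weakenʷ {P = InG} toG (in-G j) (All.map proj₁ gY) (in-G l) (proj₁ (proj₂ all-edges))
          ▷ step (symm G (nb∈ A l))))
      ; unique = All.map (λ q eq → proj₁ q (sym eq)) allG ∷ unique-arcs
      ; long = long-arcs X (Y ++ [ a l ]) (a j)
      ; sound = λ { (here refl) → 0<m , (λ ()) ; (there w∈) → proj₂ (All.lookup allG w∈) , (λ ()) }
      ; complete = cpl
      }
      where
      allG : All InG arcs
      allG = arcs-all (All.map proj₁ gX) (All.map proj₁ gY) in-G
      toG : ∀ {u v} → InG u → InG v → EP u v → Edge G u v
      toG {u} {v} (u≢0 , u<m) (v≢0 , v<m) e with origin {u} {v} e
      ... | inG _ _ e′ = e′
      ... | inH {u′} {v′} u′≢0 v′≢0 e′ refl refl with classify u′ u′≢0 | classify v′ v′≢0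
      ...   | inj₂ int | _ = ⊥-elim (σ-interior int u≢0 u<m refl)
      ...   | _ | inj₂ int = ⊥-elim (σ-interior int v≢0 v<m refl)
      -- Both ends are identified vertices, and those are independent in `H`.
      ...   | inj₁ (x , refl) | inj₁ (y , refl) = ⊥-elim (indep x y e′)
      cpl : ∀ {w} → w < m → w ∉ [] → w ∈ 0 ∷ arcs
      cpl {w} w<m _ with w ≟ 0
      ... | yes eq = here eq
      ... | no w≢0 with on-cycle (<-≤-trans w<m (m≤m+n m k))
      ...   | inj₁ w∈ = there w∈
      ...   | inj₂ w∈Z with All.lookup hZ w∈Z
      ...     | _ , int , eq = ⊥-elim (σ-interior int w≢0 w<m eq)

    unmap : ∀ {xs} → All HOnly xs → ∃[ xs′ ] (xs ≡ map σ xs′ × All Interior xs′)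
    unmap [] = [] , refl , []
    unmap ((x′ , int , refl) ∷ hs) with unmap hs
    ... | xs′ , refl , ints = x′ ∷ xs′ , refl , int ∷ ints

    -- One end has to be interior, since an edge between two identified vertices may stem from `G`.
    toH : ∀ {u v} → u ≢ 0 → v ≢ 0 → Interior u ⊎ Interior v → EP (σ u) (σ v) → Edge H u v
    toH {u} {v} u≢0 v≢0 int e with origin {σ u} {σ v} e
    ... | inH {u′} {v′} u′≢0 v′≢0 e′ eu ev with σ-inj u≢0 u′≢0 eu | σ-inj v≢0 v′≢0 ev
    ...   | refl | refl = e′
    toH u≢0 v≢0 (inj₁ int) e | inG σu≢0 _ e′ = ⊥-elim (σ-interior int σu≢0 (bound G e′) refl)
    toH u≢0 v≢0 (inj₂ int) e | inG _ σv≢0 e′ = ⊥-elim (σ-interior int σv≢0 (bound G (symm G e′)) refl)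

    liftI : ∀ {u v xs} → Interior u → All Interior xs → v ≢ 0 → Walk EP (σ u) (map σ xs) (σ v) → Walk (Edge H) u xs v
    liftI int []       v≢0 (step e) = step (toH (interior≢0 int) v≢0 (inj₁ int) e)
    liftI int (i′ ∷ ns) v≢0 (e ∷ w) = toH (interior≢0 int) (interior≢0 i′) (inj₁ int) e ∷ liftI i′ ns v≢0 w

    lift : ∀ {u v xs} → u ≢ 0 → All Interior xs → v ≢ 0 → map σ xs ≢ [] → Walk EP (σ u) (map σ xs) (σ v) → Walk (Edge H) u xs v
    lift u≢0 []        v≢0 ne w       = ⊥-elim (ne refl)
    lift u≢0 (int ∷ ns) v≢0 ne (e ∷ w) = toH u≢0 (interior≢0 int) (inj₂ int) e ∷ liftI int ns v≢0 w

    closeH : All HOnly X × X ≢ [] → All HOnly Y × Y ≢ [] → All GOnly Z → Ham (order H) (Edge H) []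
    closeH (hX , neX) (hY , neY) gZ with unmap hX | unmap hY
    ... | X′ , refl , iX | Y′ , refl , iY = 0 , arcs′ , record
      { closed = base∈ i ∷ (lift (t≢0 i) iX (t≢0 j) neX (onσ i j (proj₁ all-edges))
          ▷ (lift (t≢0 j) iY (t≢0 l) neY (onσ j l (proj₁ (proj₂ all-edges)))
          ▷ step (symm H (base∈ l))))
      ; unique = All.map (λ q eq → q (sym eq)) all≢0 ∷ Unique.map⁻ (subst Unique (sym σ-arcs) unique-arcs)
      ; long = long-arcs X′ (Y′ ++ [ t l ]) (t j)
      ; sound = λ { (here refl) → 0<order , (λ ()) ; (there w∈) → snd w∈ , (λ ()) }
      ; complete = cpl
      }
      where
      t : Fin 3 → ℕ
      t x = terminal (opp x)
      t≢0 : ∀ x → t x ≢ 0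
      t≢0 x = src≢0 (term (opp x))
      σt : ∀ x → σ (t x) ≡ a x
      σt x = trans (σ-term (opp x)) (cong a (opp-opp x))
      base∈ : ∀ x → t x ∈ rot H 0
      base∈ x = subst (_∈ rot H 0) (std (opp x)) (nb∈ B (opp x))
      onσ : ∀ x y {xs} → Walk EP (a x) xs (a y) → Walk EP (σ (t x)) xs (σ (t y))
      onσ x y = subst₂ (λ u v → Walk EP u _ v) (sym (σt x)) (sym (σt y))
      arcs′ : List ℕ
      arcs′ = t i ∷ X′ ++ t j ∷ Y′ ++ [ t l ]
      all≢0 : All (_≢ 0) arcs′
      all≢0 = t≢0 i ∷ All.++⁺ (All.map interior≢0 iX) (t≢0 j ∷ All.++⁺ (All.map interior≢0 iY) (t≢0 l ∷ []))
      σ-arcs : map σ arcs′ ≡ arcs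
      σ-arcs = cong₂ _∷_ (σt i) (trans (map-++ σ X′ _) (cong (map σ X′ ++_)
        (cong₂ _∷_ (σt j) (trans (map-++ σ Y′ _) (cong (λ s → map σ Y′ ++ [ s ]) (σt l))))))
      bnd : ∀ {w} → w ≢ 0 → σ w < m + k → w < order H
      bnd {w} w≢0 σ< with src w w≢0
      ... | apex = subst (1 <_) (sym size) (s≤s (s≤s z≤n))
      ... | term x = bound H (symm H (subst (_∈ rot H 0) (std x) (nb∈ B x)))
      ... | inner y = subst (5 + y <_) (sym size) (+-monoʳ-< 5 (+-cancelˡ-< m y k σ<))
      snd : ∀ {w} → w ∈ arcs′ → w < order H
      snd {w} w∈ = bnd (All.lookup all≢0 w∈) (proj₁ (sound (whole c)
        (subst (σ w ∈_) arcs-eq (∈-++⁺ˡ (subst (σ w ∈_) σ-arcs (∈-map⁺ σ w∈))))))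
      cpl : ∀ {w} → w < order H → w ∉ [] → w ∈ 0 ∷ arcs′
      cpl {w} w< _ with w ≟ 0
      ... | yes eq = here eq
      ... | no w≢0 with on-cycle (σ<k w≢0 w<)
      ...   | inj₁ σw∈ with ∈-map⁻ σ (subst (σ w ∈_) (sym σ-arcs) σw∈)
      ...     | w′ , w′∈ , eq with σ-inj w≢0 (All.lookup all≢0 w′∈) eq
      ...       | refl = there w′∈
      cpl {w} w< _ | no w≢0 | inj₂ σw∈Z with All.lookup gZ σw∈Z | classify w w≢0
      ... | (σw≢0 , σw<m) , _ | inj₂ int = ⊥-elim (σ-interior int σw≢0 σw<m refl)
      ... | _ , σw≢a | inj₁ (x , refl) = ⊥-elim (σw≢a (opp x) (σ-term x))

  cut : Ham (m + k) EP [] → ∃[ i ] ∃[ j ] ∃[ l ] ∃[ X ] ∃[ Y ] ∃[ Z ] Cut i j l X Y Z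
  cut (_ , _ , c) with rotate c (complete c (<-≤-trans (a<m 0F) (m≤m+n m k)) (λ ()))
  ... | ys , c′ with complete c′ (<-≤-trans (a<m 1F) (m≤m+n m k)) (λ ()) | complete c′ (<-≤-trans (a<m 2F) (m≤m+n m k)) (λ ())
  ...   | here eq | _ with nb-inj A eq
  ...     | ()
  cut _ | ys , c′ | there _ | here eq with nb-inj A eq
  ... | ()
  cut _ | ys , c′ | there a₁∈ | there a₂∈ with ∈-∃++ a₁∈
  ... | X , R , refl with ∈-++⁻ X a₂∈
  ...   | inj₂ (here eq) with nb-inj A eq
  ...     | ()
  cut _ | ys , c′ | there a₁∈ | there a₂∈ | X , R , refl | inj₁ a₂∈X with ∈-∃++ a₂∈X
  ... | X₁ , X₂ , refl = 0F , 2F , 1F , X₁ , X₂ , R , record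
          { i≢j = λ () ; l≢i = λ () ; l≢j = λ ()
          ; whole = subst (Cycle _ _ _ _) (++-assoc X₁ (a 2F ∷ X₂) (a 1F ∷ R)) c′ }
  cut _ | ys , c′ | there a₁∈ | there a₂∈ | X , R , refl | inj₂ (there a₂∈R) with ∈-∃++ a₂∈R
  ... | Y , Z , refl = 0F , 1F , 2F , X , Y , Z , record
          { i≢j = λ () ; l≢i = λ () ; l≢j = λ () ; whole = c′ }

  -- When the arcs occupy both sides, the factor that holds two of them becomes hamiltonian. When
  -- all three run on the side of `G`, they miss the apex 0 of the product, which comes from `H`;
  -- when all three run on the side of `H`, they miss `v`.
  nonHamP : NonHam G A → NonHam H B → ∃[ v ] GOnly v → NonHam P apexP
  nonHamP nG nH (v , vG) h with cut h
  ... | i , j , l , X , Y , Z , c with all-edges c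
  ...   | wX , wY , wZ with pure wX (nonTerm c) | pure wY (nonTerm c′) | pure wZ (nonTerm c″)
    where
    c′ = turn-cut c
    c″ = turn-cut c′
  ... | inj₁ gX | inj₁ gY | inj₂ (hZ , _) = nG (closeG c gX gY hZ)
  ... | inj₁ gX | inj₂ (hY , _) | inj₁ gZ = nG (closeG (turn-cut (turn-cut c)) gZ gX hY)
  ... | inj₂ (hX , _) | inj₁ gY | inj₁ gZ = nG (closeG (turn-cut c) gY gZ hX)
  ... | inj₂ hX | inj₂ hY | inj₁ gZ = nH (closeH c hX hY gZ)
  ... | inj₂ hX | inj₁ gY | inj₂ hZ = nH (closeH (turn-cut (turn-cut c)) hZ hX gY)
  ... | inj₁ gX | inj₂ hY | inj₂ hZ = nH (closeH (turn-cut c) hY hZ gX)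
  ... | inj₁ gX | inj₁ gY | inj₁ gZ with on-cycle c (<-≤-trans 0<m (m≤m+n m k))
  ...   | inj₁ 0∈ = proj₁ (All.lookup (arcs-all c (All.map proj₁ gX) (All.map proj₁ gY) in-G) 0∈) refl
  ...   | inj₂ 0∈ = proj₁ (proj₁ (All.lookup gZ 0∈)) refl
  nonHamP nG nH (v , (v≢0 , v<m) , v≢a) h | i , j , l , X , Y , Z , c | wX , wY , wZ
    | inj₂ (hX , _) | inj₂ (hY , _) | inj₂ (hZ , _) with on-cycle c (<-≤-trans v<m (m≤m+n m k))
  ... | inj₁ v∈ = contra (All.lookup (arcs-all c {Q = λ w → v ≢ w} (All.map ne hX) (All.map ne hY) v≢a) v∈)
    where
    ne : ∀ {w} → HOnly w → v ≢ w
    ne (_ , int , eq) refl = σ-interior int v≢0 v<m eq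
    contra : v ≢ v → ⊥
    contra q = q refl
  ... | inj₂ v∈ with All.lookup hZ v∈
  ...   | _ , int , eq = σ-interior int v≢0 v<m eq

-- Faces of a product

private
  variable
    X Y : Set

data Succ {X : Set} : List X → X → X → Set where
  now   : ∀ {u w xs} → Succ (u ∷ w ∷ xs) u w
  later : ∀ {x u w xs} → Succ xs u w → Succ (x ∷ xs) u w

wrap : List X → List X
wrap []       = []
wrap (x ∷ xs) = x ∷ xs ++ [ x ]

-- Repeating the head at the end turns cyclic succession into succession in a list, so that it can
-- be followed through maps and concatenations.
Next : List X → X → X → Set
Next xs = Succ (wrap xs)

Succ-++ˡ : ∀ {xs ys} {u w : X} → Succ xs u w → Succ (xs ++ ys) u w
Succ-++ˡ now       = now
Succ-++ˡ (later s) = later (Succ-++ˡ s)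

Succ-++ʳ : ∀ xs {ys} {u w : X} → Succ ys u w → Succ (xs ++ ys) u w
Succ-++ʳ []       s = s
Succ-++ʳ (_ ∷ xs) s = later (Succ-++ʳ xs s)

Succ-map : (f : X → Y) → ∀ {xs u w} → Succ xs u w → Succ (map f xs) (f u) (f w)
Succ-map f now       = now
Succ-map f (later s) = later (Succ-map f s)

wrap-map : (f : X → Y) → ∀ xs → wrap (map f xs) ≡ map f (wrap xs)
wrap-map f []       = refl
wrap-map f (x ∷ xs) = cong (f x ∷_) (sym (map-++ f xs [ x ]))

Next-map : (f : X → Y) → ∀ {xs u w} → Next xs u w → Next (map f xs) (f u) (f w)
Next-map f {xs} s = subst (λ t → Succ t _ _) (sym (wrap-map f xs)) (Succ-map f s)

Succ⇒Next : ∀ {xs} {u w : X} → Succ xs u w → Next xs u w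
Succ⇒Next {xs = _ ∷ _} s = Succ-++ˡ s

Succ-fst : ∀ {xs} {u w : X} → Succ xs u w → u ∈ xs
Succ-fst now       = here refl
Succ-fst (later s) = there (Succ-fst s)

snoc-fst : ∀ ys {z u w : X} → Succ (ys ++ [ z ]) u w → u ∈ ys
snoc-fst []           (later ())
snoc-fst (_ ∷ [])     now                = here refl
snoc-fst (_ ∷ [])     (later (later ()))
snoc-fst (_ ∷ _ ∷ _)  now                = here refl
snoc-fst (_ ∷ y ∷ ys) (later s)          = there (snoc-fst (y ∷ ys) s)

Next-fst : ∀ {xs} {u w : X} → Next xs u w → u ∈ xs
Next-fst {xs = x ∷ xs} s = snoc-fst (x ∷ xs) s

First Last : List X → X → Set
First xs u = ∃[ ys ] xs ≡ u ∷ ys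
Last  xs u = ∃[ ys ] xs ≡ ys ++ [ u ]

Succ-snoc : ∀ xs {z} {u w : X} → Succ (xs ++ [ z ]) u w → Succ xs u w ⊎ (w ≡ z × Last xs u)
Succ-snoc []           (later ())
Succ-snoc (x ∷ [])     now               = inj₂ (refl , [] , refl)
Succ-snoc (x ∷ [])     (later (later ()))
Succ-snoc (x ∷ y ∷ xs) now               = inj₁ now
Succ-snoc (x ∷ y ∷ xs) (later s) with Succ-snoc (y ∷ xs) s
... | inj₁ s′             = inj₁ (later s′)
... | inj₂ (eq , ys , eq′) = inj₂ (eq , x ∷ ys , cong (x ∷_) eq′)

-- Cutting a cyclic order open at `z` destroys only the pairs that involve `z`.
Next-tail : ∀ {z} {g : List X} {u w} → u ≢ z → w ≢ z → Next (z ∷ g) u w → Succ g u w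
Next-tail {g = []}    u≢ w≢ now              = ⊥-elim (u≢ refl)
Next-tail {g = []}    u≢ w≢ (later (later ()))
Next-tail {g = _ ∷ _} u≢ w≢ now              = ⊥-elim (u≢ refl)
Next-tail {g = y ∷ ys} u≢ w≢ (later s) with Succ-snoc (y ∷ ys) s
... | inj₁ s′       = s′
... | inj₂ (eq , _) = ⊥-elim (w≢ eq)

Succ-snd : ∀ {xs} {u w : X} → Succ xs u w → w ∈ xs
Succ-snd now       = there (here refl)
Succ-snd (later s) = there (Succ-snd s)

Next-last : ∀ {z} {g : List X} {u} → z ∉ g → u ≢ z → Next (z ∷ g) u z → Last g u
Next-last {g = []}    z∉ u≢ now              = ⊥-elim (u≢ refl)
Next-last {g = []}    z∉ u≢ (later (later ()))
Next-last {g = _ ∷ _} z∉ u≢ now              = ⊥-elim (u≢ refl)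
Next-last {g = y ∷ ys} z∉ u≢ (later s) with Succ-snoc (y ∷ ys) s
... | inj₁ s′      = ⊥-elim (z∉ (Succ-snd s′))
... | inj₂ (_ , l) = l

Next-first : ∀ {z} {g : List X} {w} → z ∉ g → w ≢ z → Next (z ∷ g) z w → First g w
Next-first {g = []}     z∉ w≢ now              = ⊥-elim (w≢ refl)
Next-first {g = []}     z∉ w≢ (later (later ()))
Next-first {g = _ ∷ ys} z∉ w≢ now              = ys , refl
Next-first {g = y ∷ ys} z∉ w≢ (later s) with Succ-snoc (y ∷ ys) s
... | inj₁ s′       = ⊥-elim (z∉ (Succ-fst s′))
... | inj₂ (eq , _) = ⊥-elim (w≢ eq)

Succ-join : ∀ {g h} {u w : X} → Last g u → First h w → Succ (g ++ h) u w
Succ-join {g = g} {h} {u} {w} (ys , refl) (_ , refl) = go ys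
  where
  go : ∀ ys → Succ ((ys ++ [ u ]) ++ w ∷ _) u w
  go []       = now
  go (_ ∷ ys) = later (go ys)

Next-join : ∀ {g h} {u w : X} → Last h u → First g w → Next (g ++ h) u w
Next-join {g = w ∷ g} {h} {u} (ys , refl) (_ , refl) = later (go g)
  where
  go₂ : ∀ ys → Succ ((ys ++ [ u ]) ++ [ w ]) u w
  go₂ []       = now
  go₂ (_ ∷ ys) = later (go₂ ys)
  go : ∀ g → Succ ((g ++ (ys ++ [ u ])) ++ [ w ]) u w
  go []      = go₂ ys
  go (_ ∷ g) = later (go g)

Dart : Set
Dart = ℕ × ℕ

-- Consecutive darts on the boundary of a face.
data Turn (r : ℕ → List ℕ) : Dart → Dart → Set where
  turn : ∀ {u v w} → Next (r v) u w → Turn r (u , v) (v , w)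

Closed : {X : Set} → (X → X → Set) → List X → Set
Closed R []       = ⊥
Closed R (x ∷ xs) = Walk R x xs x

-- The faces are data rather than orbits, so that gluing can operate on lists of darts. Being closed
-- under `Turn` and containing each dart exactly once, they are the face orbits of the rotation;
-- `Realise` later recovers the count of least darts from them.
record Embedding (G : Net) (faces : List (List Dart)) : Set where
  field
    boundary : All (Closed (Turn (rot G))) faces
    distinct : Unique (concat faces)
    dart⇒edge : ∀ {u v} → (u , v) ∈ concat faces → v ∈ rot G u
    edge⇒dart : ∀ {u v} → v ∈ rot G u → (u , v) ∈ concat faces
    euler    : 2 * order G + 2 * length faces ≡ 4 + length (concat faces)

open Embedding public

succ : Fin 3 → Fin 3
succ 0F = 1F
succ 1F = 2F
succ 2F = 0F

-- The face that passes `x` from `nb i` to the cyclically next neighbour; for faces meeting `x` just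
-- once the arc is the part of the boundary away from `x`.
apexFace : ℕ → (Fin 3 → ℕ) → (Fin 3 → List Dart) → Fin 3 → List Dart
apexFace x nb arc i = (nb i , x) ∷ (x , nb (succ i)) ∷ arc i

triple : {X : Set} → (Fin 3 → X) → List X
triple f = f 0F ∷ f 1F ∷ f 2F ∷ []

apexFaces : ℕ → (Fin 3 → ℕ) → (Fin 3 → List Dart) → List (List Dart)
apexFaces x nb arc = triple (apexFace x nb arc)

Off : ℕ → Dart → Set
Off x (u , v) = u ≢ x × v ≢ x

record PlaneApex (G : Net) (A : Apex G 0) : Set where
  field
    arc       : Fin 3 → List Dart
    rest      : List (List Dart)
    embedding : Embedding G (apexFaces 0 (nb A) arc ++ rest)
    off-apex  : All (Off 0) (concat (triple arc) ++ concat rest)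

-- By `off-next` no face at apex 0 meets apex 1. Merging the faces at 0 thus leaves those at 1
-- intact for the next product.
record PlaneLink {k} (L : Link k) : Set where
  open Link L
  field
    arc₀ arc₁ : Fin 3 → List Dart
    rest      : List (List Dart)
    embedding : Embedding net (apexFaces 0 (nb base) arc₀ ++ (apexFaces 1 (nb next) arc₁ ++ rest))
    off-base  : All (Off 0) (concat (triple arc₀) ++ concat (apexFaces 1 (nb next) arc₁ ++ rest))
    off-next  : All (Off 1) (concat (triple arc₀) ++ (concat (triple arc₁) ++ concat rest))

cutOff : ∀ {k} {L : Link k} → PlaneLink L → PlaneApex (Link.net L) (Link.base L)
cutOff p = record { arc = arc₀ ; rest = _ ; embedding = embedding ; off-apex = off-base }
  where open PlaneLink p

spokes : ℕ → (Fin 3 → ℕ) → List Dart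
spokes x nb = concat (triple λ i → (nb i , x) ∷ (x , nb (succ i)) ∷ [])

module Shuffle where

  open import Algebra.Solver.CommutativeMonoid (++-commutativeMonoid {A = Dart})
  open import Data.Vec using ([]; _∷_)

  pull-spokes : ∀ x nb (arc : Fin 3 → List Dart) R →
    concat (apexFaces x nb arc) ++ R ↭ spokes x nb ++ (concat (triple arc) ++ R)
  pull-spokes x nb arc R =
    prove 7 (((s₀ ⊕ a₀) ⊕ ((s₁ ⊕ a₁) ⊕ ((s₂ ⊕ a₂) ⊕ id))) ⊕ r)
            ((s₀ ⊕ (s₁ ⊕ (s₂ ⊕ id))) ⊕ ((a₀ ⊕ (a₁ ⊕ (a₂ ⊕ id))) ⊕ r))
            (sp 0F ∷ sp 1F ∷ sp 2F ∷ arc 0F ∷ arc 1F ∷ arc 2F ∷ R ∷ [])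
    where
    sp : Fin 3 → List Dart
    sp i = (nb i , x) ∷ (x , nb (succ i)) ∷ []
    s₀ = var 0F
    s₁ = var 1F
    s₂ = var 2F
    a₀ = var (suc 2F)
    a₁ = var (suc (suc 2F))
    a₂ = var (suc (suc (suc 2F)))
    r  = var (suc (suc (suc (suc 2F))))

  interleave : ∀ (C R a₀ a₁ a₂ h₀ h₁ h₂ S : List Dart) →
    C ++ (R ++ ((((a₀ ++ h₂) ++ ((a₁ ++ h₁) ++ ((a₂ ++ h₀) ++ [])))) ++ S))
    ↭ ((a₀ ++ (a₁ ++ (a₂ ++ []))) ++ R) ++ ((h₀ ++ (h₁ ++ (h₂ ++ []))) ++ (C ++ S))
  interleave C R a₀ a₁ a₂ h₀ h₁ h₂ S =
    prove 9 (c ⊕ (r ⊕ ((((x₀ ⊕ y₂) ⊕ ((x₁ ⊕ y₁) ⊕ ((x₂ ⊕ y₀) ⊕ id)))) ⊕ s)))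
            (((x₀ ⊕ (x₁ ⊕ (x₂ ⊕ id))) ⊕ r) ⊕ ((y₀ ⊕ (y₁ ⊕ (y₂ ⊕ id))) ⊕ (c ⊕ s)))
            (C ∷ R ∷ a₀ ∷ a₁ ∷ a₂ ∷ h₀ ∷ h₁ ∷ h₂ ∷ S ∷ [])
    where
    c  = var 0F
    r  = var 1F
    x₀ = var 2F
    x₁ = var (suc 2F)
    x₂ = var (suc (suc 2F))
    y₀ = var (suc (suc (suc 2F)))
    y₁ = var (suc (suc (suc (suc 2F))))
    y₂ = var (suc (suc (suc (suc (suc 2F)))))
    s  = var (suc (suc (suc (suc (suc (suc 2F))))))

open Shuffle

-- An arc ends by turning into the dart towards the deleted apex. Only this last step is redirected
-- into the other factor, the others stay in their own.
relastʷ : {R : X → X → Set} {S : Y → Y → Set} {P : X → Set} (f : X → Y) {y : X} {y′ : Y} →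
          (∀ {u v} → P u → P v → R u v → S (f u) (f v)) → (∀ {u} → P u → R u y → S (f u) y′) →
          ∀ {x xs} → P x → All P xs → Walk R x xs y → Walk S (f x) (map f xs) y′
relastʷ f h l px []        (step r) = step (l px r)
relastʷ f h l px (pz ∷ ps) (r ∷ w)  = h px pz r ∷ relastʷ f h l pz ps w

module GluePlane (G : Net) (A : Apex G 0) (pA : PlaneApex G A) {k : ℕ} (L : Link k) (pL : PlaneLink L) where

  open Link L renaming (net to H; base to B; next to C)
  open Glue G A L
  open PlaneApex pA renaming (rest to restG; embedding to embG)
  open PlaneLink pL renaming (rest to restH; embedding to embH)

  σσ : Dart → Dart
  σσ (u , v) = σ u , σ v

  turnG : ∀ {d e} → Off 0 d → Off 0 e → Turn (rot G) d e → Turn rotP d e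
  turnG {u , v} {_ , w} (u≢ , v≢) (_ , w≢) (turn s) with view v
  ... | apex eq = ⊥-elim (v≢ eq)
  ... | left q l n = turn (subst (λ t → Next t u w) (sym (rotP-left q l n)) s)
  ... | right j refl = ⊥-elim (m+n≮m m j (bound G (Next-fst s)))
  ... | term i refl = turn (subst (λ t → Next t u w) (sym (rotP-term i))
          (Succ⇒Next (Succ-++ˡ (Next-tail u≢ w≢ (subst (λ t → Next t u w) (rot-nb A i) s)))))

  rotB : ∀ i → rot H (terminal i) ≡ 0 ∷ tl B i
  rotB i = trans (cong (rot H) (sym (std i))) (rot-nb B i)

  tlB : ∀ i → tl A (opp i) ++ map σ (tl B i) ≡ rotP (σ (terminal i))
  tlB i = trans (cong (λ t → tl A (opp i) ++ map σ (tl B t)) (sym (opp-opp i)))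
            (trans (sym (rotP-term (opp i))) (cong rotP (sym (σ-term i))))

  turnH : ∀ {d e} → Off 0 d → Off 0 e → Turn (rot H) d e → Turn rotP (σσ d) (σσ e)
  turnH {u , v} {_ , w} (u≢ , v≢) (_ , w≢) (turn s) with src v v≢
  ... | apex = turn (subst (λ t → Next t (σ u) (σ w)) (sym rotP-apex) (Next-map σ s))
  ... | inner j = turn (subst (λ t → Next t (σ u) (σ w)) (sym (rotP-right j)) (Next-map σ s))
  ... | term i = turn (subst (λ t → Next t (σ u) (σ w)) (tlB i) (Succ⇒Next (Succ-++ʳ (tl A (opp i))
          (Succ-map σ (Next-tail u≢ w≢ (subst (λ t → Next t u w) (rotB i) s))))))

  First-map : ∀ {xs w} → First xs w → First (map σ xs) (σ w)
  First-map (ys , refl) = map σ ys , refl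

  Last-map : ∀ {xs w} → Last xs w → Last (map σ xs) (σ w)
  Last-map (ys , refl) = map σ ys , map-++ σ ys _

  -- The face of `G` comes in from the last entry of `tl A i`, the predecessor of the apex, and the
  -- face of `H` goes on to the first entry of `tl B (opp i)`, the successor of its apex. In the
  -- concatenated rotation these two are adjacent.
  crossGH : ∀ i {d e} → Off 0 d → Off 0 e → Turn (rot G) d (a i , 0) → Turn (rot H) (0 , nb B (opp i)) e →
            Turn rotP d (σσ e)
  crossGH i {u , _} {_ , w} (u≢ , _) (_ , w≢) (turn s) (turn s′) =
    subst (λ t → Turn rotP (u , a i) (t , σ w)) (sym σa) (turn (subst (λ t → Next t u (σ w)) (sym (rotP-term i))
      (Succ⇒Next (Succ-join
        (Next-last (head∉ (unique-tl A i)) u≢ (subst (λ t → Next t u 0) (rot-nb A i) s))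
        (First-map (Next-first (head∉ (unique-tl B (opp i))) w≢ (subst (λ t → Next t 0 w) (rot-nb B (opp i)) s′)))))))
    where
    σa : σ (nb B (opp i)) ≡ a i
    σa = trans (cong σ (std (opp i))) (trans (σ-term (opp i)) (cong a (opp-opp i)))

  -- The other seam lies where the concatenated rotation wraps around, hence `Next-join` in place of
  -- `Succ-join`.
  crossHG : ∀ i {d e} → Off 0 d → Off 0 e → Turn (rot H) d (nb B (opp i) , 0) → Turn (rot G) (0 , a i) e →
            Turn rotP (σσ d) e
  crossHG i {u , _} {_ , w} (u≢ , _) (_ , w≢) (turn s) (turn s′) =
    subst (λ t → Turn rotP (σ u , t) (a i , w)) (sym σa) (turn (subst (λ t → Next t (σ u) w) (sym (rotP-term i))
      (Next-join
        (Last-map (Next-last (head∉ (unique-tl B (opp i))) u≢ (subst (λ t → Next t u 0) (rot-nb B (opp i)) s)))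
        (Next-first (head∉ (unique-tl A i)) w≢ (subst (λ t → Next t 0 w) (rot-nb A i) s′)))))
    where
    σa : σ (nb B (opp i)) ≡ a i
    σa = trans (cong σ (std (opp i))) (trans (σ-term (opp i)) (cong a (opp-opp i)))

  -- The faces a (i + 1), x, a i of G and the face of H across it are merged.
  partner : Fin 3 → Fin 3
  partner 0F = 2F
  partner 1F = 1F
  partner 2F = 0F

  partner-end : ∀ i → partner i ≡ opp (succ i)
  partner-end 0F = refl
  partner-end 1F = refl
  partner-end 2F = refl

  partner-start : ∀ i → succ (partner i) ≡ opp i
  partner-start 0F = refl
  partner-start 1F = refl
  partner-start 2F = refl

  succ≢ : ∀ i → succ i ≢ i
  succ≢ 0F ()
  succ≢ 1F ()
  succ≢ 2F ()

  triple-lookup : {X : Set} {Q : X → Set} {f : Fin 3 → X} {xs : List X} → All Q (triple f ++ xs) → ∀ i → Q (f i)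
  triple-lookup (p ∷ _)         0F = p
  triple-lookup (_ ∷ p ∷ _)     1F = p
  triple-lookup (_ ∷ _ ∷ p ∷ _) 2F = p

  concat-lookup : {X : Set} {Q : X → Set} (f : Fin 3 → List X) {ys : List X} →
                  All Q (concat (triple f) ++ ys) → ∀ i → All Q (f i)
  concat-lookup f {ys} ps i = triple-lookup {f = f} {xs = []} (All.concat⁻ (All.++⁻ˡ (concat (triple f)) ps)) i

  arcG : ∀ i → Walk (Turn (rot G)) (0 , a (succ i)) (arc i) (a i , 0)
  arcG i with triple-lookup {f = apexFace 0 a arc} (boundary embG) i
  ... | _ ∷ w = w

  arcH : ∀ i → Walk (Turn (rot H)) (0 , nb B (succ i)) (arc₀ i) (nb B i , 0)
  arcH i with triple-lookup {f = apexFace 0 (nb B) arc₀} (boundary embH) i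
  ... | _ ∷ w = w

  merged : Fin 3 → List Dart
  merged i = arc i ++ map σσ (arc₀ (partner i))

  Turn-meet : ∀ {r u v v′ w} → Turn r (u , v) (v′ , w) → v ≡ v′
  Turn-meet (turn _) = refl

  empty-arc : ∀ {N x} (A : Apex N x) i → ¬ Walk (Turn (rot N)) (x , nb A (succ i)) [] (nb A i , x)
  empty-arc A i (step t) = succ≢ i (nb-inj A (Turn-meet t))

  -- The arc of `G` leads from `a (succ i)` to `a i`, and the arc of the partner face in `H` leads
  -- from there back. An empty arc would make two neighbours of an apex coincide.
  join : ∀ i j {ds es} → partner i ≡ j → All (Off 0) ds → All (Off 0) es →
         Walk (Turn (rot G)) (0 , a (succ i)) ds (a i , 0) →
         Walk (Turn (rot H)) (0 , nb B (succ j)) es (nb B j , 0) →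
         Closed (Turn rotP) (ds ++ map σσ es)
  join i j eq []      _  w _ = ⊥-elim (empty-arc A i w)
  join i j eq (_ ∷ _) [] _ w = ⊥-elim (empty-arc B j w)
  join i j {d ∷ ds} {e ∷ es} refl (p ∷ ps) (q ∷ qs) (t ∷ w) (t′ ∷ w′) =
    subst (λ xs → Walk (Turn rotP) d xs (σσ e)) (map-id ds)
      (relastʷ (λ x → x) turnG (λ pu s → crossGH i pu q s
        (subst (λ z → Turn (rot H) (0 , nb B z) e) (partner-start i) t′)) p ps w)
    ▷ relastʷ σσ turnH (λ pu s → crossHG (succ i) pu p
        (subst (λ z → Turn (rot H) _ (nb B z , 0)) (partner-end i) s) t) q qs w′

  off-arc : ∀ i → All (Off 0) (arc i)
  off-arc = concat-lookup arc off-apex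

  off-arc₀ : ∀ i → All (Off 0) (arc₀ i)
  off-arc₀ = concat-lookup arc₀ off-base

  merged-closed : ∀ i → Closed (Turn rotP) (merged i)
  merged-closed i = join i (partner i) refl (off-arc i) (off-arc₀ (partner i)) (arcG i) (arcH (partner i))

  closedG : ∀ {ds} → All (Off 0) ds → Closed (Turn (rot G)) ds → Closed (Turn rotP) ds
  closedG {_ ∷ ds} (p ∷ ps) w = subst (λ xs → Walk (Turn rotP) _ xs _) (map-id ds) (mapʷ {f = λ x → x} turnG p ps p w)

  closedH : ∀ {ds} → All (Off 0) ds → Closed (Turn (rot H)) ds → Closed (Turn rotP) (map σσ ds)
  closedH {_ ∷ _} (p ∷ ps) w = mapʷ turnH p ps p w

  arcP : Fin 3 → List Dart
  arcP i = map σσ (arc₁ i)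

  restP : List (List Dart)
  restP = restG ++ (triple merged ++ map (map σσ) restH)

  innerG innerH apexH : List Dart
  innerG = concat (triple arc) ++ concat restG
  innerH = concat (triple arc₀) ++ concat (apexFaces 1 (nb C) arc₁ ++ restH)
  apexH  = concat (apexFaces 1 (nb C) arc₁)

  facesP : List (List Dart)
  facesP = apexFaces 0 (λ i → σ (nb C i)) arcP ++ restP

  dartsG : concat (apexFaces 0 a arc ++ restG) ↭ spokes 0 a ++ innerG
  dartsG = ↭-trans (↭-reflexive (sym (concat-++ (apexFaces 0 a arc) restG))) (pull-spokes 0 a arc (concat restG))

  dartsH : concat (apexFaces 0 (nb B) arc₀ ++ (apexFaces 1 (nb C) arc₁ ++ restH)) ↭ spokes 0 (nb B) ++ innerH
  dartsH = ↭-trans (↭-reflexive (sym (concat-++ (apexFaces 0 (nb B) arc₀) (apexFaces 1 (nb C) arc₁ ++ restH))))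
             (pull-spokes 0 (nb B) arc₀ (concat (apexFaces 1 (nb C) arc₁ ++ restH)))

  mapσσ : ∀ xs ys → map σσ (xs ++ ys) ≡ map σσ xs ++ map σσ ys
  mapσσ = map-++ σσ

  dartsP : concat facesP ↭ innerG ++ map σσ innerH
  dartsP = ↭-trans (↭-reflexive eq₁) (↭-trans
      (interleave (map σσ apexH) (concat restG) (arc 0F) (arc 1F) (arc 2F)
        (map σσ (arc₀ 0F)) (map σσ (arc₀ 1F)) (map σσ (arc₀ 2F)) (map σσ (concat restH)))
      (++⁺ˡ innerG (↭-reflexive (sym eq₂))))
    where
    eq₁ : concat facesP ≡ map σσ apexH ++ (concat restG ++ (concat (triple merged) ++ map σσ (concat restH)))
    eq₁ = trans (sym (concat-++ (map (map σσ) (apexFaces 1 (nb C) arc₁)) restP))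
      (cong₂ _++_ (concat-map {f = σσ} (apexFaces 1 (nb C) arc₁))
        (trans (sym (concat-++ restG (triple merged ++ map (map σσ) restH))) (cong (concat restG ++_)
          (trans (sym (concat-++ (triple merged) (map (map σσ) restH))) (cong (concat (triple merged) ++_) (concat-map {f = σσ} restH))))))
    eq₂ : map σσ innerH ≡ (map σσ (arc₀ 0F) ++ (map σσ (arc₀ 1F) ++ (map σσ (arc₀ 2F) ++ [])))
                          ++ (map σσ apexH ++ map σσ (concat restH))
    eq₂ = trans (mapσσ (concat (triple arc₀)) _) (cong₂ _++_
      (trans (mapσσ (arc₀ 0F) _) (cong (map σσ (arc₀ 0F) ++_)
        (trans (mapσσ (arc₀ 1F) _) (cong (map σσ (arc₀ 1F) ++_) (mapσσ (arc₀ 2F) [])))))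
      (trans (cong (map σσ) (sym (concat-++ (apexFaces 1 (nb C) arc₁) restH))) (mapσσ apexH (concat restH))))

  edgeG : ∀ {u v} → (u , v) ∈ innerG → v ∈ rot G u
  edgeG d∈ = dart⇒edge embG (∈-resp-↭ (↭-sym dartsG) (∈-++⁺ʳ (spokes 0 a) d∈))

  edgeH : ∀ {u v} → (u , v) ∈ innerH → v ∈ rot H u
  edgeH d∈ = dart⇒edge embH (∈-resp-↭ (↭-sym dartsH) (∈-++⁺ʳ (spokes 0 (nb B)) d∈))

  not-spoke : ∀ nb {u v} → u ≢ 0 → v ≢ 0 → (u , v) ∉ spokes 0 nb
  not-spoke _ u≢ v≢ (here refl) = v≢ refl
  not-spoke _ u≢ v≢ (there (here refl)) = u≢ refl
  not-spoke _ u≢ v≢ (there (there (here refl))) = v≢ refl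
  not-spoke _ u≢ v≢ (there (there (there (here refl)))) = u≢ refl
  not-spoke _ u≢ v≢ (there (there (there (there (here refl))))) = v≢ refl
  not-spoke _ u≢ v≢ (there (there (there (there (there (here refl)))))) = u≢ refl

  uniqueP : Unique (concat facesP)
  uniqueP = Unique-resp-↭ (↭-sym dartsP) (Unique.++⁺
    (unique-suffix (spokes 0 a) (Unique-resp-↭ dartsG (distinct embG)))
    (unique-map σσ inj off-base (unique-suffix (spokes 0 (nb B)) (Unique-resp-↭ dartsH (distinct embH)))) disj)
    where
    inj : ∀ {d e} → Off 0 d → Off 0 e → σσ d ≡ σσ e → d ≡ e
    inj (p , q) (p′ , q′) eq = cong₂ _,_ (σ-inj p p′ (cong proj₁ eq)) (σ-inj q q′ (cong proj₂ eq))
    disj : ∀ {d} → ¬ (d ∈ innerG × d ∈ map σσ innerH)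
    disj {u , v} (d∈ , e∈) with ∈-map⁻ σσ e∈ | All.lookup off-apex d∈ | edgeG d∈
    ... | (u′ , v′) , e′∈ , refl | u≢ , v≢ | e with All.lookup off-base e′∈
    ...   | u′≢ , v′≢ with classify u′ u′≢ | classify v′ v′≢
    ...     | inj₂ int | _ = σ-interior int u≢ (bound G e) refl
    ...     | _ | inj₂ int = σ-interior int v≢ (bound G (symm G e)) refl
    ...     | inj₁ (i , refl) | inj₁ (j , refl) = indep i j (edgeH e′∈)

  dart⇒edgeP : ∀ {u v} → (u , v) ∈ concat facesP → EP u v
  dart⇒edgeP d∈ with ∈-++⁻ innerG (∈-resp-↭ dartsP d∈)
  ... | inj₁ d∈G with All.lookup off-apex d∈G
  ...   | u≢ , v≢ = fromG u≢ v≢ (edgeG d∈G)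
  dart⇒edgeP d∈ | inj₂ d∈H with ∈-map⁻ σσ d∈H
  ... | _ , e∈ , refl with All.lookup off-base e∈
  ...   | u≢ , v≢ = fromH u≢ v≢ (edgeH e∈)

  edge⇒dartP : ∀ {u v} → EP u v → (u , v) ∈ concat facesP
  edge⇒dartP {u} {v} e with origin {u} {v} e
  ... | inG u≢ v≢ e′ with ∈-++⁻ (spokes 0 a) (∈-resp-↭ dartsG (edge⇒dart embG e′))
  ...   | inj₁ s∈ = ⊥-elim (not-spoke a u≢ v≢ s∈)
  ...   | inj₂ d∈ = ∈-resp-↭ (↭-sym dartsP) (∈-++⁺ˡ d∈)
  edge⇒dartP {u} {v} e | inH u≢ v≢ e′ refl refl with ∈-++⁻ (spokes 0 (nb B)) (∈-resp-↭ dartsH (edge⇒dart embH e′))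
  ... | inj₁ s∈ = ⊥-elim (not-spoke (nb B) u≢ v≢ s∈)
  ... | inj₂ d∈ = ∈-resp-↭ (↭-sym dartsP) (∈-++⁺ʳ innerG (∈-map⁺ σσ d∈))

  eulerP : 2 * (m + k) + 2 * length facesP ≡ 4 + length (concat facesP)
  eulerP = arith m k (length restG) (length restH) (length innerG) (length innerH) _ _
    (trans (euler embG) (cong (4 +_) (↭-length dartsG)))
    (trans (cong (λ t → 2 * t + 2 * (6 + length restH)) (sym size)) (trans (euler embH) (cong (4 +_) (↭-length dartsH))))
    (trans (cong (3 +_) (length-++ restG)) (cong (λ t → 3 + (length restG + (3 + t))) (length-map (map σσ) restH)))
    (trans (↭-length dartsP) (trans (length-++ innerG) (cong (length innerG +_) (length-map σσ innerH))))
    where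
    -- Together the factors have five vertices and three faces more than the product, which accounts
    -- for 2 · 5 + 2 · 3 = 16. On the other side these are twelve darts and one summand 4.
    lhs : ∀ m k r s → (2 * (m + k) + 2 * (3 + (r + (3 + s)))) + 16 ≡ (2 * m + 2 * (3 + r)) + (2 * (5 + k) + 2 * (6 + s))
    lhs = solve-∀
    rhs : ∀ x y → (4 + (6 + x)) + (4 + (6 + y)) ≡ (4 + (x + y)) + 16
    rhs = solve-∀
    arith : ∀ m k r s x y f d → 2 * m + 2 * (3 + r) ≡ 4 + (6 + x) → 2 * (5 + k) + 2 * (6 + s) ≡ 4 + (6 + y) →
            f ≡ 3 + (r + (3 + s)) → d ≡ x + y → 2 * (m + k) + 2 * f ≡ 4 + d
    arith m k r s x y _ _ p q refl refl = +-cancelʳ-≡ 16 _ _ (trans (lhs m k r s) (trans (cong₂ _+_ p q) (rhs x y)))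

  closedP : All (Closed (Turn rotP)) facesP
  closedP = mapped (apexFaces 1 (nb C) arc₁) (All.++⁻ˡ (apexFaces 1 (nb C) arc₁) (All.++⁻ʳ (apexFaces 0 (nb B) arc₀) (boundary embH)))
      (All.++⁻ˡ (apexFaces 1 (nb C) arc₁) off-rest)
    ⟨ All.++⁺ ⟩ (allG (All.++⁻ʳ (apexFaces 0 a arc) (boundary embG)) (All.concat⁻ (All.++⁻ʳ (concat (triple arc)) off-apex))
    ⟨ All.++⁺ ⟩ (merged-closed 0F ∷ merged-closed 1F ∷ merged-closed 2F ∷ mapped restH
      (All.++⁻ʳ (apexFaces 1 (nb C) arc₁) (All.++⁻ʳ (apexFaces 0 (nb B) arc₀) (boundary embH)))
      (All.++⁻ʳ (apexFaces 1 (nb C) arc₁) off-rest)))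
    where
    off-rest : All (All (Off 0)) (apexFaces 1 (nb C) arc₁ ++ restH)
    off-rest = All.concat⁻ (All.++⁻ʳ (concat (triple arc₀)) off-base)
    mapped : ∀ fs → All (Closed (Turn (rot H))) fs → All (All (Off 0)) fs → All (Closed (Turn rotP)) (map (map σσ) fs)
    mapped []       []       []       = []
    mapped (_ ∷ fs) (c ∷ cs) (o ∷ os) = closedH o c ∷ mapped fs cs os
    allG : ∀ {fs} → All (Closed (Turn (rot G))) fs → All (All (Off 0)) fs → All (Closed (Turn rotP)) fs
    allG []       []       = []
    allG (c ∷ cs) (o ∷ os) = closedG o c ∷ allG cs os

  σ≢0 : ∀ {v} → v ≢ 0 → v ≢ 1 → σ v ≢ 0
  σ≢0 v≢0 v≢1 with src _ v≢0
  ... | apex = ⊥-elim (v≢1 refl)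
  ... | term i = λ eq → a≢0 (opp i) (trans (sym (σ-term i)) eq)
  ... | inner j = λ eq → 0≢m+ j (sym eq)

  offσ : ∀ {ds} → All (Off 0) ds → All (Off 1) ds → All (Off 0) (map σσ ds)
  offσ []             []             = []
  offσ ((p , q) ∷ ps) ((p′ , q′) ∷ qs) = (σ≢0 p p′ , σ≢0 q q′) ∷ offσ ps qs

  offP : All (Off 0) (concat (triple arcP) ++ concat restP)
  offP = All.++⁺ (All.++⁺ (arcs 0F) (All.++⁺ (arcs 1F) (All.++⁺ (arcs 2F) [])))
      (subst (All (Off 0)) ((concat-++ restG (triple merged ++ map (map σσ) restH))) (All.++⁺ (All.++⁻ʳ (concat (triple arc)) off-apex)
        (subst (All (Off 0)) ((concat-++ (triple merged) (map (map σσ) restH))) (All.++⁺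
          (All.++⁺ (mg 0F) (All.++⁺ (mg 1F) (All.++⁺ (mg 2F) [])))
          (subst (All (Off 0)) (sym (concat-map {f = σσ} restH)) (offσ off-r off-r₁))))))
    where
    off₀ : All (Off 0) (concat (apexFaces 1 (nb C) arc₁) ++ concat restH)
    off₀ = subst (All (Off 0)) (sym (concat-++ (apexFaces 1 (nb C) arc₁) restH)) (All.++⁻ʳ (concat (triple arc₀)) off-base)
    off-r : All (Off 0) (concat restH)
    off-r = All.++⁻ʳ (concat (apexFaces 1 (nb C) arc₁)) off₀
    off-r₁ : All (Off 1) (concat restH)
    off-r₁ = All.++⁻ʳ (concat (triple arc₁)) (All.++⁻ʳ (concat (triple arc₀)) off-next)
    tail₂ : {Q : Dart → Set} {d e : Dart} {ds : List Dart} → All Q (d ∷ e ∷ ds) → All Q ds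
    tail₂ (_ ∷ _ ∷ qs) = qs
    arcs : ∀ i → All (Off 0) (arcP i)
    arcs i = offσ (tail₂ (concat-lookup (apexFace 1 (nb C) arc₁) off₀ i))
      (concat-lookup arc₁ (All.++⁻ʳ (concat (triple arc₀)) off-next) i)
    mg : ∀ i → All (Off 0) (merged i)
    mg i = All.++⁺ (off-arc i) (offσ (off-arc₀ (partner i)) (concat-lookup arc₀ off-next (partner i)))

  planeP : PlaneApex P apexP
  planeP = record
    { arc = arcP ; rest = restP ; off-apex = offP
    ; embedding = record { boundary = closedP ; distinct = uniqueP ; dart⇒edge = dart⇒edgeP
                         ; edge⇒dart = edge⇒dartP ; euler = eulerP } }

-- Grinberg's criterion modulo 3

module Succ-unique {X : Set} where

  Succ-tail : ∀ {z xs} {u w : X} → Succ (z ∷ xs) u w → w ∈ xs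
  Succ-tail now       = here refl
  Succ-tail (later s) = Succ-snd s

  Succ-det : ∀ {xs} {u v w : X} → Unique xs → Succ xs u v → Succ xs u w → v ≡ w
  Succ-det u         now       now        = refl
  Succ-det (x∉ ∷ _)  now       (later s)  = ⊥-elim (All.lookup x∉ (Succ-fst s) refl)
  Succ-det (x∉ ∷ _)  (later s) now        = ⊥-elim (All.lookup x∉ (Succ-fst s) refl)
  Succ-det (_ ∷ u)   (later s) (later s′) = Succ-det u s s′

  Succ-inj : ∀ {xs} {u v w : X} → Unique xs → Succ xs u w → Succ xs v w → u ≡ v
  Succ-inj u         now       now        = refl
  Succ-inj (_ ∷ u)   now       (later s)  = ⊥-elim (head∉ u (Succ-tail s))
  Succ-inj (_ ∷ u)   (later s) now        = ⊥-elim (head∉ u (Succ-tail s))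
  Succ-inj (_ ∷ u)   (later s) (later s′) = Succ-inj u s s′

  Succ-asym : ∀ {xs} {u v : X} → Unique xs → Succ xs u v → ¬ Succ xs v u
  Succ-asym u        now       s          = head∉ u (Succ-tail s)
  Succ-asym u        (later s) now        = head∉ u (Succ-snd s)
  Succ-asym (_ ∷ u)  (later s) (later s′) = Succ-asym u s s′

  Last-Succ : ∀ {xs} {u v : X} → Unique xs → Last xs u → ¬ Succ xs u v
  Last-Succ uq (ys , refl) s = go ys uq s
    where
    go : ∀ ys {u v} → Unique (ys ++ [ u ]) → ¬ Succ (ys ++ [ u ]) u v
    go []           _        (later ())
    go (y ∷ [])     (y∉ ∷ _) now       = All.lookup y∉ (here refl) refl
    go (y ∷ [])     (_ ∷ u)  (later s) = go [] u s
    go (y ∷ z ∷ ys) (y∉ ∷ _) now       = All.lookup y∉ (there (∈-++⁺ʳ ys (here refl))) refl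
    go (y ∷ z ∷ ys) (_ ∷ u)  (later s) = go (z ∷ ys) u s

  Last-det : ∀ {xs} {u v : X} → Last xs u → Last xs v → u ≡ v
  Last-det (ys , refl) (zs , eq) = go ys zs eq
    where
    go : ∀ ys zs {u v} → ys ++ [ u ] ≡ zs ++ [ v ] → u ≡ v
    go []       []       refl = refl
    go (_ ∷ ys) (_ ∷ zs) eq   = go ys zs (cong (λ { [] → [] ; (_ ∷ t) → t }) eq)
    go []       (_ ∷ []) ()
    go []       (_ ∷ _ ∷ _) ()
    go (_ ∷ []) []       ()
    go (_ ∷ _ ∷ _) []    ()

  Next-det : ∀ {xs} {u v w : X} → Unique xs → Next xs u v → Next xs u w → v ≡ w
  Next-det {x ∷ xs} uq s s′ with Succ-snoc (x ∷ xs) s | Succ-snoc (x ∷ xs) s′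
  ... | inj₁ t | inj₁ t′ = Succ-det uq t t′
  ... | inj₁ t | inj₂ (_ , l) = ⊥-elim (Last-Succ uq l t)
  ... | inj₂ (_ , l) | inj₁ t = ⊥-elim (Last-Succ uq l t)
  ... | inj₂ (eq , _) | inj₂ (eq′ , _) = trans eq (sym eq′)

  Next-inj : ∀ {xs} {u v w : X} → Unique xs → Next xs u w → Next xs v w → u ≡ v
  Next-inj {x ∷ xs} uq s s′ with Succ-snoc (x ∷ xs) s | Succ-snoc (x ∷ xs) s′
  ... | inj₁ t | inj₁ t′ = Succ-inj uq t t′
  ... | inj₁ t | inj₂ (refl , _) = ⊥-elim (head∉ uq (Succ-tail t))
  ... | inj₂ (refl , _) | inj₁ t = ⊥-elim (head∉ uq (Succ-tail t))
  ... | inj₂ (_ , l) | inj₂ (_ , l′) = Last-det l l′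

  Last-tail : ∀ {x y zs} {v : X} → Last (x ∷ y ∷ zs) v → Last (y ∷ zs) v
  Last-tail ([]     , ())
  Last-tail (_ ∷ ys , eq) = ys , ∷-injectiveʳ eq

  wrapped : ∀ {x xs} {v : X} → Unique (x ∷ xs) → 2 ≤ length xs → Succ (x ∷ xs) x v → ¬ Last (x ∷ xs) v
  wrapped uq       (s≤s ()) (now {xs = []})    last
  wrapped (_ ∷ uq) l        (now {xs = _ ∷ _}) last = Last-Succ uq (Last-tail last) now
  wrapped uq       l        (later t)          last = head∉ uq (Succ-fst t)

  Next-asym : ∀ {x xs} {u v : X} → Unique (x ∷ xs) → 2 ≤ length xs → Next (x ∷ xs) u v → ¬ Next (x ∷ xs) v u
  Next-asym {x} {xs} uq l s s′ with Succ-snoc (x ∷ xs) s | Succ-snoc (x ∷ xs) s′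
  ... | inj₁ t | inj₁ t′ = Succ-asym uq t t′
  ... | inj₁ t | inj₂ (refl , last) = wrapped uq l t last
  Next-asym {x} {xs} uq l s s′ | inj₂ (refl , last) | inj₁ t = wrapped uq l t last
  Next-asym {x} {y ∷ xs} uq l s s′ | inj₂ (refl , last) | inj₂ (refl , _) = Last-Succ uq last now

  Succ-cut : ∀ xs {y ys} {u w : X} → Succ (xs ++ y ∷ ys) u w → Succ (xs ++ [ y ]) u w ⊎ Succ (y ∷ ys) u w
  Succ-cut []           s         = inj₂ s
  Succ-cut (x ∷ [])     now       = inj₁ now
  Succ-cut (x ∷ [])     (later s) = inj₂ s
  Succ-cut (x ∷ z ∷ xs) now       = inj₁ now
  Succ-cut (x ∷ z ∷ xs) (later s) with Succ-cut (z ∷ xs) s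
  ... | inj₁ s′ = inj₁ (later s′)
  ... | inj₂ s′ = inj₂ s′

  Next-rotate : ∀ as {s bs} {u w : X} → Succ ((s ∷ bs ++ as) ++ [ s ]) u w → Next (as ++ s ∷ bs) u w
  Next-rotate [] {s} {bs} {u} {w} sc = subst (λ t → Succ (s ∷ t ++ [ s ]) u w) (List.++-identityʳ bs) sc
  Next-rotate (x ∷ as) {s} {bs} {u} {w} sc with Succ-cut (s ∷ bs) (subst (λ t → Succ t u w) (++-assoc (s ∷ bs) (x ∷ as) [ s ]) sc)
  ... | inj₁ t = subst (λ z → Succ (x ∷ z) u w) (sym (++-assoc as (s ∷ bs) [ x ])) (Succ-++ʳ (x ∷ as) t)
  ... | inj₂ t = subst (λ z → Succ (x ∷ z) u w) (trans (++-assoc as [ s ] (bs ++ [ x ])) (sym (++-assoc as (s ∷ bs) [ x ])))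
                   (Succ-++ˡ t)

  Next-snd : ∀ {xs} {u : X} → u ∈ xs → ∃[ w ] Next xs u w
  Next-snd {x ∷ xs} u∈ = go (x ∷ xs) u∈
    where
    go : ∀ ys {z u} → u ∈ ys → ∃[ w ] Succ (ys ++ [ z ]) u w
    go (y ∷ [])     (here refl) = _ , now
    go (y ∷ _ ∷ ys) (here refl) = _ , now
    go (y ∷ ys)     (there u∈) with go ys u∈
    ... | w , s = w , later s

  Next-pre : ∀ {xs} {u : X} → u ∈ xs → ∃[ w ] Next xs w u
  Next-pre {x ∷ xs} (here refl) = go x xs
    where
    go : ∀ y ys {z} → ∃[ w ] Succ (y ∷ ys ++ [ z ]) w z
    go y []       = y , now
    go y (y′ ∷ ys) with go y′ ys
    ... | w , s = w , later s
  Next-pre {x ∷ xs} (there u∈) = go x xs u∈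
    where
    go : ∀ y ys {z u} → u ∈ ys → ∃[ w ] Succ (y ∷ ys ++ [ z ]) w u
    go y (_ ∷ ys) (here refl) = y , now
    go y (y′ ∷ ys) (there u∈) with go y′ ys u∈
    ... | w , s = w , later s

open Succ-unique

-- Edge counts of connected classes

data Conn {X : Set} (es : List (X × X)) : X → X → Set where
  stop : ∀ {x} → Conn es x x
  fwd  : ∀ {x y z} → (x , y) ∈ es → Conn es y z → Conn es x z
  bwd  : ∀ {x y z} → (y , x) ∈ es → Conn es y z → Conn es x z

module _ {X : Set} {es : List (X × X)} where

  _◅◅_ : ∀ {x y z} → Conn es x y → Conn es y z → Conn es x z
  stop    ◅◅ d = d
  fwd e c ◅◅ d = fwd e (c ◅◅ d)
  bwd e c ◅◅ d = bwd e (c ◅◅ d)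

  back : ∀ {x y} → Conn es x y → Conn es y x
  back stop      = stop
  back (fwd e c) = back c ◅◅ bwd e stop
  back (bwd e c) = back c ◅◅ fwd e stop

  Conn-mono : ∀ {fs x y} → (∀ {e} → e ∈ es → e ∈ fs) → Conn es x y → Conn fs x y
  Conn-mono h stop      = stop
  Conn-mono h (fwd e c) = fwd (h e) (Conn-mono h c)
  Conn-mono h (bwd e c) = bwd (h e) (Conn-mono h c)

module Forest {X : Set} (_≟ˣ_ : DecidableEquality X) where

  merge : X → X → X → X
  merge x y z with z ≟ˣ y
  ... | yes _ = x
  ... | no _  = z

  merge-y : ∀ x y → merge x y y ≡ x
  merge-y x y with y ≟ˣ y
  ... | yes _  = refl
  ... | no y≢y = ⊥-elim (y≢y refl)

  merge-x : ∀ x y → merge x y x ≡ x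
  merge-x x y with x ≟ˣ y
  ... | yes _ = refl
  ... | no _  = refl

  merge-≢ : ∀ {x y z} → z ≢ y → merge x y z ≡ z
  merge-≢ {x} {y} {z} z≢y with z ≟ˣ y
  ... | yes eq = ⊥-elim (z≢y eq)
  ... | no _   = refl

  merge₂ : X → X → X × X → X × X
  merge₂ x y (u , v) = merge x y u , merge x y v

  contract : ∀ {x y es u v} → Conn ((x , y) ∷ es) u v → Conn (map (merge₂ x y) es) (merge x y u) (merge x y v)
  contract stop = stop
  contract {x} {y} {es} {v = v} (fwd (here refl) c) = subst (λ t → Conn (map (merge₂ x y) es) t (merge x y v)) (trans (merge-y x y) (sym (merge-x x y))) (contract c)
  contract {x} {y} {es} {v = v} (bwd (here refl) c) = subst (λ t → Conn (map (merge₂ x y) es) t (merge x y v)) (trans (merge-x x y) (sym (merge-y x y))) (contract c)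
  contract {x} {y} (fwd (there e) c) = fwd (∈-map⁺ (merge₂ x y) e) (contract c)
  contract {x} {y} (bwd (there e) c) = bwd (∈-map⁺ (merge₂ x y) e) (contract c)

  other? : ∀ y z → Dec (z ≢ y)
  other? y z = ¬? (z ≟ˣ y)

  drop-one : ∀ y xs → Unique xs → length xs ≤ suc (length (filter (other? y) xs))
  drop-one y [] _ = z≤n
  drop-one y (x ∷ xs) (x∉ ∷ u) with x ≟ˣ y
  ... | no _     = s≤s (drop-one y xs u)
  ... | yes refl = s≤s (≤-reflexive (sym (cong length (filter-all (other? y) (All.map (λ x≢z eq → x≢z (sym eq)) x∉)))))

  -- Contracting the first edge and dropping its end `y` lowers the number of edges by one and that
  -- of the vertices by at most one. The recursion runs on `k`, since the contracted list is not a
  -- structural part of `es`.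
  forest-step : ∀ k es xs a → length es ≡ k → Unique xs → (∀ {x} → x ∈ xs → Conn es x a) → length xs ≤ suc k
  forest-step k [] []           a eq u conn = z≤n
  forest-step k [] (x ∷ [])     a eq u conn = s≤s z≤n
  forest-step k [] (x ∷ y ∷ xs) a eq (x∉ ∷ _) conn with conn (here refl) | conn (there (here refl))
  ... | stop | stop = ⊥-elim (All.lookup x∉ (here refl) refl)
  forest-step (suc k) ((x , y) ∷ es) xs a eq u conn = ≤-trans (drop-one y xs u) (s≤s
    (forest-step k (map (merge₂ x y) es) (filter (other? y) xs) (merge x y a)
      (trans (length-map _ es) (suc-injective eq)) (Unique.filter⁺ (other? y) u) conn′))
    where
    conn′ : ∀ {z} → z ∈ filter (other? y) xs → Conn (map (merge₂ x y) es) z (merge x y a)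
    conn′ z∈ with ∈-filter⁻ (other? y) {xs = xs} z∈
    ... | z∈xs , z≢y = subst (λ t → Conn _ t _) (merge-≢ z≢y) (contract (conn z∈xs))

  forest : ∀ es xs a → Unique xs → (∀ {x} → x ∈ xs → Conn es x a) → length xs ≤ suc (length es)
  forest es xs a = forest-step (length es) es xs a refl

length-⊆ : {X : Set} (_≟ˣ_ : DecidableEquality X) → ∀ {xs ys : List X} → Unique xs →
           (∀ {v} → v ∈ xs → v ∈ ys) → length xs ≤ length ys
length-⊆ _≟ˣ_ {[]}     {[]}     u sub = z≤n
length-⊆ _≟ˣ_ {x ∷ xs} {[]}     u sub with sub (here refl)
... | ()
length-⊆ _≟ˣ_ {xs}     {z ∷ zs} u sub =
  ≤-trans (drop-one z xs u) (s≤s (length-⊆ _≟ˣ_ (Unique.filter⁺ (other? z) u) sub′))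
  where
  open Forest _≟ˣ_ using (drop-one; other?)
  sub′ : ∀ {v} → v ∈ filter (other? z) xs → v ∈ zs
  sub′ v∈ with ∈-filter⁻ (other? z) {xs = xs} v∈
  ... | v∈xs , v≢z with sub v∈xs
  ...   | here eq   = ⊥-elim (v≢z eq)
  ...   | there v∈′ = v∈′

-- A path, not a cycle: it connects the l darts of a face by l - 1 pairs, the least possible number,
-- and the count below leaves no slack.
links : {X : Set} → List X → List (X × X)
links []           = []
links (x ∷ [])     = []
links (x ∷ y ∷ xs) = (x , y) ∷ links (y ∷ xs)

to-head : {X : Set} {x : X} {xs : List X} {y : X} → y ∈ x ∷ xs → Conn (links (x ∷ xs)) y x
to-head (here refl) = stop
to-head {xs = z ∷ xs} (there y∈) = Conn-mono there (to-head y∈) ◅◅ bwd (here refl) stop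

links-fst : {X : Set} (xs : List X) {x y : X} → (x , y) ∈ links xs → x ∈ xs × y ∈ xs
links-fst (x ∷ y ∷ xs) (here refl) = here refl , there (here refl)
links-fst (x ∷ y ∷ xs) (there e) with links-fst (y ∷ xs) e
... | p , q = there p , there q

Walk-next : {X : Set} {R : X → X → Set} → ∀ {z zs y d} → Walk R z zs y → d ∈ z ∷ zs → ∃[ e ] (R d e × e ∈ zs ++ [ y ])
Walk-next (step r) (here refl) = _ , r , here refl
Walk-next (r ∷ w)  (here refl) = _ , r , here refl
Walk-next (r ∷ w)  (there d∈) with Walk-next w d∈
... | e , r′ , e∈ = e , r′ , there e∈

swap : Dart → Dart
swap (u , v) = v , u

_≟ᵈ_ : DecidableEquality Dart
_≟ᵈ_ = ≡-dec _≟_ _≟_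

open DecMembership _≟ᵈ_ using () renaming (_∈?_ to _∈ᵈ?_)

trail : ℕ → List ℕ → ℕ → List Dart
trail x []       y = [ (x , y) ]
trail x (z ∷ zs) y = (x , z) ∷ trail z zs y

∈trail : ∀ {x} xs {y u v} → (u , v) ∈ trail x xs y → Succ (x ∷ xs ++ [ y ]) u v
∈trail []       (here refl) = now
∈trail (z ∷ zs) (here refl) = now
∈trail (z ∷ zs) (there d)   = later (∈trail zs d)

trail∋ : ∀ {x} xs {y u v} → Succ (x ∷ xs ++ [ y ]) u v → (u , v) ∈ trail x xs y
trail∋ []       now              = here refl
trail∋ []       (later (later ()))
trail∋ (z ∷ zs) now              = here refl
trail∋ (z ∷ zs) (later s)        = there (trail∋ zs s)

trail-fst : ∀ x xs y → map proj₁ (trail x xs y) ≡ x ∷ xs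
trail-fst x []       y = refl
trail-fst x (z ∷ zs) y = cong (x ∷_) (trail-fst z zs y)

trail-edge : ∀ {E : ℕ → ℕ → Set} {x xs y u v} → Walk E x xs y → (u , v) ∈ trail x xs y → E u v
trail-edge (step e) (here refl) = e
trail-edge (e ∷ w)  (here refl) = e
trail-edge (e ∷ w)  (there d)   = trail-edge w d

-- The list `es` links the darts along each face and the two darts of each chord. Every dart is then
-- connected to one of the two darts of a fixed cycle edge, so there are at most two classes. As
-- there are two links fewer than darts, there are exactly two classes, and each is spanned by a
-- tree. They play the part of the interior and the exterior of the cycle.
module Grinberg (G : Net) (faces : List (List Dart)) (emb : Embedding G faces)
                {x : ℕ} {xs : List ℕ} (c : Cycle (order G) (Edge G) [] x xs) where

  D : List Dart
  D = concat faces

  on : ∀ {u} → u < order G → u ∈ x ∷ xs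
  on u< = complete c u< λ ()

  along against chords chords< : List Dart
  along   = trail x xs x
  against = map swap along

  chord? : ∀ d → Dec (d ∉ along × d ∉ against)
  chord? d = ¬? (d ∈ᵈ? along) ×-dec ¬? (d ∈ᵈ? against)

  increasing? : ∀ d → Dec (proj₁ d < proj₂ d)
  increasing? (u , v) = u <? v

  chords  = filter chord? D
  chords< = filter increasing? chords

  flips : List (Dart × Dart)
  flips = map (λ d → d , swap d) chords<

  faceLinks : List (Dart × Dart)
  faceLinks = concat (map links faces)

  es : List (Dart × Dart)
  es = faceLinks ++ flips

  _~_ : Dart → Dart → Set
  _~_ = Conn es

  swap∈D : ∀ {d} → d ∈ D → swap d ∈ D
  swap∈D d∈ = edge⇒dart emb (symm G (dart⇒edge emb d∈))

  along⊆D : ∀ {d} → d ∈ along → d ∈ D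
  along⊆D d∈ = edge⇒dart emb (trail-edge (closed c) d∈)

  against⇒ : ∀ {u v} → (u , v) ∈ against → (v , u) ∈ along
  against⇒ d∈ with ∈-map⁻ swap d∈
  ... | _ , e∈ , refl = e∈

  ⇒against : ∀ {u v} → (v , u) ∈ along → (u , v) ∈ against
  ⇒against = ∈-map⁺ swap

  swap-chord : ∀ {d} → d ∈ chords → swap d ∈ chords
  swap-chord d∈ with ∈-filter⁻ chord? {xs = D} d∈
  ... | d∈D , ∉1 , ∉2 = ∈-filter⁺ chord? (swap∈D d∈D) ((λ e → ∉2 (⇒against e)) , λ e → ∉1 (against⇒ e))

  flip~ : ∀ {d} → d ∈ chords → d ~ swap d
  flip~ {u , v} d∈ with <-cmp u v
  ... | tri< u<v _ _ = fwd (∈-++⁺ʳ faceLinks (∈-map⁺ _ (∈-filter⁺ increasing? d∈ u<v))) stop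
  ... | tri> _ _ v<u = bwd (∈-++⁺ʳ faceLinks (∈-map⁺ _ (∈-filter⁺ increasing? (swap-chord d∈) v<u))) stop
  ... | tri≈ _ refl _ = stop

  same-face : ∀ {f d e} → f ∈ faces → d ∈ f → e ∈ f → d ~ e
  same-face {f ∷ fs} f∈ d∈ e∈ = inFace (to-head d∈ ◅◅ back (to-head e∈))
    where
    inFace : ∀ {d e} → Conn (links (f ∷ fs)) d e → d ~ e
    inFace = Conn-mono λ l∈ → ∈-++⁺ˡ (∈-concat⁺′ l∈ (∈-map⁺ links f∈))

  -- The two darts are consecutive on a face, because `Turn` continues `(v , u)` with the successor
  -- of `v` around `u`.
  corner : ∀ {u v w} → Next (rot G u) v w → (v , u) ~ (u , w)
  corner {u} {v} s with ∈-concat⁻′ faces (edge⇒dart emb (symm G (Next-fst s)))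
  ... | d ∷ ds , d∈ , f∈ with Walk-next (All.lookup (boundary emb) f∈) d∈
  ...   | (_ , w′) , turn s′ , e∈ with Next-det (uniq G u) s s′
  ...     | refl = same-face f∈ d∈ (∈-resp-↭ (++-comm ds [ d ]) e∈)

  -- Turning around u, the darts leaving u stay in one class as long as no
  -- cycle edge is crossed.
  chain : ∀ u z ms {y} → (∀ {v w} → Succ (z ∷ ms ++ [ y ]) v w → Next (rot G u) v w) →
          All (λ v → (u , v) ∈ chords) ms → ∀ {w} → w ∈ ms ++ [ y ] → (z , u) ~ (u , w)
  chain u z []       h []       (here refl) = corner (h now)
  chain u z (_ ∷ _)  h _        (here refl) = corner (h now)
  chain u z (m ∷ ms) h (p ∷ ps) (there w∈)  =
    corner (h now) ◅◅ (flip~ p ◅◅ chain u m ms (λ s → h (later s)) ps w∈)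

  module Around {p u s : ℕ} (pu : (p , u) ∈ along) (us : (u , s) ∈ along) where

    s∈ : s ∈ rot G u
    s∈ = trail-edge (closed c) us

    p∈ : p ∈ rot G u
    p∈ = symm G (trail-edge (closed c) pu)

    chord : ∀ {v} → v ∈ rot G u → v ≢ p → v ≢ s → (u , v) ∈ chords
    chord v∈ v≢p v≢s = ∈-filter⁺ chord? (edge⇒dart emb v∈)
      ( (λ e → v≢s (Next-det (unique c) (∈trail xs e) (∈trail xs us)))
      , (λ e → v≢p (Next-inj (unique c) (∈trail xs (against⇒ e)) (∈trail xs pu))))

    p≢s : p ≢ s
    p≢s refl = Next-asym (unique c) (long c) (∈trail xs pu) (∈trail xs us)

    split-rot : ∃[ m₁ ] ∃[ m₂ ] ((rot G u ↭ s ∷ m₁ ++ p ∷ m₂)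
                × (∀ {v w} → Succ ((s ∷ m₁ ++ p ∷ m₂) ++ [ s ]) v w → Next (rot G u) v w))
    split-rot with ∈-∃++ s∈
    ... | as , bs , eq with ∈-resp-↭ (++-comm as (s ∷ bs)) (subst (p ∈_) eq p∈)
    ...   | here refl = ⊥-elim (p≢s refl)
    ...   | there p∈′ with ∈-∃++ p∈′
    ...     | m₁ , m₂ , eq′ = m₁ , m₂
            , subst₂ _↭_ (sym eq) (cong (s ∷_) eq′) (++-comm as (s ∷ bs))
            , λ sc → subst (λ t → Next t _ _) (sym eq) (Next-rotate as (subst (λ t → Succ (s ∷ t ++ [ s ]) _ _) (sym eq′) sc))

    -- The cycle neighbours `p` and `s` divide the rotation at `u` into two intervals, in which all
    -- darts belong to chords. So `chain` sweeps through each: from `(p , u)` as far as `(u , s)`,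
    -- and from `(s , u)` as far as `(u , p)`.
    classes : (p , u) ~ (u , s) × (s , u) ~ (u , p) × (∀ {v} → v ∈ rot G u → ((u , v) ~ (p , u)) ⊎ ((u , v) ~ (s , u)))
    classes with split-rot
    ... | m₁ , m₂ , perm , next = L (∈-++⁺ʳ m₂ (here refl)) , R (∈-++⁺ʳ m₁ (here refl)) , all
      where
      uq : Unique (s ∷ m₁ ++ p ∷ m₂)
      uq = Unique-resp-↭ perm (uniq G u)
      uq′ : Unique (p ∷ m₂ ++ s ∷ m₁)
      uq′ = Unique-resp-↭ (++-comm (s ∷ m₁) (p ∷ m₂)) uq
      back∈ : ∀ {v} → v ∈ s ∷ m₁ ++ p ∷ m₂ → v ∈ rot G u
      back∈ = ∈-resp-↭ (↭-sym perm)
      R : ∀ {w} → w ∈ m₁ ++ [ p ] → (s , u) ~ (u , w)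
      R = chain u s m₁ (λ sc → next (subst (λ t → Succ (s ∷ t) _ _)
            (trans (++-assoc m₁ [ p ] (m₂ ++ [ s ])) (sym (++-assoc m₁ (p ∷ m₂) [ s ]))) (Succ-++ˡ sc)))
            (All.tabulate λ v∈ → chord (back∈ (there (∈-++⁺ˡ v∈)))
              (λ { refl → head∉ uq′ (∈-++⁺ʳ m₂ (there v∈)) }) (λ { refl → head∉ uq (∈-++⁺ˡ v∈) }))
      L : ∀ {w} → w ∈ m₂ ++ [ s ] → (p , u) ~ (u , w)
      L = chain u p m₂ (λ sc → next (subst (λ t → Succ (s ∷ t) _ _) (sym (++-assoc m₁ (p ∷ m₂) [ s ])) (Succ-++ʳ (s ∷ m₁) sc)))
            (All.tabulate λ v∈ → chord (back∈ (there (∈-++⁺ʳ m₁ (there v∈))))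
              (λ { refl → head∉ uq′ (∈-++⁺ˡ v∈) }) (λ { refl → head∉ uq (∈-++⁺ʳ m₁ (there v∈)) }))
      all : ∀ {v} → v ∈ rot G u → ((u , v) ~ (p , u)) ⊎ ((u , v) ~ (s , u))
      all v∈ with ∈-resp-↭ perm v∈
      ... | here refl = inj₁ (back (L (∈-++⁺ʳ m₂ (here refl))))
      ... | there v∈′ with ∈-++⁻ m₁ v∈′
      ...   | inj₁ v∈₁ = inj₂ (back (R (∈-++⁺ˡ v∈₁)))
      ...   | inj₂ (here refl) = inj₂ (back (R (∈-++⁺ʳ m₁ (here refl))))
      ...   | inj₂ (there v∈₂) = inj₁ (back (L (∈-++⁺ˡ v∈₂)))

  step-along : ∀ {p u s} → (p , u) ∈ along → (u , s) ∈ along → (p , u) ~ (u , s)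
  step-along pu us = proj₁ (Around.classes pu us)

  step-against : ∀ {p u s} → (p , u) ∈ along → (u , s) ∈ along → (u , p) ~ (s , u)
  step-against pu us = back (proj₁ (proj₂ (Around.classes pu us)))

  first : ℕ → List ℕ → ℕ → Dart
  first x []      y = x , y
  first x (z ∷ _) y = x , z

  first∈ : ∀ x zs y → first x zs y ∈ trail x zs y
  first∈ x []      y = here refl
  first∈ x (_ ∷ _) y = here refl

  to-first : (Q : Dart → Dart → Set) → (∀ {d} → Q d d) → (∀ {d e f} → Q d e → Q e f → Q d f) →
             (∀ {p u s} → (p , u) ∈ along → (u , s) ∈ along → Q (u , s) (p , u)) →
             ∀ x zs y → (∀ {d} → d ∈ trail x zs y → d ∈ along) → ∀ {d} → d ∈ trail x zs y → Q d (first x zs y)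
  to-first Q r t h x []       y sub (here refl) = r
  to-first Q r t h x (z ∷ zs) y sub (here refl) = r
  to-first Q r t h x (z ∷ zs) y sub (there d∈) =
    t (to-first Q r t h z zs y (λ e∈ → sub (there e∈)) d∈) (link zs (sub (there (first∈ z zs y))))
    where
    link : ∀ zs → first z zs y ∈ along → Q (first z zs y) (x , z)
    link []      f∈ = h (sub (here refl)) f∈
    link (_ ∷ _) f∈ = h (sub (here refl)) f∈

  root : Bool → Dart
  root true  = first x xs x
  root false = swap (first x xs x)

  along~ : ∀ {d} → d ∈ along → d ~ root true
  along~ = to-first _~_ stop _◅◅_ (λ pu us → back (step-along pu us)) x xs x (λ d∈ → d∈)

  against~ : ∀ {d} → d ∈ along → swap d ~ root false
  against~ = to-first (λ d e → swap d ~ swap e) stop _◅◅_ (λ pu us → back (step-against pu us)) x xs x (λ d∈ → d∈)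

  -- Here the cycle has to be Hamiltonian: the tail of the dart has a predecessor and a successor on
  -- it, and `classes` attaches the dart to one of the two cycle darts that enter or reverse there.
  classify : ∀ {d} → d ∈ D → (d ~ root true) ⊎ (d ~ root false)
  classify {u , v} d∈ with Next-pre u∈ | Next-snd u∈
    where u∈ = on (bound G (dart⇒edge emb d∈))
  ... | p , pu | s , us with proj₂ (proj₂ (Around.classes (trail∋ xs pu) (trail∋ xs us))) (dart⇒edge emb d∈)
  ...   | inj₁ q = inj₁ (q ◅◅ along~ (trail∋ xs pu))
  ...   | inj₂ q = inj₂ (q ◅◅ against~ (trail∋ xs us))

  unique-along : Unique along
  unique-along = Unique.map⁻ (subst Unique (sym (trail-fst x xs x)) (unique c))

  swap-inj : ∀ {d e} → swap d ≡ swap e → d ≡ e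
  swap-inj {_ , _} {_ , _} refl = refl

  partition : D ↭ along ++ (against ++ (chords< ++ map swap chords<))
  partition = unique-↭ (distinct emb)
    (Unique.++⁺ unique-along (Unique.++⁺ (Unique.map⁺ swap-inj unique-along)
      (Unique.++⁺ uc (Unique.map⁺ swap-inj uc) d₃) d₂) d₁) to from
    where
    uc : Unique chords<
    uc = Unique.filter⁺ increasing? (Unique.filter⁺ chord? (distinct emb))
    chord< : ∀ {d} → d ∈ chords< → d ∈ chords × proj₁ d < proj₂ d
    chord< = ∈-filter⁻ increasing? {xs = chords}
    isChord : ∀ {d} → d ∈ chords< ++ map swap chords< → d ∈ chords
    isChord d∈ with ∈-++⁻ chords< d∈
    ... | inj₁ d∈₁ = proj₁ (chord< d∈₁)
    ... | inj₂ d∈₂ with ∈-map⁻ swap d∈₂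
    ...   | _ , e∈ , refl = swap-chord (proj₁ (chord< e∈))
    d₃ : ∀ {d} → ¬ (d ∈ chords< × d ∈ map swap chords<)
    d₃ (d∈ , e∈) with ∈-map⁻ swap e∈
    ... | _ , e∈′ , refl = <-asym (proj₂ (chord< d∈)) (proj₂ (chord< e∈′))
    d₂ : ∀ {d} → ¬ (d ∈ against × d ∈ chords< ++ map swap chords<)
    d₂ (d∈ , e∈) = proj₂ (proj₂ (∈-filter⁻ chord? {xs = D} (isChord e∈))) d∈
    d₁ : ∀ {d} → ¬ (d ∈ along × d ∈ against ++ (chords< ++ map swap chords<))
    d₁ (d∈ , e∈) with ∈-++⁻ against e∈
    ... | inj₁ e∈₁ = Next-asym (unique c) (long c) (∈trail xs d∈) (∈trail xs (against⇒ e∈₁))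
    ... | inj₂ e∈₂ = proj₁ (proj₂ (∈-filter⁻ chord? {xs = D} (isChord e∈₂))) d∈
    to : ∀ {d} → d ∈ D → d ∈ along ++ (against ++ (chords< ++ map swap chords<))
    to {d} d∈ with d ∈ᵈ? along | d ∈ᵈ? against
    ... | yes p | _ = ∈-++⁺ˡ p
    ... | no _ | yes q = ∈-++⁺ʳ along (∈-++⁺ˡ q)
    ... | no p | no q with <-cmp (proj₁ d) (proj₂ d)
    ...   | tri< l _ _ = ∈-++⁺ʳ along (∈-++⁺ʳ against (∈-++⁺ˡ (∈-filter⁺ increasing? (∈-filter⁺ chord? d∈ (p , q)) l)))
    ...   | tri> _ _ g = ∈-++⁺ʳ along (∈-++⁺ʳ against (∈-++⁺ʳ chords< (∈-map⁺ swap
              (∈-filter⁺ increasing? (swap-chord (∈-filter⁺ chord? d∈ (p , q))) g))))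
    ...   | tri≈ _ refl _ = ⊥-elim (irrefl G (dart⇒edge emb d∈))
    from : ∀ {d} → d ∈ along ++ (against ++ (chords< ++ map swap chords<)) → d ∈ D
    from d∈ with ∈-++⁻ along d∈
    ... | inj₁ d∈₁ = along⊆D d∈₁
    ... | inj₂ d∈₂ with ∈-++⁻ against d∈₂
    ...   | inj₂ d∈₃ = proj₁ (∈-filter⁻ chord? {xs = D} (isChord d∈₃))
    ...   | inj₁ d∈₃ with ∈-map⁻ swap d∈₃
    ...     | _ , e∈ , refl = swap∈D (along⊆D e∈)

  n q : ℕ
  n = length along
  q = length chords<

  order≡n : order G ≡ n
  order≡n = ≤-antisym
    (subst (_≤ n) (length-upTo (order G)) (≤-trans (length-⊆ _≟_ (Unique.upTo⁺ (order G)) (λ v∈ → on (∈-upTo⁻ v∈))) (≤-reflexive len)))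
    (≤-trans (≤-reflexive (sym len)) (subst (length (x ∷ xs) ≤_) (length-upTo (order G))
      (length-⊆ _≟_ (unique c) (λ v∈ → ∈-upTo⁺ (proj₁ (sound c v∈))))))
    where
    len : length (x ∷ xs) ≡ n
    len = trans (cong length (sym (trail-fst x xs x))) (length-map proj₁ along)

  size-D : length D ≡ n + (n + (q + q))
  size-D = trans (↭-length partition) (trans (length-++ along) (cong (n +_)
    (trans (length-++ against) (cong₂ _+_ (length-map swap along)
      (trans (length-++ chords<) (cong (q +_) (length-map swap chords<)))))))

  length-links : ∀ fs → All (Closed (Turn (rot G))) fs → length (concat fs) ≡ length (concat (map links fs)) + length fs
  length-links [] [] = refl
  length-links ((d ∷ ds) ∷ fs) (_ ∷ cs) = trans (length-++ (d ∷ ds)) (trans (cong₂ _+_ (one d ds) (length-links fs cs))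
    (trans (reorder (length (links (d ∷ ds))) (length (concat (map links fs))) (length fs))
      (cong (_+ suc (length fs)) (sym (length-++ (links (d ∷ ds)))))))
    where
    one : ∀ (d : Dart) ds → suc (length ds) ≡ suc (length (links (d ∷ ds)))
    one d []       = refl
    one d (e ∷ ds) = cong suc (one e ds)
    reorder : ∀ a b f → suc a + (b + f) ≡ (a + b) + suc f
    reorder = solve-∀

  number-of-faces : length faces ≡ 2 + q
  number-of-faces = arith n q (length faces) (trans (cong (λ t → 2 * t + 2 * length faces) (sym order≡n))
      (trans (euler emb) (cong (4 +_) size-D)))
    where
    double-inj : ∀ a b → a + a ≡ b + b → a ≡ b
    double-inj zero    zero    _  = refl
    double-inj (suc a) (suc b) eq = cong suc (double-inj a b (suc-injective (trans (sym (+-suc a a)) (trans (suc-injective eq) (+-suc b b)))))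
    arith : ∀ n q f → 2 * n + 2 * f ≡ 4 + (n + (n + (q + q))) → f ≡ 2 + q
    arith n q f eq = double-inj f (2 + q) (+-cancelˡ-≡ (n + n) (f + f) ((2 + q) + (2 + q)) (trans (sym (l n f)) (trans eq (r n q))))
      where
      l : ∀ n f → 2 * n + 2 * f ≡ (n + n) + (f + f)
      l = solve-∀
      r : ∀ n q → 4 + (n + (n + (q + q))) ≡ (n + n) + ((2 + q) + (2 + q))
      r = solve-∀

  length-flips : length flips ≡ q
  length-flips = length-map _ chords<

  -- A face of length l has l - 1 links, so `faceLinks` falls short of the darts by the number of
  -- faces, which is 2 + `q` by Euler's formula; the `q` flips make up for all but two.
  D≡es+2 : length D ≡ 2 + length es
  D≡es+2 = trans (length-links faces (boundary emb)) (trans (cong (length faceLinks +_) number-of-faces)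
    (trans (+-suc′ (length faceLinks) q) (cong (2 +_) (trans (cong (length faceLinks +_) (sym length-flips)) (sym (length-++ faceLinks))))))
    where
    +-suc′ : ∀ a q → a + (2 + q) ≡ 2 + (a + q)
    +-suc′ = solve-∀

  open Forest _≟ᵈ_ using (forest)

  -- Otherwise the links would connect all darts, and there are too few of them.
  separated : ¬ (root false ~ root true)
  separated bt = 1+n≰n (subst (_≤ suc (length es)) D≡es+2
    (forest es D (root true) (distinct emb) (λ d∈ → Sum.[ (λ d~ → d~) , (λ d~ → d~ ◅◅ bt) ]′ (classify d∈))))

  colour : Dart → Bool
  colour d with d ∈ᵈ? D
  ... | no _ = false
  ... | yes d∈ with classify d∈
  ...   | inj₁ _ = true
  ...   | inj₂ _ = false

  colour~ : ∀ {d} → d ∈ D → d ~ root (colour d)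
  colour~ {d} d∈ with d ∈ᵈ? D
  ... | no d∉ = ⊥-elim (d∉ d∈)
  ... | yes d∈′ with classify d∈′
  ...   | inj₁ r = r
  ...   | inj₂ r = r

  colour-unique : ∀ {d β} → d ∈ D → d ~ root β → colour d ≡ β
  colour-unique {d} {β} d∈ r = go (colour d) β (colour~ d∈) r
    where
    go : ∀ γ β → d ~ root γ → d ~ root β → γ ≡ β
    go true  true  _ _ = refl
    go false false _ _ = refl
    go true  false p r = ⊥-elim (separated (back r ◅◅ p))
    go false true  p r = ⊥-elim (separated (back p ◅◅ r))

  es⊆D : ∀ {d e} → (d , e) ∈ es → d ∈ D × e ∈ D
  es⊆D l∈ with ∈-++⁻ faceLinks l∈
  ... | inj₁ l∈₁ with ∈-concat⁻′ (map links faces) l∈₁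
  ...   | _ , l∈f , f∈ with ∈-map⁻ links f∈
  ...     | f , f∈′ , refl with links-fst f l∈f
  ...       | d∈ , e∈ = ∈-concat⁺′ d∈ f∈′ , ∈-concat⁺′ e∈ f∈′
  es⊆D l∈ | inj₂ l∈₂ with ∈-map⁻ _ l∈₂
  ... | d , d∈ , refl with proj₁ (∈-filter⁻ chord? {xs = D} (proj₁ (∈-filter⁻ increasing? {xs = chords} d∈)))
  ...   | d∈D = d∈D , swap∈D d∈D

  colour-~ : ∀ {d e} → d ∈ D → e ∈ D → d ~ e → colour d ≡ colour e
  colour-~ d∈ e∈ r = colour-unique d∈ (r ◅◅ colour~ e∈)

  colour-link : ∀ {d e} → (d , e) ∈ es → colour d ≡ colour e
  colour-link l∈ with es⊆D l∈
  ... | d∈ , e∈ = colour-~ d∈ e∈ (fwd l∈ stop)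

  faceColour : List Dart → Bool
  faceColour []      = false
  faceColour (d ∷ _) = colour d

  is? : ∀ β d → Dec (colour d ≡ β)
  is? β d = colour d Bool.≟ β

  link? : ∀ β (l : Dart × Dart) → Dec (colour (proj₁ l) ≡ β)
  link? β l = is? β (proj₁ l)

  face? : ∀ β f → Dec (faceColour f ≡ β)
  face? β f = faceColour f Bool.≟ β

  # : Bool → List Dart → ℕ
  # β ds = length (filter (is? β) ds)

  #links : Bool → List (Dart × Dart) → ℕ
  #links β ls = length (filter (link? β) ls)

  #faces : Bool → List (List Dart) → ℕ
  #faces β fs = length (filter (face? β) fs)

  -- Links never leave a colour class, so the forest bound holds within each class separately.
  class-forest : ∀ β → # β D ≤ suc (#links β es)
  class-forest β = forest (filter (link? β) es) (filter (is? β) D) (root β) (Unique.filter⁺ (is? β) (distinct emb)) conn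
    where
    restrict : ∀ {d e} → colour d ≡ β → d ~ e → Conn (filter (link? β) es) d e
    restrict eq stop       = stop
    restrict eq (fwd l∈ r) = fwd (∈-filter⁺ (link? β) l∈ eq) (restrict (trans (sym (colour-link l∈)) eq) r)
    restrict eq (bwd l∈ r) = bwd (∈-filter⁺ (link? β) l∈ eq′) (restrict eq′ r)
      where eq′ = trans (colour-link l∈) eq
    conn : ∀ {d} → d ∈ filter (is? β) D → Conn (filter (link? β) es) d (root β)
    conn d∈ with ∈-filter⁻ (is? β) {xs = D} d∈
    ... | d∈D , refl = restrict refl (colour~ d∈D)

  both : {X : Set} (g : X → Bool) → ∀ ys →
         length (filter (λ y → g y Bool.≟ true) ys) + length (filter (λ y → g y Bool.≟ false) ys) ≡ length ys
  both g [] = refl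
  both g (y ∷ ys) with g y
  ... | true  = cong suc (both g ys)
  ... | false = trans (+-suc _ _) (cong suc (both g ys))

  squeeze : ∀ {a b c d} → a ≤ c → b ≤ d → a + b ≡ c + d → a ≡ c × b ≡ d
  squeeze {a} {b} {c} {d} a≤c b≤d eq = a≡c , +-cancelˡ-≡ c b d (trans (cong (_+ b) (sym a≡c)) eq)
    where
    a≡c : a ≡ c
    a≡c = ≤-antisym a≤c (+-cancelʳ-≤ b c a (≤-trans (+-mono-≤ (≤-refl {c}) b≤d) (≤-reflexive (sym eq))))

  -- The two bounds of `class-forest` add up to the equation `D≡es+2`, so neither can be strict.
  class-size : ∀ β → # β D ≡ suc (#links β es)
  class-size = λ { true → proj₁ eqs ; false → proj₂ eqs }
    where
    eqs : # true D ≡ suc (#links true es) × # false D ≡ suc (#links false es)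
    eqs = squeeze (class-forest true) (class-forest false) (trans (both colour D) (trans D≡es+2
      (trans (cong (2 +_) (sym (both (λ l → colour (proj₁ l)) es))) (cong suc (sym (+-suc _ _))))))

  #-++ : ∀ β ds es → # β (ds ++ es) ≡ # β ds + # β es
  #-++ β ds es = trans (cong length (filter-++ (is? β) ds es)) (length-++ (filter (is? β) ds))

  #links-++ : ∀ β ds es → #links β (ds ++ es) ≡ #links β ds + #links β es
  #links-++ β ds es = trans (cong length (filter-++ (link? β) ds es)) (length-++ (filter (link? β) ds))

  mono : ∀ β {γ} ds → All (λ d → colour d ≡ γ) ds → (γ ≡ β × # β ds ≡ length ds) ⊎ (γ ≢ β × # β ds ≡ 0)
  mono β {γ} ds all with γ Bool.≟ β
  ... | yes refl = inj₁ (refl , cong length (filter-all (is? β) all))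
  ... | no γ≢β   = inj₂ (γ≢β , cong length (filter-none (is? β) (All.map (λ eq eq′ → γ≢β (trans (sym eq) eq′)) all)))

  along-true : All (λ d → colour d ≡ true) along
  along-true = All.tabulate λ d∈ → colour-unique (along⊆D d∈) (along~ d∈)

  against-false : All (λ d → colour d ≡ false) against
  against-false = All.map⁺ (All.tabulate λ d∈ → colour-unique (swap∈D (along⊆D d∈)) (against~ d∈))

  -- Each cycle edge has one dart on either side, whereas a chord has both darts on the same side.
  #cycle : ∀ β → # β along + # β against ≡ n
  #cycle true with mono true along along-true | mono true against against-false
  ... | inj₁ (_ , e) | inj₂ (_ , e′) = trans (cong₂ _+_ e e′) (+-identityʳ n)
  ... | inj₁ _ | inj₁ (() , _)
  ... | inj₂ (ne , _) | _ = ⊥-elim (ne refl)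
  #cycle false with mono false along along-true | mono false against against-false
  ... | inj₂ (_ , e) | inj₁ (_ , e′) = trans (cong₂ _+_ e e′) (length-map swap along)
  ... | inj₂ _ | inj₂ (ne , _) = ⊥-elim (ne refl)
  ... | inj₁ (() , _) | _

  chord∈D : ∀ {d} → d ∈ chords< → d ∈ chords × d ∈ D
  chord∈D d∈ with proj₁ (∈-filter⁻ increasing? {xs = chords} d∈)
  ... | d∈c = d∈c , proj₁ (∈-filter⁻ chord? {xs = D} d∈c)

  #swap : ∀ β ds → All (λ d → colour (swap d) ≡ colour d) ds → # β (map swap ds) ≡ # β ds
  #swap β [] [] = refl
  #swap β (d ∷ ds) (eq ∷ eqs) with colour (swap d) | colour d | eq
  ... | γ | .γ | refl with γ Bool.≟ β
  ...   | yes _ = cong suc (#swap β ds eqs)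
  ...   | no _  = #swap β ds eqs

  #flips : ∀ β ds → #links β (map (λ d → d , swap d) ds) ≡ # β ds
  #flips β [] = refl
  #flips β (d ∷ ds) with colour d Bool.≟ β
  ... | yes _ = cong suc (#flips β ds)
  ... | no _  = #flips β ds

  #D : ∀ β → # β D ≡ n + (# β chords< + # β chords<)
  #D β = trans (↭-length (filter-↭ (is? β) partition)) (trans (#-++ β along _)
    (trans (cong (# β along +_) (#-++ β against _)) (trans (sym (+-assoc (# β along) (# β against) _))
      (cong₂ _+_ (#cycle β) (trans (#-++ β chords< _) (cong (# β chords< +_) (#swap β chords<
        (All.tabulate λ d∈ → let d∈c , d∈D = chord∈D d∈ in sym (colour-~ d∈D (swap∈D d∈D) (flip~ d∈c))))))))))

  monochromatic : All (λ f → All (λ d → colour d ≡ faceColour f) f) faces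
  monochromatic = All.tabulate λ {f} f∈ → go f f∈
    where
    go : ∀ f → f ∈ faces → All (λ d → colour d ≡ faceColour f) f
    go []       f∈ = []
    go (e ∷ ds) f∈ = All.tabulate λ d∈ →
      colour-~ (∈-concat⁺′ d∈ f∈) (∈-concat⁺′ (here refl) f∈) (same-face f∈ d∈ (here refl))

  #links-mono : ∀ β {γ} d ds → All (λ d → colour d ≡ γ) (d ∷ ds) →
                (γ ≡ β × #links β (links (d ∷ ds)) ≡ length ds) ⊎ (γ ≢ β × #links β (links (d ∷ ds)) ≡ 0)
  #links-mono β {γ} d ds all with γ Bool.≟ β
  ... | yes refl = inj₁ (refl , go d ds all)
    where
    go : ∀ d ds → All (λ d → colour d ≡ γ) (d ∷ ds) → #links γ (links (d ∷ ds)) ≡ length ds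
    go d []       _          = refl
    go d (e ∷ ds) (eq ∷ eqs) with colour d Bool.≟ γ
    ... | yes _ = cong suc (go e ds eqs)
    ... | no ne = ⊥-elim (ne eq)
  ... | no γ≢β = inj₂ (γ≢β , go d ds all)
    where
    go : ∀ d ds → All (λ d → colour d ≡ γ) (d ∷ ds) → #links β (links (d ∷ ds)) ≡ 0
    go d []       _          = refl
    go d (e ∷ ds) (eq ∷ eqs) with colour d Bool.≟ β
    ... | yes eq′ = ⊥-elim (γ≢β (trans (sym eq) eq′))
    ... | no _    = go e ds eqs

  #faceLinks : ∀ β fs → All (Closed (Turn (rot G))) fs → All (λ f → All (λ d → colour d ≡ faceColour f) f) fs →
               # β (concat fs) ≡ #links β (concat (map links fs)) + #faces β fs
  #faceLinks β [] [] [] = refl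
  #faceLinks β ((d ∷ ds) ∷ fs) (_ ∷ cs) (m ∷ ms) = trans (#-++ β (d ∷ ds) (concat fs))
    (trans (cong₂ _+_ one (#faceLinks β fs cs ms)) (trans reorder (cong₂ _+_ (sym (#links-++ β (links (d ∷ ds)) _)) parts)))
    where
    here# : ℕ
    here# = length (filter (face? β) [ d ∷ ds ])
    parts : here# + #faces β fs ≡ #faces β ((d ∷ ds) ∷ fs)
    parts = trans (sym (length-++ (filter (face? β) [ d ∷ ds ]))) (cong length (sym (filter-++ (face? β) [ d ∷ ds ] fs)))
    one : # β (d ∷ ds) ≡ #links β (links (d ∷ ds)) + here#
    one with mono β (d ∷ ds) m | #links-mono β d ds m
    ... | inj₁ (eq , e) | inj₁ (_ , e′) = trans e (sym (trans (cong₂ _+_ e′ (cong length (filter-all (face? β) (eq ∷ []))))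
            (+-comm (length ds) 1)))
    ... | inj₂ (ne , e) | inj₂ (_ , e′) = trans e (sym (cong₂ _+_ e′ (cong length (filter-none (face? β) (ne ∷ [])))))
    ... | inj₁ (eq , _) | inj₂ (ne , _) = ⊥-elim (ne eq)
    ... | inj₂ (ne , _) | inj₁ (eq , _) = ⊥-elim (ne eq)
    A B F : ℕ
    A = #links β (links (d ∷ ds))
    B = #links β (concat (map links fs))
    F = #faces β fs
    reorder : (A + here#) + (B + F) ≡ (A + B) + (here# + F)
    reorder = inter A here# B F
      where
      inter : ∀ a h b f → (a + h) + (b + f) ≡ (a + b) + (h + f)
      inter = solve-∀

  -- On each side faces are the vertices and chords the edges of a tree, as in the usual proof of
  -- Grinberg's formula.
  faces-per-class : ∀ β → #faces β faces ≡ suc (# β chords<)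
  faces-per-class β = arith (#links β faceLinks) (# β chords<) (#faces β faces) (# β D)
    (trans (class-size β) (cong suc (trans (#links-++ β faceLinks flips) (cong (#links β faceLinks +_) (#flips β chords<)))))
    (#faceLinks β faces (boundary emb) monochromatic)
    where
    arith : ∀ l r f d → d ≡ suc (l + r) → d ≡ l + f → f ≡ suc r
    arith l r f d eq eq′ = +-cancelˡ-≡ l f (suc r) (trans (sym eq′) (trans eq (sym (+-suc l r))))

  excess : List Dart → ℕ
  excess f = suc (length f) % 3

  total-excess : Bool → List (List Dart) → ℕ
  total-excess β fs = sum (map excess (filter (face? β) fs))

  sizes : ∀ β fs → All (λ f → All (λ d → colour d ≡ faceColour f) f) fs →
          ∃[ k ] # β (concat fs) + #faces β fs ≡ total-excess β fs + k * 3
  sizes β [] [] = 0 , refl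
  sizes β (f ∷ fs) (m ∷ ms) with sizes β fs ms
  ... | k , eq with mono β f m
  ...   | inj₁ (e , e′) = suc (length f) / 3 + k , trans
            (cong₂ _+_ (trans (#-++ β f (concat fs)) (cong (_+ # β (concat fs)) e′)) (cong length fl))
            (trans (r₁ (length f) (# β (concat fs)) (#faces β fs))
            (trans (cong₂ _+_ (m≡m%n+[m/n]*n (suc (length f)) 3) eq)
            (trans (r₂ (excess f) (suc (length f) / 3) (total-excess β fs) k) (cong (λ t → sum (map excess t) + (suc (length f) / 3 + k) * 3) (sym fl)))))
    where
    fl : filter (face? β) (f ∷ fs) ≡ f ∷ filter (face? β) fs
    fl with faceColour f Bool.≟ β
    ... | yes _ = refl
    ... | no ne = ⊥-elim (ne e)
    r₁ : ∀ l a b → (l + a) + suc b ≡ suc l + (a + b)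
    r₁ = solve-∀
    r₂ : ∀ x p t k → (x + p * 3) + (t + k * 3) ≡ (x + t) + (p + k) * 3
    r₂ = solve-∀
  ...   | inj₂ (ne , e′) = k , trans
            (cong₂ _+_ (trans (#-++ β f (concat fs)) (cong (_+ # β (concat fs)) e′)) (cong length fl))
            (trans eq (cong (λ t → sum (map excess t) + k * 3) (sym fl)))
    where
    fl : filter (face? β) (f ∷ fs) ≡ filter (face? β) fs
    fl with faceColour f Bool.≟ β
    ... | yes e = ⊥-elim (ne e)
    ... | no _  = refl

  all-excess : ∀ fs → total-excess true fs + total-excess false fs ≡ sum (map excess fs)
  all-excess [] = refl
  all-excess (f ∷ fs) with faceColour f
  ... | true  = trans (+-assoc (excess f) _ _) (cong (excess f +_) (all-excess fs))
  ... | false = trans (exch (total-excess true fs) (excess f) _) (cong (excess f +_) (all-excess fs))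
    where
    exch : ∀ a b c → a + (b + c) ≡ b + (a + c)
    exch = solve-∀

  -- With r chords on a side, its face lengths sum to `n` + 2r and it has r + 1 faces. Adding 1 to
  -- each length therefore gives `n` + 1 + 3r, whose residue is independent of r.
  residue : ∀ β → suc n % 3 ≡ total-excess β faces % 3
  residue β with sizes β faces monochromatic
  ... | k , eq = trans (sym ([m+kn]%n≡m%n (suc n) (# β chords<) 3))
      (trans (cong (_% 3) (trans (r n (# β chords<)) (trans (sym (cong₂ _+_ (#D β) (faces-per-class β))) eq)))
        ([m+kn]%n≡m%n (total-excess β faces) k 3))
    where
    r : ∀ n q → suc n + q * 3 ≡ (n + (q + q)) + suc q
    r = solve-∀

  -- A total excess of 1 leaves 1 for one side and 0 for the other, whereas by `residue` both are
  -- congruent modulo 3.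
  contradiction : sum (map excess faces) ≡ 1 → ⊥
  contradiction one = go (total-excess true faces) (total-excess false faces)
      (trans (all-excess faces) one) (trans (sym (residue true)) (residue false))
    where
    go : ∀ a b → a + b ≡ 1 → a % 3 ≡ b % 3 → ⊥
    go 0 .1 refl ()
    go 1 0 eq ()
    go 1 (suc b) () _
    go (suc (suc a)) b () _

-- suc (length f) % 3 is length f - 2 modulo 3, the weight of f in Grinberg's formula.
grinberg : ∀ {G faces} → Embedding G faces → sum (map (λ f → suc (length f) % 3) faces) ≡ 1 →
           ¬ Ham (order G) (Edge G) []
grinberg emb one (_ , _ , c) = Grinberg.contradiction _ _ emb c one

open DecMembership _≟_ using (_∈?_)

-- Graphs over Fin n

map-lift : (h : X → Y) {P : Y → Set} → (∀ {y} → P y → ∃[ x ] h x ≡ y) →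
           ∀ {ys} → All P ys → ∃[ xs ] map h xs ≡ ys
map-lift h f []       = [] , refl
map-lift h f (p ∷ ps) with f p | map-lift h f ps
... | x , refl | xs , refl = x ∷ xs , refl

module _ {f : X → X} {h : X → Y} {R : Y → Y → Set} (sim : ∀ {x y} → R (h x) y → h (f x) ≡ y) where

  iterate-suc : ∀ k x → iterate f (suc k) x ≡ iterate f k (f x)
  iterate-suc zero    x = refl
  iterate-suc (suc k) x = cong f (iterate-suc k x)

  along-walk : ∀ {x y zs z} → h x ≡ y → Walk R y zs z → ∀ {w} → w ∈ y ∷ zs →
               ∃[ k ] (k < suc (length zs) × h (iterate f k x) ≡ w)
  along-walk eq w (here refl) = 0 , s≤s z≤n , eq
  along-walk {x} refl (r ∷ w) (there w∈) with along-walk (sim r) w w∈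
  ... | k , k< , e = suc k , s≤s k< , trans (cong h (iterate-suc k x)) e

  -- The bound on k matters for faces: `isFaceRep` inspects only boundedly many iterates, and these
  -- have to reach every dart of the face.
  orbit : ∀ {x ys} → Closed R ys → h x ∈ ys → ∀ {w} → w ∈ ys → ∃[ k ] (k < length ys × h (iterate f k x) ≡ w)
  orbit {ys = y ∷ zs} c (here eq) w∈ = along-walk eq c w∈
  orbit {x} {ys = y ∷ zs} c (there x∈) {w} w∈ with ∈-∃++ x∈
  ... | as , bs , refl with split as c
  ...   | w₁ , w₂ with along-walk refl (w₂ ▷ w₁) (∈-resp-↭ (++-comm (y ∷ as) (h x ∷ bs)) w∈)
  ...     | k , k< , e = k , subst (k <_) (↭-length (++-comm (h x ∷ bs) (y ∷ as))) k< , e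

  orbit-inside : ∀ {x ys} → Closed R ys → h x ∈ ys → ∀ k → h (iterate f k x) ∈ ys
  orbit-inside c x∈ zero = x∈
  orbit-inside {ys = y ∷ zs} c x∈ (suc k) with Walk-next c (orbit-inside c x∈ k)
  ... | e , r , e∈ = subst (_∈ y ∷ zs) (sym (sim r)) (∈-resp-↭ (++-comm zs [ y ]) e∈)

follow : ℕ → List ℕ → ℕ → ℕ
follow x []       v = v
follow x (y ∷ ys) v with v ≟ x
... | yes _ = y
... | no _  = follow y ys v

after : List ℕ → ℕ → ℕ
after []       v = v
after (x ∷ xs) v = follow x (xs ++ [ x ]) v

after-Next : ∀ {xs u w} → Unique xs → Next xs u w → after xs u ≡ w
after-Next {x ∷ xs} uq s = go x xs uq s
  where
  go : ∀ y ys {z u w} → Unique (y ∷ ys) → Succ (y ∷ ys ++ [ z ]) u w → follow y (ys ++ [ z ]) u ≡ w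
  go y [] {u = u} _ now with u ≟ u
  ... | yes _ = refl
  ... | no ne = ⊥-elim (ne refl)
  go y [] _ (later (later ()))
  go y (y′ ∷ ys) {u = u} _ now with u ≟ u
  ... | yes _ = refl
  ... | no ne = ⊥-elim (ne refl)
  go y (y′ ∷ ys) {u = u} (y∉ ∷ uq) (later s) with u ≟ y
  ... | no _     = go y′ ys uq s
  ... | yes refl = ⊥-elim (All.lookup y∉ (snoc-fst (y′ ∷ ys) s) refl)

Next-mem : ∀ {xs} {u w : X} → Next xs u w → w ∈ xs
Next-mem {xs = x ∷ xs} s with ∈-++⁻ (x ∷ xs) (Succ-snd s)
... | inj₁ w∈ = w∈
... | inj₂ (here refl) = here refl

Next-walk : ∀ (x : X) xs → Walk (Next (x ∷ xs)) x xs x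
Next-walk x xs = go x xs (λ s → s)
  where
  go : ∀ y ys {z} → (∀ {u w} → Succ (y ∷ ys ++ [ z ]) u w → Next (x ∷ xs) u w) → Walk (Next (x ∷ xs)) y ys z
  go y []       f = step (f now)
  go y (_ ∷ ys) f = f now ∷ go _ ys (λ s → f (later s))

count-filter : (p : X → Bool) → ∀ xs → count p xs ≡ length (filter (λ x → T? (p x)) xs)
count-filter p [] = refl
count-filter p (x ∷ xs) with p x
... | true  = cong suc (count-filter p xs)
... | false = count-filter p xs

count-↭ : (p : X → Bool) → ∀ {xs ys} → Unique xs → Unique ys → (∀ {x} → T (p x) → x ∈ xs → x ∈ ys) →
          (∀ {x} → T (p x) → x ∈ ys → x ∈ xs) → count p xs ≡ count p ys
count-↭ p {xs} {ys} ux uy f g = trans (count-filter p xs) (trans (↭-length (unique-↭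
    (Unique.filter⁺ p? ux) (Unique.filter⁺ p? uy) (half f) (half g))) (sym (count-filter p ys)))
  where
  p? = λ x → T? (p x)
  half : ∀ {xs ys} → (∀ {x} → T (p x) → x ∈ xs → x ∈ ys) → ∀ {x} → x ∈ filter p? xs → x ∈ filter p? ys
  half {xs} h x∈ with ∈-filter⁻ p? {xs = xs} x∈
  ... | x∈xs , px = ∈-filter⁺ p? (h px x∈xs) px

count-all : (p : X → Bool) → ∀ {xs} → All (λ x → T (p x)) xs → count p xs ≡ length xs
count-all p [] = refl
count-all p {x ∷ xs} (t ∷ ts) with p x
... | true = cong suc (count-all p ts)

count-++ : (p : X → Bool) → ∀ xs ys → count p (xs ++ ys) ≡ count p xs + count p ys
count-++ p []       ys = refl
count-++ p (x ∷ xs) ys with p x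
... | true  = cong suc (count-++ p xs ys)
... | false = count-++ p xs ys

count-concat : (p : X → Bool) → ∀ xss → All (λ xs → count p xs ≡ 1) xss → count p (concat xss) ≡ length xss
count-concat p [] [] = refl
count-concat p (xs ∷ xss) (e ∷ es) = trans (count-++ p xs (concat xss)) (cong₂ _+_ e (count-concat p xss es))

least : (f : X → ℕ) → ∀ x xs → ∃[ m ] (m ∈ x ∷ xs × (∀ {y} → y ∈ x ∷ xs → f m ≤ f y))
least f x [] = x , here refl , λ { (here refl) → ≤-refl }
least f x (y ∷ ys) with least f y ys
... | m , m∈ , m≤ with ≤-total (f x) (f m)
...   | inj₁ x≤ = x , here refl , λ { (here refl) → ≤-refl ; (there z∈) → ≤-trans x≤ (m≤ z∈) }
...   | inj₂ ≤x = m , there m∈ , λ { (here refl) → ≤x ; (there z∈) → m≤ z∈ }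

count-least : (p : X → Bool) (f : X → ℕ) → (∀ {x y} → f x ≡ f y → x ≡ y) → ∀ {xs} → xs ≢ [] → Unique xs →
              (∀ {x} → x ∈ xs → T (p x) → ∀ {y} → y ∈ xs → f x ≤ f y) →
              (∀ {x} → x ∈ xs → (∀ {y} → y ∈ xs → f x ≤ f y) → T (p x)) → count p xs ≡ 1
count-least p f inj {[]} ne _ _ _ = ⊥-elim (ne refl)
count-least p f inj {x ∷ xs} _ uq min⇒ ⇒min with least f x xs
... | m , m∈ , m≤ = trans (count-filter p (x ∷ xs)) (↭-length (unique-↭ {ys = [ m ]} (Unique.filter⁺ p? uq) ([] ∷ [])
      to λ { (here refl) → ∈-filter⁺ p? m∈ (⇒min m∈ m≤) }))
  where
  p? = λ x → T? (p x)
  to : ∀ {y} → y ∈ filter p? (x ∷ xs) → y ∈ [ m ]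
  to y∈ with ∈-filter⁻ p? {xs = x ∷ xs} y∈
  ... | y∈xs , py = here (inj (≤-antisym (min⇒ y∈xs py m∈) (m≤ y∈xs)))

allB⇒ : {p : X → Bool} → ∀ {xs} → T (allB p xs) → ∀ {x} → x ∈ xs → T (p x)
allB⇒ {xs = _ ∷ _} t (here refl) = proj₁ (Equivalence.to T-∧ t)
allB⇒ {xs = _ ∷ _} t (there x∈)  = allB⇒ (proj₂ (Equivalence.to T-∧ t)) x∈

⇒allB : {p : X → Bool} → ∀ {xs} → (∀ {x} → x ∈ xs → T (p x)) → T (allB p xs)
⇒allB {xs = []}    h = tt
⇒allB {xs = _ ∷ _} h = Equivalence.from T-∧ (h (here refl) , ⇒allB (λ x∈ → h (there x∈)))

does⇒ : {A : Set} (a? : Dec A) → T (does a?) → A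
does⇒ (yes a) _ = a

⇒does : {A : Set} (a? : Dec A) → A → T (does a?)
⇒does (yes _) _ = tt
⇒does (no ¬a) a = ¬a a

module Realise (G : Net) where

  N : ℕ
  N = order G

  graph : Graph N
  graph = record
    { adj = λ u v → does (toℕ v ∈? rot G (toℕ u))
    ; sym = λ u v → does-⇔ (mk⇔ (symm G) (symm G)) (toℕ v ∈? rot G (toℕ u)) (toℕ u ∈? rot G (toℕ v))
    ; irrefl = λ u → dec-false (toℕ u ∈? rot G (toℕ u)) (irrefl G)
    }

  adj⇒ : ∀ {u v} → Adj graph u v → Edge G (toℕ u) (toℕ v)
  adj⇒ {u} {v} = does⇒ (toℕ v ∈? rot G (toℕ u))

  ⇒adj : ∀ {u v} → Edge G (toℕ u) (toℕ v) → Adj graph u v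
  ⇒adj {u} {v} = ⇒does (toℕ v ∈? rot G (toℕ u))

  bound₂ : ∀ {u v} → Edge G u v → v < N
  bound₂ e = bound G (symm G e)

  lift< : ∀ {v} → v < N → ∃[ u ] toℕ {N} u ≡ v
  lift< v< = fromℕ< v< , toℕ-fromℕ< v<

  linked : ∀ {u v : Fin N} {zs} → Walk (Edge G) (toℕ u) (map toℕ zs) (toℕ v) → Linked (Adj graph) (u ∷ zs ++ [ v ])
  linked {u} {v} {zs} w = Linked.map ⇒adj (Linked.map⁻ {f = toℕ} (subst (λ t → Linked (Edge G) (toℕ u ∷ t))
    (sym (map-++ toℕ zs [ v ])) (toLinked w)))

  module _ {ds : List ℕ} {P : Fin N → Set} (to : ∀ {w} → toℕ w ∉ ds → P w) (from : ∀ {w} → P w → toℕ w ∉ ds) where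

    toHam : Ham N (Edge G) ds → Σ (Fin N) λ x → Σ (List (Fin N)) λ xs → IsHamCycleOn graph P x xs
    toHam (x , xs , c) with lift< (proj₁ (sound c (here refl))) | map-lift toℕ lift< (All.tabulate (λ v∈ → proj₁ (sound c (there {x = x} v∈))))
    ... | y , refl | ys , refl = y , ys , record
      { atLeast3 = s≤s (subst (2 ≤_) (length-map toℕ ys) (long c))
      ; distinct = Unique.map⁻ (unique c)
      ; edges = linked (closed c)
      ; inside = λ w w∈ → to (proj₂ (sound c (∈-map⁺ toℕ w∈)))
      ; covers = λ w pw → covers w (complete c (toℕ<n w) (from pw))
      }
      where
      covers : ∀ w → toℕ w ∈ map toℕ (y ∷ ys) → w ∈ y ∷ ys
      covers w w∈ with ∈-map⁻ toℕ w∈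
      ... | w′ , w′∈ , eq with toℕ-injective eq
      ...   | refl = w′∈

    fromHam : (Σ (Fin N) λ x → Σ (List (Fin N)) λ xs → IsHamCycleOn graph P x xs) → Ham N (Edge G) ds
    fromHam (x , xs , h) = toℕ x , map toℕ xs , record
      { closed = fromLinked (map toℕ xs) (subst (λ t → Linked (Edge G) (toℕ x ∷ t)) (map-++ toℕ xs [ x ])
          (Linked.map⁺ (Linked.map adj⇒ (IsHamCycleOn.edges h))))
      ; unique = Unique.map⁺ toℕ-injective (IsHamCycleOn.distinct h)
      ; long = subst (2 ≤_) (sym (length-map toℕ xs)) (pred≤ (IsHamCycleOn.atLeast3 h))
      ; sound = λ w∈ → snd (∈-map⁻ toℕ {xs = x ∷ xs} w∈)
      ; complete = cpl
      }
      where
      pred≤ : ∀ {a b} → suc a ≤ suc b → a ≤ b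
      pred≤ (s≤s l) = l
      snd : ∀ {w} → (∃[ v ] (v ∈ x ∷ xs × w ≡ toℕ v)) → w < N × w ∉ ds
      snd (v , v∈ , refl) = toℕ<n v , from (IsHamCycleOn.inside h v v∈)
      cpl : ∀ {w} → w < N → w ∉ ds → w ∈ toℕ x ∷ map toℕ xs
      cpl w< w∉ with lift< w<
      ... | v , refl = ∈-map⁺ toℕ (IsHamCycleOn.covers h v (to w∉))

  hypo : ¬ Ham N (Edge G) [] → (∀ {u v} → Edge G u v → Ham N (Edge G) (u ∷ v ∷ [])) → K2-Hypohamiltonian graph
  hypo nonham k2 =
      (λ u v e → toHam (λ w∉ → (λ { refl → w∉ (here refl) }) , λ { refl → w∉ (there (here refl)) })
        (λ { (w≢u , w≢v) (here eq) → w≢u (toℕ-injective eq) ; (w≢u , w≢v) (there (here eq)) → w≢v (toℕ-injective eq) ; _ (there (there ())) })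
        (k2 (adj⇒ e)))
    , λ h → nonham (fromHam {P = λ _ → ⊤} (λ _ → tt) (λ _ ()) h)

  Reach : ℕ → ℕ → Set
  Reach u v = u ≡ v ⊎ ∃[ zs ] Walk (Edge G) u zs v

  reach-sym : ∀ {u v} → Reach u v → Reach v u
  reach-sym (inj₁ eq) = inj₁ (sym eq)
  reach-sym (inj₂ (zs , w)) = inj₂ (_ , reverseʷ (symm G) w)

  reach-trans : ∀ {u v w} → Reach u v → Reach v w → Reach u w
  reach-trans (inj₁ refl) r = r
  reach-trans (inj₂ p) (inj₁ refl) = inj₂ p
  reach-trans (inj₂ (zs , p)) (inj₂ (ys , q)) = inj₂ (_ , p ▷ q)

  -- The Hamiltonian cycle that avoids `a` connects 0 to all other vertices, and `a` is a neighbour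
  -- of 0.
  connected : ∀ {a} → a ∈ rot G 0 → 0 ∉ [ a ] → Ham N (Edge G) [ a ] → Connected graph
  connected {a} a∈ 0∉ (_ , _ , c) u v = conv (reach-trans (reach-sym (from0 (toℕ<n u))) (from0 (toℕ<n v)))
    where
    from0 : ∀ {w} → w < N → Reach 0 w
    from0 {w} w< with w ≟ a | rotate c (complete c (bound G a∈) 0∉)
    ... | yes refl | _ = inj₂ ([] , step a∈)
    ... | no w≢a | ys , c′ with complete c′ w< (λ { (here eq) → w≢a eq })
    ...   | here eq = inj₁ (sym eq)
    ...   | there w∈ with ∈-∃++ w∈
    ...     | as , bs , refl = inj₂ (as , proj₁ (split as (closed c′)))
    inner< : ∀ {x zs y} → Walk (Edge G) x zs y → All (_< N) zs
    inner< (step _) = []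
    inner< (e ∷ w)  = bound₂ e ∷ inner< w
    conv : Reach (toℕ u) (toℕ v) → u ≡ v ⊎ (∃[ xs ] Linked (Adj graph) (u ∷ xs ++ [ v ]))
    conv (inj₁ eq) = inj₁ (toℕ-injective eq)
    conv (inj₂ (zs , w)) with map-lift toℕ lift< (inner< w)
    ... | ys , refl = inj₂ (ys , linked w)

  ρ : Rotation N
  ρ u v with after (rot G (toℕ u)) (toℕ v) <? N
  ... | yes l = fromℕ< l
  ... | no _  = v

  ρ-Next : ∀ {u v w} → Next (rot G (toℕ u)) (toℕ v) w → toℕ (ρ u v) ≡ w
  ρ-Next {u} {v} s with after (rot G (toℕ u)) (toℕ v) <? N | after-Next (uniq G (toℕ u)) s
  ... | yes l | eq = trans (toℕ-fromℕ< l) eq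
  ... | no ≮  | refl = ⊥-elim (≮ (bound₂ (Next-mem s)))

  rotation : IsRotationSystem graph ρ
  rotation = (λ u v e → let w , s = Succ-unique.Next-snd (adj⇒ e) in
                 ⇒adj (subst (_∈ rot G (toℕ u)) (sym (ρ-Next {u} {v} s)) (Next-mem s)))
           , λ u v w e e′ → let k , _ , eq = reached u v w (adj⇒ e) (adj⇒ e′) in k , toℕ-injective eq
    where
    reached : ∀ u (v w : Fin N) → toℕ v ∈ rot G (toℕ u) → toℕ w ∈ rot G (toℕ u) →
              ∃[ k ] (k < length (rot G (toℕ u)) × toℕ (iterate (ρ u) k v) ≡ toℕ w)
    reached u v w v∈ w∈ = orbit {f = ρ u} {h = toℕ} {R = Next (rot G (toℕ u))} (λ {x} s → ρ-Next {u} {x} s)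
      (cyc (rot G (toℕ u)) v∈) v∈ w∈
      where
      cyc : ∀ xs {y} → y ∈ xs → Closed (Next xs) xs
      cyc (x ∷ xs) _ = Next-walk x xs

  val : Defs.Dart N → Dart
  val (u , v) = toℕ u , toℕ v

  val-inj : ∀ {d e} → val d ≡ val e → d ≡ e
  val-inj eq = cong₂ _,_ (toℕ-injective (cong proj₁ eq)) (toℕ-injective (cong proj₂ eq))

  face-sim : ∀ {d e} → Turn (rot G) (val d) e → val (faceStep ρ d) ≡ e
  face-sim {u , v} (turn s) = cong (toℕ v ,_) (ρ-Next {v} {u} s)

  key≡ : ∀ (d : Defs.Dart N) → key d ≡ toℕ (combine (proj₁ d) (proj₂ d))
  key≡ (u , v) = sym (trans (toℕ-combine u v) (cong (_+ toℕ v) (*-comm N (toℕ u))))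

  key-inj : ∀ {d e : Defs.Dart N} → key d ≡ key e → d ≡ e
  key-inj {u , v} {u′ , v′} eq with combine-injective u v u′ v′ (toℕ-injective (trans (sym (key≡ (u , v))) (trans eq (key≡ (u′ , v′)))))
  ... | refl , refl = refl

  key< : ∀ (d : Defs.Dart N) → key d < N * N
  key< d = subst (_< N * N) (sym (key≡ d)) (toℕ<n (combine (proj₁ d) (proj₂ d)))

  -- The keys are distinct numbers below `N * N`. This is what makes the range of iterates in
  -- `isFaceRep` long enough for a whole face.
  short : ∀ {ds : List (Defs.Dart N)} → Unique ds → length ds ≤ N * N
  short {ds} u = subst₂ _≤_ (length-map key ds) (length-upTo (N * N))
    (length-⊆ _≟_ (Unique.map⁺ key-inj u) (λ k∈ → lt (∈-map⁻ key k∈)))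
    where
    lt : ∀ {k} → (∃[ d ] (d ∈ ds × k ≡ key d)) → k ∈ upTo (N * N)
    lt (d , _ , refl) = ∈-upTo⁺ (key< d)

  allDarts≡ : Defs.allDarts N ≡ cartesianProduct (allFin N) (allFin N)
  allDarts≡ = go (allFin N)
    where
    go : ∀ us → concatMap (λ u → map (λ v → (u , v)) (allFin N)) us ≡ cartesianProduct us (allFin N)
    go []       = refl
    go (u ∷ us) = cong (map (u ,_) (allFin N) ++_) (go us)

  unique-allDarts : Unique (Defs.allDarts N)
  unique-allDarts = subst Unique (sym allDarts≡) (Unique.cartesianProduct⁺ (Unique.allFin⁺ N) (Unique.allFin⁺ N))

  ∈allDarts : ∀ (d : Defs.Dart N) → d ∈ Defs.allDarts N
  ∈allDarts (u , v) = subst ((u , v) ∈_) (sym allDarts≡) (∈-cartesianProduct⁺ (∈-allFin u) (∈-allFin v))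

  module _ {faces : List (List Dart)} (emb : Embedding G faces) where

    dart-lift : ∀ {d} → d ∈ concat faces → ∃[ e ] val e ≡ d
    dart-lift {u , v} d∈ = (fromℕ< (bound G e) , fromℕ< (bound₂ e)) , cong₂ _,_ (toℕ-fromℕ< _) (toℕ-fromℕ< _)
      where e = dart⇒edge emb d∈

    faces-lift : ∃[ fs ] map (map val) fs ≡ faces
    faces-lift = map-lift (map val) {P = λ f → All (λ d → d ∈ concat faces) f} (map-lift val dart-lift)
      (All.tabulate λ f∈ → All.tabulate λ d∈ → ∈-concat⁺′ d∈ f∈)

    fs : List (List (Defs.Dart N))
    fs = proj₁ faces-lift

    fs-val : map val (concat fs) ≡ concat faces
    fs-val = trans (sym (concat-map {f = val} fs)) (cong concat (proj₂ faces-lift))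

    unique-fs : Unique (concat fs)
    unique-fs = Unique.map⁻ {f = val} (subst Unique (sym fs-val) (distinct emb))

    dart∈ : ∀ {d} → T (isDart graph d) → d ∈ concat fs
    dart∈ {u , v} t with ∈-map⁻ val (subst ((toℕ u , toℕ v) ∈_) (sym fs-val) (edge⇒dart emb (adj⇒ t)))
    ... | e , e∈ , eq with val-inj {u , v} {e} eq
    ...   | refl = e∈

    ∈dart : ∀ {d} → d ∈ concat fs → T (isDart graph d)
    ∈dart {u , v} d∈ = ⇒adj (dart⇒edge emb (subst ((toℕ u , toℕ v) ∈_) fs-val (∈-map⁺ val d∈)))

    count-darts : numDarts graph ≡ length (concat faces)
    count-darts = trans (count-↭ (isDart graph) unique-allDarts unique-fs (λ t _ → dart∈ t) (λ _ _ → ∈allDarts _))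
      (trans (count-all (isDart graph) (All.tabulate ∈dart)) (trans (sym (length-map val (concat fs))) (cong length fs-val)))

    rep : Defs.Dart N → Bool
    rep = isFaceRep graph ρ

    -- The face is an orbit of `faceStep` and `key` is injective, so precisely its dart of least key
    -- passes the test.
    one-rep : ∀ {f} → f ∈ fs → count rep f ≡ 1
    one-rep {f} f∈ = count-least rep key key-inj ne uf min⇒ ⇒min
      where
      clo : Closed (Turn (rot G)) (map val f)
      clo = All.lookup (boundary emb) (subst (map val f ∈_) (proj₂ faces-lift) (∈-map⁺ (map val) f∈))
      ne : f ≢ []
      ne refl = clo
      uf : Unique f
      uf = in-concat fs unique-fs f∈
        where
        in-concat : ∀ {f : List (Defs.Dart N)} fs → Unique (concat fs) → f ∈ fs → Unique f
        in-concat (g ∷ gs) u (here refl) = unique-prefix g u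
        in-concat (g ∷ gs) u (there f∈)  = in-concat gs (unique-suffix g u) f∈
      min⇒ : ∀ {d} → d ∈ f → T (rep d) → ∀ {e} → e ∈ f → key d ≤ key e
      min⇒ {d} d∈ t {e} e∈ with orbit {f = faceStep ρ} {h = val} {R = Turn (rot G)} face-sim clo (∈-map⁺ val d∈) (∈-map⁺ val e∈)
      ... | k , k< , eq with val-inj {iterate (faceStep ρ) k d} {e} eq
      ...   | refl = ≤ᵇ⇒≤ _ _ (allB⇒ {xs = upTo (N * N)} (proj₂ (Equivalence.to T-∧ t))
                (∈-upTo⁺ (<-≤-trans k< (≤-trans (≤-reflexive (length-map val f)) (short uf)))))
      ⇒min : ∀ {d} → d ∈ f → (∀ {e} → e ∈ f → key d ≤ key e) → T (rep d)
      ⇒min {d} d∈ h = Equivalence.from T-∧ (∈dart (∈-concat⁺′ d∈ f∈) , ⇒allB {xs = upTo (N * N)} λ {k} _ → ≤⇒≤ᵇ (h (orb k)))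
        where
        orb : ∀ k → iterate (faceStep ρ) k d ∈ f
        orb k with ∈-map⁻ val (orbit-inside {f = faceStep ρ} {h = val} {R = Turn (rot G)} face-sim clo (∈-map⁺ val d∈) k)
        ... | e , e∈ , eq with val-inj {iterate (faceStep ρ) k d} {e} eq
        ...   | eq′ = subst (_∈ f) (sym eq′) e∈

    count-faces : numFaces graph ρ ≡ length faces
    count-faces = trans (count-↭ rep unique-allDarts unique-fs (λ t _ → dart∈ (proj₁ (Equivalence.to T-∧ t))) (λ _ _ → ∈allDarts _))
      (trans (count-concat rep fs (All.tabulate one-rep))
        (trans (sym (length-map (map val) fs)) (cong length (proj₂ faces-lift))))

    planar : Planar graph
    planar = ρ , rotation , trans (cong (λ t → 2 * N + 2 * t) count-faces) (trans (euler emb) (cong (4 +_) (sym count-darts)))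

open UniqueDec _≟_ using (unique?)

-- Verification of explicit graphs

walk? : {X : Set} {R : X → X → Set} → (∀ u v → Dec (R u v)) → ∀ x zs y → Dec (Walk R x zs y)
walk? r? x []       y = map′ step (λ { (step r) → r }) (r? x y)
walk? r? x (z ∷ zs) y = map′ (λ { (r , w) → r ∷ w }) (λ { (r ∷ w) → r , w }) (r? x z ×-dec walk? r? z zs y)

closed? : {X : Set} {R : X → X → Set} → (∀ u v → Dec (R u v)) → ∀ xs → Dec (Closed R xs)
closed? r? []       = no λ ()
closed? r? (x ∷ xs) = walk? r? x xs x

-- Boolean tests that evaluate faster than the corresponding decision procedures.
module Fast {X : Set} (_==_ : X → X → Bool) (==⇒≡ : ∀ {x y} → T (x == y) → x ≡ y) (==-refl : ∀ x → T (x == x)) where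

  elem : X → List X → Bool
  elem x []       = false
  elem x (y ∷ ys) with x == y
  ... | true  = true
  ... | false = elem x ys

  elem⇒∈ : ∀ {x} ys → T (elem x ys) → x ∈ ys
  elem⇒∈ {x} (y ∷ ys) h with x == y in eq
  ... | true  = here (==⇒≡ (subst T (sym eq) tt))
  ... | false = there (elem⇒∈ ys h)

  ∈⇒elem : ∀ {x ys} → x ∈ ys → T (elem x ys)
  ∈⇒elem {x} {y ∷ ys} x∈ with x == y in eq
  ... | true = tt
  ∈⇒elem {x} {.x ∷ ys} (here refl) | false = ⊥-elim (subst T eq (==-refl x))
  ∈⇒elem {x} {y ∷ ys} (there x∈)   | false = ∈⇒elem x∈

  nodup : List X → Bool
  nodup []       = true
  nodup (x ∷ xs) = not (elem x xs) ∧ nodup xs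

  notelem⇒∉ : ∀ {x xs} → T (not (elem x xs)) → x ∉ xs
  notelem⇒∉ {x} {xs} h x∈ with elem x xs | ∈⇒elem x∈
  ... | true | _ = h

  nodup⇒unique : ∀ xs → T (nodup xs) → Unique xs
  nodup⇒unique []       _ = []
  nodup⇒unique (x ∷ xs) h with Equivalence.to T-∧ h
  ... | p , q = All.tabulate (λ { y∈ refl → notelem⇒∉ {x} {xs} p y∈ }) ∷ nodup⇒unique xs q

≡ᵇ-refl : ∀ x → T (x ≡ᵇ x)
≡ᵇ-refl x = ≡⇒≡ᵇ x x refl

module Nats = Fast _≡ᵇ_ (≡ᵇ⇒≡ _ _) ≡ᵇ-refl

sameDart : Dart → Dart → Bool
sameDart (u , v) (u′ , v′) = (u ≡ᵇ u′) ∧ (v ≡ᵇ v′)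

sameDart⇒≡ : ∀ {d e} → T (sameDart d e) → d ≡ e
sameDart⇒≡ {u , v} {u′ , v′} h with Equivalence.to (T-∧ {u ≡ᵇ u′}) h
... | p , q = cong₂ _,_ (≡ᵇ⇒≡ u u′ p) (≡ᵇ⇒≡ v v′ q)

sameDart-refl : ∀ d → T (sameDart d d)
sameDart-refl (u , v) = Equivalence.from T-∧ (≡⇒≡ᵇ u u refl , ≡⇒≡ᵇ v v refl)

module DartLists = Fast sameDart sameDart⇒≡ sameDart-refl

look : {X : Set} → X → List X → ℕ → X
look d []       _       = d
look d (x ∷ xs) zero    = x
look d (x ∷ xs) (suc i) = look d xs i

ham-swap : ∀ {n E u v} → Ham n E (u ∷ v ∷ []) → Ham n E (v ∷ u ∷ [])
ham-swap (x , xs , c) = x , xs , record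
  { closed = closed c ; unique = unique c ; long = long c
  ; sound = λ w∈ → proj₁ (sound c w∈) , λ { (here eq) → proj₂ (sound c w∈) (there (here eq))
                                          ; (there (here eq)) → proj₂ (sound c w∈) (here eq) }
  ; complete = λ w< w∉ → complete c w< λ { (here eq) → w∉ (there (here eq)) ; (there (here eq)) → w∉ (here eq) } }

pick : {X : Set} → X → X → X → Fin 3 → X
pick x y z 0F = x
pick x y z 1F = y
pick x y z 2F = z

-- The base 100 digits of a number below its leading 1.
unpack : ℕ → List ℕ
unpack = go 9 []
  where
  go : ℕ → List ℕ → ℕ → List ℕ
  go zero    xs c = xs
  go (suc k) xs c with c ≤ᵇ 1
  ... | true  = xs
  ... | false = go k (c % 100 ∷ xs) (c / 100)

-- A plane graph on 0, …, n - 1 given by its packed rotations, with the layout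
-- of a Link.  The rotations come in rows of ten to speed up their evaluation.
module Layout (n : ℕ) (rows : List (List ℕ)) where

  r : ℕ → List ℕ
  r u with u <ᵇ n
  ... | true  = unpack (look 1 (look [] rows (u / 10)) (u % 10))
  ... | false = []

  r-bound : ∀ {u v} → v ∈ r u → u < n
  r-bound {u} v∈ with u <ᵇ n in eq
  ... | true = <ᵇ⇒< u n (subst T (sym eq) tt)

  Simple : Set
  Simple = All (λ u → Unique (r u) × All (λ v → u ∈ r v × u ≢ v) (r u)) (upTo n)

  simple? : Dec Simple
  simple? = All.all? (λ u → unique? (r u) ×-dec All.all? (λ v → (u ∈? r v) ×-dec ¬? (u ≟ v)) (r u)) (upTo n)

  t b : Fin 3 → ℕ
  t = terminal
  b 0F = look 0 (r 1) 0
  b 1F = look 0 (r 1) 1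
  b 2F = look 0 (r 1) 2

  Apexes : Set
  Apexes = (r 0 ≡ t 0F ∷ t 1F ∷ t 2F ∷ []) × (r 1 ≡ b 0F ∷ b 1F ∷ b 2F ∷ [])
         × (∀ i → r (t i) ≡ 0 ∷ drop 1 (r (t i))) × (∀ i → r (b i) ≡ 1 ∷ drop 1 (r (b i)))
         × (∀ i → 5 ≤ b i) × (∀ i j → t j ∉ r (t i))

  apexes? : Dec Apexes
  apexes? = (r 0 ≟ˡ _) ×-dec ((r 1 ≟ˡ _)
      ×-dec (Fin.all? (λ i → r (t i) ≟ˡ _) ×-dec (Fin.all? (λ i → r (b i) ≟ˡ _)
      ×-dec (Fin.all? (λ i → 5 ≤? b i) ×-dec Fin.all? λ i → Fin.all? λ j → ¬? (t j ∈? r (t i))))))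
    where _≟ˡ_ = List.≡-dec _≟_

  nextDart : Dart → Dart
  nextDart (u , v) = v , after (r v) u

  -- The traced lists are only candidates, so running out of fuel does no harm to soundness:
  -- `planeOn?` checks afterwards that each face closes up and that all darts occur once.
  trace : ℕ → Dart → Dart → List Dart
  trace zero    d e = []
  trace (suc k) d e with sameDart d e
  ... | true  = []
  ... | false = d ∷ trace k (nextDart d) e

  arcAt : ℕ → (Fin 3 → ℕ) → Fin 3 → List Dart
  arcAt x nb i = trace n (nextDart (x , nb (succ i))) (nb i , x)

  darts : List Dart
  darts = concatMap (λ u → map (u ,_) (r u)) (upTo n)

  collect : List Dart → List Dart → List (List Dart)
  collect seen [] = []
  collect seen (d ∷ ds) with DartLists.elem d seen
  ... | true  = collect seen ds
  ... | false = next (d ∷ trace n (nextDart d) d)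
    where
    next : List Dart → List (List Dart)
    next f = f ∷ collect (f ++ seen) ds

  -- A form of `Turn` that is decided by evaluation, the existential position in the rotation being
  -- replaced by the function `after`.
  Turn′ : Dart → Dart → Set
  Turn′ (u , v) (v′ , w) = v ≡ v′ × u ∈ r v × after (r v) u ≡ w

  turn? : ∀ d e → Dec (Turn′ d e)
  turn? (u , v) (v′ , w) = (v ≟ v′) ×-dec ((u ∈? r v) ×-dec (after (r v) u ≟ w))

  off? : ∀ x d → Dec (Off x d)
  off? x (u , v) = ¬? (u ≟ x) ×-dec ¬? (v ≟ x)

  record Arcs : Set where
    constructor arcs
    field x₀ x₁ x₂ y₀ y₁ y₂ : List Dart
          others : List (List Dart)

    arc₀ arc₁ : Fin 3 → List Dart
    arc₀ = pick x₀ x₁ x₂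
    arc₁ = pick y₀ y₁ y₂

    faces : List (List Dart)
    faces = apexFaces 0 t arc₀ ++ (apexFaces 1 b arc₁ ++ others)

  open Arcs

  arcData : Arcs
  arcData = complete-with (arcAt 0 t 0F) (arcAt 0 t 1F) (arcAt 0 t 2F) (arcAt 1 b 0F) (arcAt 1 b 1F) (arcAt 1 b 2F)
    where
    complete-with : (x₀ x₁ x₂ y₀ y₁ y₂ : List Dart) → Arcs
    complete-with x₀ x₁ x₂ y₀ y₁ y₂ = arcs x₀ x₁ x₂ y₀ y₁ y₂ (collect
      (concat (apexFaces 0 t (pick x₀ x₁ x₂) ++ apexFaces 1 b (pick y₀ y₁ y₂))) darts)

  covering : List Dart → Bool
  covering ds = DartLists.nodup ds ∧ allB (λ d → DartLists.elem d ds) darts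

  PlaneOn : Arcs → Set
  PlaneOn p = All (Closed Turn′) (faces p) × T (covering (concat (faces p))) × All (λ d → proj₂ d ∈ r (proj₁ d)) (concat (faces p))
        × 2 * n + 2 * length (faces p) ≡ 4 + length (concat (faces p))
        × All (Off 0) (concat (triple (arc₀ p)) ++ concat (apexFaces 1 b (arc₁ p) ++ others p))
        × All (Off 1) (concat (triple (arc₀ p)) ++ (concat (triple (arc₁ p)) ++ concat (others p)))
        × sum (map (λ f → suc (length f) % 3) (faces p)) ≡ 1

  planeOn? : ∀ p → Dec (PlaneOn p)
  planeOn? p = All.all? (closed? turn?) (faces p) ×-dec (T? (covering (concat (faces p)))
    ×-dec (All.all? (λ d → proj₂ d ∈? r (proj₁ d)) _ ×-dec ((_ ≟ _) ×-dec (All.all? (off? 0) _ ×-dec (All.all? (off? 1) _ ×-dec (_ ≟ _))))))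

  Plane : Set
  Plane = PlaneOn arcData

  plane? : Dec Plane
  plane? = planeOn? arcData

  -- A cycle is coded by its successive choices among the neighbours other
  -- than the predecessor, as digits in the mixed radix "degree - 1".
  choose : ℕ → List ℕ → ℕ → ℕ
  choose p []       i = 0
  choose p (w ∷ ws) i with w ≡ᵇ p | i
  ... | true  | i     = choose p ws i
  ... | false | zero  = w
  ... | false | suc i = choose p ws i

  walkCode : ℕ → ℕ → ℕ → ℕ → List ℕ
  walkCode zero    p v c = []
  walkCode (suc k) p v c = v ∷ from (r v)
    where
    from : List ℕ → List ℕ
    from ws = walkCode k v (choose p ws (c % suc (length ws ∸ 2))) (c / suc (length ws ∸ 2))

  -- The walk starts with 0 as its own predecessor, which excludes none of the three neighbours of
  -- 0, while the radix there is 2. So only 2 and 3 can come first, and every cycle through 0 uses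
  -- one of them in one of its directions.
  cyc : List ℕ → ℕ → List ℕ
  cyc ds c = drop 1 (walkCode (n ∸ length ds) 0 0 c)

  joined : ℕ → List ℕ → ℕ → Bool
  joined x []       y = Nats.elem y (r x)
  joined x (z ∷ zs) y = Nats.elem z (r x) ∧ joined z zs y

  joined⇒walk : ∀ x zs y → T (joined x zs y) → Walk (λ u v → v ∈ r u) x zs y
  joined⇒walk x []       y h = step (Nats.elem⇒∈ (r x) h)
  joined⇒walk x (z ∷ zs) y h with Equivalence.to T-∧ h
  ... | p , q = Nats.elem⇒∈ (r x) p ∷ joined⇒walk z zs y q

  tour : List ℕ → List ℕ → Bool
  tour ds xs = joined 0 xs 0 ∧ (Nats.nodup ((0 ∷ xs) ++ ds) ∧ ((2 ≤ᵇ length xs)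
    ∧ (allB (_<ᵇ n) ((0 ∷ xs) ++ ds) ∧ (n ≡ᵇ length ((0 ∷ xs) ++ ds)))))

  Codes : List ℕ → ℕ → Set
  Codes ds c = T (tour ds (cyc ds c))

  codes? : ∀ ds c → Dec (Codes ds c)
  codes? ds c = T? (tour ds (cyc ds c))

  codes⇒ham : ∀ {ds c} → Codes ds c → Ham n (λ u v → v ∈ r u) ds
  codes⇒ham {ds} {c} h with cyc ds c
  ... | xs with Equivalence.to (T-∧ {joined 0 xs 0}) h
  ... | w , h₁ with Equivalence.to (T-∧ {Nats.nodup ((0 ∷ xs) ++ ds)}) h₁
  ... | u , h₂ with Equivalence.to (T-∧ {2 ≤ᵇ length xs}) h₂
  ... | l , h₃ with Equivalence.to (T-∧ {allB (_<ᵇ n) ((0 ∷ xs) ++ ds)}) h₃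
  ... | s , e = 0 , xs , record
    { closed = joined⇒walk 0 xs 0 w ; unique = unique-prefix (0 ∷ xs) uniq′ ; long = ≤ᵇ⇒≤ 2 (length xs) l
    ; sound = λ v∈ → below (∈-++⁺ˡ v∈) , λ v∈ds → apart uniq′ v∈ v∈ds
    ; complete = cpl }
    where
    uniq′ : Unique ((0 ∷ xs) ++ ds)
    uniq′ = Nats.nodup⇒unique ((0 ∷ xs) ++ ds) u
    below : ∀ {v} → v ∈ (0 ∷ xs) ++ ds → v < n
    below {v} v∈ = <ᵇ⇒< v n (allB⇒ {xs = (0 ∷ xs) ++ ds} s v∈)
    apart : ∀ {ys zs : List ℕ} → Unique (ys ++ zs) → ∀ {v} → v ∈ ys → v ∉ zs
    apart {_ ∷ ys} (x∉ ∷ _) (here refl) v∈ = All.lookup x∉ (∈-++⁺ʳ ys v∈) refl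
    apart {_ ∷ ys} (_ ∷ uq) (there v∈′) v∈ = apart uq v∈′ v∈
    -- All n vertices occur, for otherwise there would be n + 1 of them.
    cpl : ∀ {v} → v < n → v ∉ ds → v ∈ 0 ∷ xs
    cpl {v} v< v∉ds with v ∈? 0 ∷ xs
    ... | yes v∈ = v∈
    ... | no v∉ = ⊥-elim (1+n≰n (subst₂ _≤_ (cong suc (sym (≡ᵇ⇒≡ n _ e))) (List.length-upTo n)
        (length-⊆ _≟_ (All.tabulate fresh ∷ uniq′) λ { (here refl) → ∈-upTo⁺ v< ; (there z∈) → ∈-upTo⁺ (below z∈) })))
      where
      fresh : ∀ {z} → z ∈ (0 ∷ xs) ++ ds → v ≢ z
      fresh z∈ refl = Sum.[ v∉ , v∉ds ]′ (∈-++⁻ (0 ∷ xs) z∈)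

  Coded : List (List ℕ) → List ℕ → Set
  Coded = Pointwise Codes

  coded? : ∀ dss cs → Dec (Coded dss cs)
  coded? = Pointwise.decidable codes?

  coded⇒ham : ∀ {dss cs} → Coded dss cs → ∀ {ds} → ds ∈ dss → Ham n (λ u v → v ∈ r u) ds
  coded⇒ham (c ∷ _)  (here refl) = codes⇒ham c
  coded⇒ham (_ ∷ cs) (there ds∈) = coded⇒ham cs ds∈

  nbSets : List (List ℕ)
  nbSets = map [_] (triple t ++ triple b)

  increasing : List Dart
  increasing = filter (λ d → proj₁ d <? proj₂ d) (filter (off? 1) (filter (off? 0) darts))

  edgeSets : List (List ℕ)
  edgeSets = map (λ d → proj₁ d ∷ proj₂ d ∷ []) increasing

  nextSets : List (List ℕ)
  nextSets = map (λ v → 1 ∷ v ∷ []) (triple b)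

  darts∋ : ∀ {u v} → v ∈ r u → (u , v) ∈ darts
  darts∋ {u} v∈ = ∈-concat⁺′ (∈-map⁺ (u ,_) v∈) (∈-map⁺ (λ u → map (u ,_) (r u)) (∈-upTo⁺ (r-bound v∈)))

  module _ (s : Simple) where

    net : Net
    net = record
      { order = n ; rot = r ; bound = r-bound
      ; symm = λ v∈ → proj₁ (at v∈)
      ; irrefl = λ u∈ → proj₂ (at u∈) refl
      ; uniq = λ u → uniq′ u (u <? n)
      }
      where
      at : ∀ {u v} → v ∈ r u → u ∈ r v × u ≢ v
      at v∈ = All.lookup (proj₂ (All.lookup s (∈-upTo⁺ (r-bound v∈)))) v∈
      uniq′ : ∀ u → Dec (u < n) → Unique (r u)
      uniq′ u (yes u<) = proj₁ (All.lookup s (∈-upTo⁺ u<))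
      uniq′ u (no u≮) = none (r u) (λ v∈ → u≮ (r-bound v∈))
        where
        none : ∀ xs → (∀ {v} → v ∈ xs → ⊥) → Unique xs
        none []      _ = []
        none (_ ∷ _) h = ⊥-elim (h (here refl))

    module _ (ap : Apexes) where

      link : ∀ {k} → n ≡ 5 + k → Link k
      link eq = record
        { net = net ; size = eq
        ; base = record { nb = t ; nb-inj = λ {i} {j} → t-inj i j ; rot-x = proj₁ ap
                        ; tl = λ i → drop 1 (r (t i)) ; rot-nb = proj₁ (proj₂ (proj₂ ap)) }
        ; std = λ _ → refl
        ; next = record { nb = b ; nb-inj = λ {i} {j} → b-inj i j ; rot-x = proj₁ (proj₂ ap)
                        ; tl = λ i → drop 1 (r (b i)) ; rot-nb = proj₁ (proj₂ (proj₂ (proj₂ ap))) }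
        ; far = proj₁ (proj₂ (proj₂ (proj₂ (proj₂ ap))))
        ; indep = proj₂ (proj₂ (proj₂ (proj₂ (proj₂ ap))))
        }
        where
        t-inj : ∀ i j → t i ≡ t j → i ≡ j
        t-inj 0F 0F _ = refl
        t-inj 1F 1F _ = refl
        t-inj 2F 2F _ = refl
        t-inj 0F 1F ()
        t-inj 0F 2F ()
        t-inj 1F 0F ()
        t-inj 1F 2F ()
        t-inj 2F 0F ()
        t-inj 2F 1F ()
        b-uniq : Unique (b 0F ∷ b 1F ∷ b 2F ∷ [])
        b-uniq = subst Unique (proj₁ (proj₂ ap)) (uniq net 1)
        b-inj : ∀ i j → b i ≡ b j → i ≡ j
        b-inj i j with b-uniq
        ... | (b₀₁ ∷ b₀₂ ∷ []) ∷ (b₁₂ ∷ []) ∷ _ = go i j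
          where
          go : ∀ i j → b i ≡ b j → i ≡ j
          go 0F 0F _  = refl
          go 1F 1F _  = refl
          go 2F 2F _  = refl
          go 0F 1F eq = ⊥-elim (b₀₁ eq)
          go 1F 0F eq = ⊥-elim (b₀₁ (sym eq))
          go 0F 2F eq = ⊥-elim (b₀₂ eq)
          go 2F 0F eq = ⊥-elim (b₀₂ (sym eq))
          go 1F 2F eq = ⊥-elim (b₁₂ eq)
          go 2F 1F eq = ⊥-elim (b₁₂ (sym eq))

      module _ (pl : Plane) where

        turn⇒ : ∀ {d e} → Turn′ d e → Turn r d e
        turn⇒ {u , v} (refl , u∈ , refl) with Succ-unique.Next-snd u∈
        ... | w , nx = turn (subst (Next (r v) u) (sym (after-Next (uniq net v) nx)) nx)

        closed⇒ : ∀ {f} → Closed Turn′ f → Closed (Turn r) f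
        closed⇒ {_ ∷ xs} w = weakenʷ {P = λ _ → ⊤} (λ _ _ → turn⇒) tt (All.tabulate λ _ → tt) tt w

        embedding : Embedding net (faces arcData)
        embedding = record
          { boundary = All.map (λ {f} → closed⇒ {f}) (proj₁ pl)
          ; distinct = DartLists.nodup⇒unique _ (proj₁ cov)
          ; dart⇒edge = All.lookup (proj₁ (proj₂ (proj₂ pl)))
          ; edge⇒dart = λ v∈ → DartLists.elem⇒∈ _ (allB⇒ {xs = darts} (proj₂ cov) (darts∋ v∈))
          ; euler = proj₁ (proj₂ (proj₂ (proj₂ pl)))
          }
          where cov = Equivalence.to (T-∧ {DartLists.nodup (concat (faces arcData))}) (proj₁ (proj₂ pl))

        planeLink : ∀ {k} (eq : n ≡ 5 + k) → PlaneLink (link eq)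
        planeLink eq = record
          { arc₀ = arc₀ arcData ; arc₁ = arc₁ arcData ; rest = others arcData ; embedding = embedding
          ; off-base = proj₁ (proj₂ (proj₂ (proj₂ (proj₂ pl))))
          ; off-next = proj₁ (proj₂ (proj₂ (proj₂ (proj₂ (proj₂ pl)))))
          }

        non-ham : ¬ Ham n (Edge net) []
        non-ham = grinberg embedding (proj₂ (proj₂ (proj₂ (proj₂ (proj₂ (proj₂ pl))))))

  ham-edge : ∀ {cs} → Simple → Coded edgeSets cs → ∀ {u v} → u ≢ 0 → v ≢ 0 → u ≢ 1 → v ≢ 1 → v ∈ r u →
             Ham n (λ u v → v ∈ r u) (u ∷ v ∷ [])
  ham-edge {cs} s co {u} {v} u≢0 v≢0 u≢1 v≢1 v∈ with <-cmp u v
  ... | tri< u<v _ _ = up u≢0 v≢0 u≢1 v≢1 u<v v∈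
    where
    up : ∀ {u v} → u ≢ 0 → v ≢ 0 → u ≢ 1 → v ≢ 1 → u < v → v ∈ r u → Ham n (λ u v → v ∈ r u) (u ∷ v ∷ [])
    up u≢0 v≢0 u≢1 v≢1 u<v v∈ = coded⇒ham co (∈-map⁺ _ (∈-filter⁺ (λ d → proj₁ d <? proj₂ d)
      (∈-filter⁺ (off? 1) (∈-filter⁺ (off? 0) (darts∋ v∈) (u≢0 , v≢0)) (u≢1 , v≢1)) u<v))
  ... | tri≈ _ refl _ = ⊥-elim (irrefl (net s) v∈)
  ... | tri> _ _ v<u = ham-swap (coded⇒ham co (∈-map⁺ _ (∈-filter⁺ (λ d → proj₁ d <? proj₂ d)
      (∈-filter⁺ (off? 1) (∈-filter⁺ (off? 0) (darts∋ (symm (net s) v∈)) (v≢0 , u≢0)) (v≢1 , u≢1)) v<u)))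

-- A factor that may violate K₂-hamiltonicity at the apexes 0 and 1; a Cap may do
-- so only at 0 and can end a chain of products.
record Piece (k : ℕ) : Set where
  field
    link     : Link k
    plane    : PlaneLink link
  open Link link public
  field
    non-ham  : NonHam net base
    ham-base : HamNbs net base base
    ham-next : HamNbs net base next
    ham-edge : ∀ {u v} → u ≢ 0 → v ≢ 0 → u ≢ 1 → v ≢ 1 → v ∈ rot net u → Ham (order net) (Edge net) (u ∷ v ∷ [])

record Cap (k : ℕ) : Set where
  field
    piece    : Piece k
  open Piece piece public using (net; base; next)
  field
    ham-at-next : ∀ i → Ham (order net) (Edge net) (1 ∷ nb next i ∷ [])

record Certificate (k : ℕ) : Set where
  field
    rotations : List (List ℕ)
    -- Hamiltonian cycles avoiding a neighbour of an apex, and avoiding an edge.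
    nb-codes edge-codes : List ℕ

  open Layout (5 + k) rotations public

  Valid : Set
  Valid = Simple × Apexes × Plane × Coded nbSets nb-codes × Coded edgeSets edge-codes

  valid? : Dec Valid
  valid? = simple? ×-dec (apexes? ×-dec (plane? ×-dec (coded? nbSets nb-codes ×-dec coded? edgeSets edge-codes)))

  mkPiece : Valid → Piece k
  mkPiece (s , ap , pl , c , e) = record
    { link = link s ap refl ; plane = planeLink s ap pl refl ; non-ham = non-ham s ap pl
    ; ham-base = λ { 0F → coded⇒ham c (here refl)
                   ; 1F → coded⇒ham c (there (here refl))
                   ; 2F → coded⇒ham c (there (there (here refl))) }
    ; ham-next = λ { 0F → coded⇒ham c (there (there (there (here refl))))
                   ; 1F → coded⇒ham c (there (there (there (there (here refl)))))
                   ; 2F → coded⇒ham c (there (there (there (there (there (here refl)))))) }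
    ; ham-edge = ham-edge s e
    }

  mkCap : Valid → ∀ {cs} → Coded nextSets cs → Cap k
  mkCap v c = record
    { piece = mkPiece v
    ; ham-at-next = λ { 0F → coded⇒ham c (here refl)
                      ; 1F → coded⇒ham c (there (here refl))
                      ; 2F → coded⇒ham c (there (there (here refl))) }
    }

-- Chains of factors

-- The invariant of an unfinished chain, with 0 as the vertex where the next factor is attached.
-- Nothing is claimed about the edges at 0, since that vertex disappears with the next product.
record Good (n : ℕ) : Set where
  field
    net      : Net
    size     : order net ≡ n
    base     : Apex net 0
    plane    : PlaneApex net base
    non-ham  : NonHam net base
    ham-base : HamNbs net base base
    ham-edge : HamEdges net base (_≢ 0)
    -- Keeps a Hamiltonian cycle of the product from running in the next factor only.
    spare    : ∃[ v ] (v ≢ 0 × v < order net × ∀ i → v ≢ nb base i)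

Realised : ℕ → Set
Realised n = ∃[ G ] (Connected {n} G × Planar G × K2-Hypohamiltonian G)

-- Vertex 1 of the first factor is never cut off, so the edges at it have to be treated too; hence a
-- cap.
start : ∀ {k} → Cap k → Good (5 + k)
start {k} c = record
  { net = H ; size = size ; base = base ; plane = cutOff plane ; non-ham = non-ham ; ham-base = ham-base
  ; ham-edge = edge
  ; spare = 1 , (λ ()) , subst (1 <_) (sym size) (s≤s (s≤s z≤n)) , λ i eq → not-terminal i (trans eq (std i)) }
  where
  open Cap c using (piece; ham-at-next)
  open Piece piece renaming (net to H)
  not-terminal : ∀ i → 1 ≢ terminal i
  not-terminal 0F ()
  not-terminal 1F ()
  not-terminal 2F ()
  edge : ∀ {u v} → u ≢ 0 → v ≢ 0 → v ∈ rot H u → Ham (order H) (Edge H) (u ∷ v ∷ [])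
  edge {u} {v} u≢0 v≢0 v∈ with u ≟ 1 | v ≟ 1
  ... | no u≢1 | no v≢1 = ham-edge u≢0 v≢0 u≢1 v≢1 v∈
  ... | yes refl | _ with ∈nb next v∈
  ...   | i , refl = ham-at-next i
  edge u≢0 v≢0 v∈ | no _ | yes refl with ∈nb next (symm H v∈)
  ... | i , refl = ham-swap (ham-at-next i)

module Extend {n k : ℕ} (g : Good n) (p : Piece k) where

  open Good g renaming (net to G; base to A)
  open Piece p using (link) renaming (net to H; base to B; next to C; non-ham to nonHamH; ham-base to k1H; ham-next to k1C; ham-edge to k2H)
  open Glue G A link
  open Splice G A link
  open GluePlane G A plane link (Piece.plane p)

  k1P : HamNbs P apexP apexP
  k1P i = hamH ham-base (λ { (here eq) → next≢0 i (sym eq) }) (k1C i)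

  -- As `σ 1` is 0, the two conditions on `σ` state that the edge of `H` does not meet vertex 1,
  -- around which a mere piece guarantees nothing.
  edgeP : (∀ {u v} → u ≢ 0 → v ≢ 0 → σ u ≢ 0 → σ v ≢ 0 → v ∈ rot H u → Ham (order H) (Edge H) (u ∷ v ∷ [])) →
          ∀ {u v} → u ≢ 0 → v ≢ 0 → EP u v → Ham (order P) EP (u ∷ v ∷ [])
  edgeP h {u} {v} u≢0 v≢0 e with origin {u} {v} e
  ... | inG _ _ e′ = hamG k1H u≢0 v≢0 (bound G e′) (bound G (symm G e′)) (ham-edge u≢0 v≢0 e′)
  ... | inH u′≢0 v′≢0 e′ refl refl = hamH ham-base
          (λ { (here eq) → u′≢0 (sym eq) ; (there (here eq)) → v′≢0 (sym eq) }) (h u′≢0 v′≢0 u≢0 v≢0 e′)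

  nonHam : NonHam P apexP
  nonHam with spare
  ... | v , v≢0 , v< , v≢a = nonHamP non-ham nonHamH (v , (v≢0 , v<) , v≢a)

  extend : Good (n + k)
  extend = record
    { net = P ; size = cong (_+ k) size ; base = apexP ; plane = planeP ; non-ham = nonHam ; ham-base = k1P
    ; ham-edge = edgeP (λ u≢0 v≢0 σu≢0 σv≢0 → k2H u≢0 v≢0 (λ { refl → σu≢0 refl }) (λ { refl → σv≢0 refl }))
    -- The neighbours of the new apex are interior to the last factor, so any vertex of the previous
    -- seam is spare.
    ; spare = a 0F , a≢0 0F , <-≤-trans (a<m 0F) (m≤m+n m k) , outside }
    where
    far-interior : ∀ {v} → 5 ≤ v → Interior v
    far-interior {suc (suc (suc (suc (suc j))))} _ = inner j
    far-interior {1} (s≤s ())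
    far-interior {2} (s≤s (s≤s ()))
    far-interior {3} (s≤s (s≤s (s≤s ())))
    far-interior {4} (s≤s (s≤s (s≤s (s≤s ()))))
    outside : ∀ i → a 0F ≢ nb apexP i
    outside i = σ-interior (far-interior (Link.far link i)) (a≢0 0F) (a<m 0F)

module Finish {n k : ℕ} (g : Good n) (c : Cap k) where

  open Cap c using (piece; ham-at-next)
  open Good g renaming (net to G; base to A)
  open Piece piece using (link) renaming (net to H; next to C; ham-edge to k2H)
  open Extend g piece using (k1P; edgeP; nonHam)
  open Glue G A link
  open Splice G A link
  open GluePlane G A plane link (Piece.plane piece)

  -- The apex of the product is vertex 1 of the cap, so its edges come from the cap too.
  at-apex : ∀ {v} → EP 0 v → Ham (order P) EP (0 ∷ v ∷ [])
  at-apex e with ∈nb apexP e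
  ... | i , refl = hamH ham-base (λ { (there (here eq)) → next≢0 i (sym eq) }) (ham-at-next i)

  away : ∀ {u v} → u ≢ 0 → v ≢ 0 → EP u v → Ham (order P) EP (u ∷ v ∷ [])
  away = edgeP (λ u≢0 v≢0 σu≢0 σv≢0 → k2H u≢0 v≢0 (λ { refl → σu≢0 refl }) (λ { refl → σv≢0 refl }))

  edge-avoided : ∀ u v → EP u v → Ham (order P) EP (u ∷ v ∷ [])
  edge-avoided zero    v       e = at-apex e
  edge-avoided (suc u) zero    e = ham-swap (at-apex (symmP e))
  edge-avoided (suc u) (suc v) e = away (λ ()) (λ ()) e

  realised : Realised (n + k)
  realised = subst Realised (cong (_+ k) size) (graph
    , connected (nb∈ apexP 0F) (λ { (here eq) → nb≢ apexP 0F (sym eq) }) (k1P 0F)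
    , planar (PlaneApex.embedding planeP)
    , hypo nonHam (λ {u} {v} → edge-avoided u v))
    where open Realise P

-- The factors

certificate34 : Certificate 29
certificate34 = record
  { rotations =
      (1020304 ∷ 1050607 ∷ 1000809 ∷ 10013101112 ∷ 1001415 ∷ 1011613 ∷ 1010917 ∷ 1011819 ∷
       102152017 ∷ 1020613 ∷ []) ∷
      (1031621 ∷ 1032223 ∷ 1032414 ∷ 1030905 ∷ 1041225 ∷ 1042608 ∷ 1051910 ∷ 106082018 ∷
       1071727 ∷ 1072816 ∷ []) ∷
      (108293017 ∷ 1102822 ∷ 1112130 ∷ 1113124 ∷ 1122332 ∷ 1143226 ∷ 1152529 ∷ 1183028 ∷
       1192721 ∷ 1202633 ∷ []) ∷
      (120312227 ∷ 1233033 ∷ 1243325 ∷ 1293231 ∷ []) ∷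
      []
  ; nb-codes =
      7062188703 ∷ 4198021246 ∷ 1651759198 ∷ 2372840225 ∷ 2372860691 ∷ 7030862495 ∷ []
  ; edge-codes =
      790953747 ∷ 4198021241 ∷ 368012738 ∷ 341274078 ∷ 1840240936 ∷ 2632019700 ∷ 909162622 ∷
      3543356996 ∷ 4198021206 ∷ 1186430099 ∷ 3811282840 ∷ 2343596703 ∷ 3947448654 ∷ 3811279384 ∷
      2193678110 ∷ 1693903482 ∷ 527280850 ∷ 3679226524 ∷ 3947376544 ∷ 3947157598 ∷ 3675253737 ∷
      2571286203 ∷ 1148966468 ∷ 5231543317 ∷ 515966551 ∷ 4604745284 ∷ 3811272400 ∷ 2054734260 ∷
      2631642244 ∷ 1186386275 ∷ 3696677535 ∷ 5130546153 ∷ 377075806 ∷ 2506989779 ∷ 1186501388 ∷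
      2798739230 ∷ 4806870037 ∷ 1188197132 ∷ 3950960414 ∷ 789092446 ∷ 700299358 ∷ 2374351752 ∷
      2798683158 ∷ 3515396767 ∷ 6325340251 ∷ 3547163186 ∷ 515966623 ∷ 4202127134 ∷ []
  }

opaque
  -- Opaque, so that the chains use a factor only through its fields and never unfold the check of
  -- its certificate.
  piece34 : Piece 29
  piece34 = mkPiece (toWitness {a? = valid?} tt)
    where open Certificate certificate34

certificate37 : Certificate 32
certificate37 = record
  { rotations =
      (1020304 ∷ 1050607 ∷ 1000809 ∷ 1001011 ∷ 1001213 ∷ 1011415 ∷ 101161710 ∷ 1010918 ∷
       102131918 ∷ 1020710 ∷ []) ∷
      (1030906 ∷ 103172012 ∷ 1041121 ∷ 1042208 ∷ 1051823 ∷ 1052416 ∷ 1061525 ∷ 1062611 ∷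
       107081914 ∷ 108272818 ∷ []) ∷
      (1112930 ∷ 1123022 ∷ 1132127 ∷ 1142824 ∷ 1152331 ∷ 116313226 ∷ 1172529 ∷ 119223334 ∷
       1193523 ∷ 1202636 ∷ []) ∷
      (1203321 ∷ 1243525 ∷ 1253436 ∷ 1273036 ∷ 1273235 ∷ 1283431 ∷ 1293233 ∷ []) ∷
      []
  ; nb-codes =
      70797107831 ∷ 111959773598 ∷ 115188730894 ∷ 45635478279 ∷ 34688014390 ∷ 137437012209 ∷ []
  ; edge-codes =
      23686685303 ∷ 55979886797 ∷ 67866805402 ∷ 17344007182 ∷ 57094547870 ∷ 62837671676 ∷
      67638034449 ∷ 62420329668 ∷ 16633859062 ∷ 33961879286 ∷ 37486911202 ∷ 62432273604 ∷
      15122703111 ∷ 33903343638 ∷ 15931847606 ∷ 31729639106 ∷ 9543275980 ∷ 42776708657 ∷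
      47790744113 ∷ 44724941425 ∷ 28232631519 ∷ 70621520071 ∷ 47527221580 ∷ 56230350414 ∷
      22716078855 ∷ 35152656959 ∷ 37487585822 ∷ 58497225206 ∷ 27742268100 ∷ 10138674951 ∷
      23428614719 ∷ 10158967953 ∷ 71369870481 ∷ 100168687330 ∷ 29574597646 ∷ 71981989954 ∷
      24565600630 ∷ 22811943687 ∷ 22819467615 ∷ 37486900350 ∷ 17355806742 ∷ 17355344470 ∷
      106793590498 ∷ 19993231496 ∷ 15213304071 ∷ 68723524849 ∷ 67822768081 ∷ 67801620753 ∷
      130303556988 ∷ 115217110402 ∷ 25344361174 ∷ 28706383630 ∷ 62444826178 ∷ []
  }

opaque
  piece37 : Piece 32
  piece37 = mkPiece (toWitness {a? = valid?} tt)
    where open Certificate certificate37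

certificate40 : Certificate 35
certificate40 = record
  { rotations =
      (1020304 ∷ 1050607 ∷ 1000908 ∷ 1001110 ∷ 1000512 ∷ 1010410 ∷ 10113141516 ∷ 1011712 ∷
       1021811 ∷ 1021219 ∷ []) ∷
      (103201305 ∷ 1030821 ∷ 1040709 ∷ 106102022 ∷ 1062423 ∷ 1062625 ∷ 1062717 ∷ 1071619 ∷
       108192728 ∷ 1091718 ∷ []) ∷
      (110212913 ∷ 111283020 ∷ 1133124 ∷ 1143226 ∷ 1142233 ∷ 1153427 ∷ 1152335 ∷ 1162518 ∷
       1183421 ∷ 1203631 ∷ []) ∷
      (1213536 ∷ 1222937 ∷ 1233338 ∷ 1243732 ∷ 1253528 ∷ 126383034 ∷ 1293039 ∷ 1313933 ∷
       1323935 ∷ 1363837 ∷ []) ∷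
      []
  ; nb-codes =
      671195405931 ∷ 2091474805902 ∷ 1267005061390 ∷ 2360203770163 ∷ 1329719651249 ∷
      526521918606 ∷ []
  ; edge-codes =
      1312226196825 ∷ 1045737402949 ∷ 1046817468786 ∷ 223328008462 ∷ 263507600526 ∷
      886843233668 ∷ 787853125553 ∷ 436033284017 ∷ 660600182705 ∷ 470875750166 ∷ 260664207683 ∷
      397352176078 ∷ 11930401075 ∷ 339511525684 ∷ 881239430388 ∷ 2912918287706 ∷ 1050805191638 ∷
      112080323501 ∷ 18583532497 ∷ 622316140187 ∷ 417262149398 ∷ 226732329526 ∷ 1023194741524 ∷
      2744568921937 ∷ 1001846061844 ∷ 1320619815857 ∷ 932353074405 ∷ 1312226197105 ∷
      2810179311441 ∷ 9597552183 ∷ 886613896881 ∷ 889568921009 ∷ 433468159766 ∷ 873794537393 ∷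
      684232910102 ∷ 650650044182 ∷ 1310611874445 ∷ 1310443750629 ∷ 1320169810865 ∷
      1328579054513 ∷ 492885627203 ∷ 1321075660721 ∷ 1329341711589 ∷ 889568922545 ∷
      1306713657205 ∷ 1321381972913 ∷ 1321569168305 ∷ 587653932788 ∷ 1048312166986 ∷
      339676770774 ∷ 2911152914257 ∷ 340098596598 ∷ 2908266315601 ∷ 226448552374 ∷ 873988352945 ∷
      943113408539 ∷ 2735423110993 ∷ 2734150270801 ∷ []
  }

opaque
  cap40 : Cap 35
  cap40 = mkCap (toWitness {a? = valid?} tt)
    (toWitness {a? = coded? nextSets (942623689815 ∷ 435648789084 ∷ 875626166542 ∷ [])} tt)
    where open Certificate certificate40

certificate49 : Certificate 44
certificate49 = record
  { rotations =
      (1020304 ∷ 1050607 ∷ 1000809 ∷ 1001011 ∷ 1001213 ∷ 101141516 ∷ 1011718 ∷ 1012019 ∷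
       1021321 ∷ 1022210 ∷ []) ∷
      (1030923 ∷ 10325192412 ∷ 1041126 ∷ 1042708 ∷ 105192829 ∷ 1053031 ∷ 1053217 ∷ 1061633 ∷
       1063420 ∷ 107112814 ∷ []) ∷
      (1071824 ∷ 108363522 ∷ 1092137 ∷ 1103725 ∷ 1112038 ∷ 1112339 ∷ 1123827 ∷ 1132633324036 ∷
       114193941 ∷ 1144230 ∷ []) ∷
      (1152943 ∷ 1154432 ∷ 1163127 ∷ 1172734 ∷ 1183338 ∷ 1214145 ∷ 1212746 ∷ 1224523 ∷ 1243426 ∷
       1254528 ∷ []) ∷
      (1274447 ∷ 128354642 ∷ 1294148 ∷ 1304844 ∷ 1314340 ∷ 1353937 ∷ 1364741 ∷ 1404846 ∷
       1424743 ∷ []) ∷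
      []
  ; nb-codes =
      2080222951196159 ∷ 2487103640886398 ∷ 1475191441201918 ∷ 892013939892095 ∷
      1299812735596426 ∷ 974079572192368 ∷ []
  ; edge-codes =
      269626549453727 ∷ 1243551820443197 ∷ 1065962596515770 ∷ 473261470391038 ∷ 643898162798538 ∷
      587064909299412 ∷ 297199949351039 ∷ 445854247130239 ∷ 429992805064650 ∷ 669010452536223 ∷
      487039786085488 ∷ 903061452891217 ∷ 99666844855408 ∷ 344399695564054 ∷ 197810007721034 ∷
      964898380951400 ∷ 451590022058876 ∷ 127907497192435 ∷ 482449169308293 ∷ 303922265394897 ∷
      491855617184465 ∷ 194845291003773 ∷ 300381483992667 ∷ 377980385097605 ∷ 82598097131824 ∷
      395875001609553 ∷ 369526223298941 ∷ 980489377124997 ∷ 669010848604831 ∷ 1729041180353277 ∷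
      473090811420592 ∷ 1201836947030236 ∷ 667008743871647 ∷ 381410066775933 ∷ 549177650341110 ∷
      669010845387871 ∷ 371774552815549 ∷ 370858354421741 ∷ 631015293813875 ∷ 269601884914591 ∷
      964834881728360 ∷ 296715011585340 ∷ 553889463197040 ∷ 451590022059044 ∷ 1716282378713937 ∷
      260264055201738 ∷ 251355030282186 ∷ 188818514089392 ∷ 188137244700080 ∷ 86949497593470 ∷
      632569412158600 ∷ 420676862542611 ∷ 185847840687408 ∷ 1738043418415101 ∷ 641573332757194 ∷
      473090771099056 ∷ 669010454928255 ∷ 649906379896714 ∷ 473090811416560 ∷ 607755584744771 ∷
      134430478773235 ∷ 80721527290830 ∷ 596472047627837 ∷ 980875961503953 ∷ 133716929483248 ∷
      980490165967493 ∷ 370488729245693 ∷ 369521015075837 ∷ 185850610724848 ∷ 612765545488458 ∷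
      612765899205322 ∷ 643898160838602 ∷ 980489377150597 ∷ []
  }

opaque
  cap49 : Cap 44
  cap49 = mkCap (toWitness {a? = valid?} tt)
    (toWitness {a? = coded? nextSets (429440349953994 ∷ 1200754643912656 ∷ 1201837047300316 ∷ [])} tt)
    where open Certificate certificate49

certificate70 : Certificate 65
certificate70 = record
  { rotations =
      (1020304 ∷ 1050607 ∷ 1000908 ∷ 1000610 ∷ 1001112 ∷ 1011314 ∷ 101150308 ∷ 1011617 ∷
       1021606 ∷ 1021218 ∷ []) ∷
      (103192011 ∷ 1041021 ∷ 1042209 ∷ 1051723 ∷ 1052415 ∷ 106142519 ∷ 107081826 ∷ 1072713 ∷
       1092816 ∷ 110152920 ∷ []) ∷
      (110193031 ∷ 1113122 ∷ 112213228 ∷ 113333424 ∷ 1142335 ∷ 115353637 ∷ 1163827 ∷ 117263933 ∷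
       1182238 ∷ 1193740 ∷ []) ∷
      (1204041 ∷ 120424321 ∷ 1224344 ∷ 1232745 ∷ 1234647 ∷ 1244725 ∷ 1254849 ∷ 1255029 ∷
       1262844 ∷ 1274451 ∷ []) ∷
      (1295230 ∷ 1305342 ∷ 131415455 ∷ 1315632 ∷ 132573938 ∷ 133515846 ∷ 1344559 ∷ 134604835 ∷
       1364761 ∷ 136626350 ∷ []) ∷
      (1374952 ∷ 1396445 ∷ 1405053 ∷ 1415263 ∷ 1426365 ∷ 1426656 ∷ 1435557 ∷ 1445664 ∷ 1456667 ∷
       1466760 ∷ []) ∷
      (1475968 ∷ 1486862 ∷ 1496165 ∷ 1495453 ∷ 1515766 ∷ 1546269 ∷ 1555864 ∷ 1586959 ∷ 1606961 ∷
       1656867 ∷ []) ∷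
      []
  ; nb-codes =
      12358576340823276984699 ∷ 58370592426845364831714 ∷ 47958420308780047300242 ∷
      43711162284718088102955 ∷ 7089744854284095001719 ∷ 20083804053732227593127 ∷ []
  ; edge-codes =
      4575238595777580701639 ∷ 33199921406636585142647 ∷ 20118539528987200445154 ∷
      15647554199593096476306 ∷ 4010102507815621444242 ∷ 87446143138722174997476 ∷
      10048109004628742218487 ∷ 10049151524727102879047 ∷ 1438699235684895679991 ∷
      6996233828712965370860 ∷ 5032792802549476622838 ∷ 21855581142359043981675 ∷
      911635609409685689940 ∷ 8890128822715521820306 ∷ 16096458994259813159562 ∷
      2363189443315767545749 ∷ 2363071238985482585749 ∷ 9551132994039141266021 ∷
      3237988271074735273743 ∷ 12497989351695496929151 ∷ 3408061966983997154807 ∷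
      6695459181495410973095 ∷ 33199953364860666028126 ∷ 22133280937745788924318 ∷
      4465839099880446262439 ∷ 4465839099880356747431 ∷ 14570387574254110867071 ∷
      6653195479453355867406 ∷ 3048094885020219754871 ∷ 17266323361057148118555 ∷
      9904758667149009656393 ∷ 13441126741247561816802 ∷ 2159227959582466166245 ∷
      6794637255414313538495 ∷ 6996781662417605026914 ∷ 7063185190817741035626 ∷
      5148677048706695533458 ∷ 6525091102537106785402 ∷ 5032795678168969200172 ∷
      14513478010455284444847 ∷ 14513257304441010712191 ∷ 9876479865013234253838 ∷
      4103021159273552234158 ∷ 14536256460178350075519 ∷ 6696431417684236040951 ∷
      15529916503174971410807 ∷ 10808446249174689414815 ∷ 2246816713492812735911 ∷
      3050156071516487912807 ∷ 4575238595777599364039 ∷ 49203954556083598551954 ∷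
      6154529409117569386414 ∷ 39944971905778039417746 ∷ 49203957979866170682258 ∷
      6809597102777678852351 ∷ 2673401671877080951698 ∷ 3982408838267596087086 ∷
      3593275929444452339631 ∷ 7216052279431345962604 ∷ 15208468343307247362321 ∷
      6698944911400380654887 ∷ 6699054840273615697223 ∷ 33199926006356380316446 ∷
      3544872699574043166997 ∷ 10048596013626759161255 ∷ 5032792802857348493814 ∷
      14570387426776655651367 ∷ 15976598902534973938631 ∷ 39944971917620662528914 ∷
      10044647127273726935975 ∷ 6696242546298360964391 ∷ 4103019439601935650142 ∷
      1000710111509973750318 ∷ 7549068344292247194480 ∷ 14512959063384172990383 ∷
      5032712227449723234294 ∷ 6699071366436842299559 ∷ 6699033536737611330887 ∷
      10279749192430136232432 ∷ 6699071366435073933479 ∷ 6699071366721306378407 ∷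
      33199953372581410534174 ∷ 32802672387363329567634 ∷ 4103020500760186404526 ∷
      6698921834447573361959 ∷ 33199933421450925273886 ∷ 16212667600180853112479 ∷
      33199953275990322344734 ∷ 10048596013626041665895 ∷ 25388050749134857766206 ∷
      33199953359207259861790 ∷ 17243575964754481468079 ∷ 10806874193049415915367 ∷
      18570505420406465951578 ∷ 11208164498361561256295 ∷ 6052774525038530024567 ∷
      21771804300810550284207 ∷ 21767599757999048420991 ∷ 49201744874286344072082 ∷
      10048550305025617016135 ∷ 5317308978372514507669 ∷ 49201727374953197628306 ∷
      10048607050081287487655 ∷ 10279733495547093521136 ∷ 1007445141261650520978 ∷
      21790008777398990089323 ∷ 3979987217334405720978 ∷ []
  }

opaque
  cap70 : Cap 65
  cap70 = mkCap (toWitness {a? = valid?} tt)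
    (toWitness {a? = coded? nextSets (15238561173516446510865 ∷ 3050159063851717878983 ∷ 33199953649486377413470 ∷ [])} tt)
    where open Certificate certificate70

certificate73 : Certificate 68
certificate73 = record
  { rotations =
      (1020304 ∷ 1050607 ∷ 1000809 ∷ 1001011 ∷ 1001213 ∷ 1011415 ∷ 1011617 ∷ 1011819 ∷ 1021320 ∷
       1022110 ∷ []) ∷
      (1030922 ∷ 103232412 ∷ 1041125 ∷ 1042608 ∷ 1052728 ∷ 1052916 ∷ 106153031 ∷ 1063218 ∷
       1071733 ∷ 1073435 ∷ []) ∷
      (1083621 ∷ 1092037 ∷ 1103723 ∷ 1112238 ∷ 11141423940 ∷ 1124026 ∷ 113254336 ∷ 1144445 ∷
       1144629 ∷ 1152847 ∷ []) ∷
      (116474849 ∷ 1165032 ∷ 1173151 ∷ 1185134 ∷ 1193352 ∷ 1195344 ∷ 120265554 ∷ 1215422 ∷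
       123545641 ∷ 1245257 ∷ []) ∷
      (1245825 ∷ 124385960 ∷ 1246153 ∷ 1265862 ∷ 1273561 ∷ 127606346 ∷ 1284564 ∷ 1296430 ∷
       1306566 ∷ 130565550 ∷ []) ∷
      (131496867 ∷ 132676933 ∷ 134693953 ∷ 1355242 ∷ 136563837 ∷ 1366249 ∷ 138544966 ∷ 1397058 ∷
       140577143 ∷ 1416663 ∷ []) ∷
      (1414561 ∷ 1426044 ∷ 1436855 ∷ 1455965 ∷ 1466547 ∷ 1486463 ∷ 1485956 ∷ 1507251 ∷ 1506271 ∷
       1517052 ∷ []) ∷
      (1576972 ∷ 1587268 ∷ 1677170 ∷ []) ∷
      []
  ; nb-codes =
      530060816516474428276559 ∷ 710645486326636579705726 ∷ 450918706166679822830654 ∷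
      29745198352166049943941 ∷ 231523426027194016147710 ∷ 697871896217219599683446 ∷ []
  ; edge-codes =
      158387717814700704758761 ∷ 355322743163318289852861 ∷ 300407629045753068777722 ∷
      106269467668685680708670 ∷ 3173916289602670754686 ∷ 207012221613156524064324 ∷
      115774921033917873545598 ∷ 171775483018529055162863 ∷ 27509496416782722666885 ∷
      348935948108323972173686 ∷ 171780506757843188422559 ∷ 115600538091719435561214 ∷
      110558388253924349576790 ∷ 76455429016467702443114 ∷ 225658325106880912104068 ∷
      97770396579401983521276 ∷ 27978209260639535165770 ∷ 36941001586466088137237 ∷
      53519456992603403132113 ∷ 92864695639227583926257 ∷ 66608918338625216020171 ∷
      103026625093831150322673 ∷ 115436704406172264165886 ∷ 171775926939178025075183 ∷
      170047502737194768908783 ∷ 76979878584282295895806 ∷ 51272898789725923454206 ∷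
      152685778403477038766038 ∷ 170749839000569513270927 ∷ 115469817876423459604222 ∷
      77821341867978191548401 ∷ 43855404369235655618890 ∷ 56964441903616983157386 ∷
      95122080197588105689709 ∷ 159404201503028521058391 ∷ 39121311928080459952871 ∷
      158525034827234987873640 ∷ 347633630641357430075126 ∷ 117221695874008057026383 ∷
      57263729234665325497799 ∷ 28482220963338556131978 ∷ 28361916053519879180490 ∷
      85887977383838003087471 ∷ 150210378791069725165770 ∷ 98036720585104466196298 ∷
      4749562369623341509966 ∷ 17665958075674018099262 ∷ 115774920979393698536766 ∷
      77174475342392735191806 ∷ 14872590509371904457093 ∷ 14872599176083026448773 ∷
      170046939852725934866927 ∷ 76909348091287603745278 ∷ 77067025563059375929278 ∷
      51385717501843902703998 ∷ 76979878602581409138430 ∷ 115761713013625794930942 ∷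
      51919720596372067364229 ∷ 51919720596281653833093 ∷ 348935948109644875943798 ∷
      114520351667026538680223 ∷ 115469817867456230526910 ∷ 170047405612774828065263 ∷
      9464466186456698720318 ∷ 70394541250978091003889 ∷ 2115877701776668351468 ∷
      70880313178557585614806 ∷ 146132602769286673443696 ∷ 71359265264953807869910 ∷
      76979617551073636648702 ∷ 43749224382968372752714 ∷ 2115475464578115500926 ∷
      114517284548185244549615 ∷ 114517363698060053430767 ∷ 171780572976144867231647 ∷
      348935948109988017138038 ∷ 77183067090546273483646 ∷ 115468932853855111440382 ∷
      39183427128238056713201 ∷ 77067023322719824960254 ∷ 113364958647534260044271 ∷
      51919721305612509752709 ∷ 115774921035092010230142 ∷ 115774921018502193557886 ∷
      43855313399190167646538 ∷ 77880431285269222632837 ∷ 6875784906244240403441 ∷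
      77174336756691751217406 ∷ 51389690203365715890942 ∷ 37989469794205758951978 ∷
      27515729222745142989189 ∷ 28109876288701836200945 ∷ 232623988348365420030326 ∷
      76979878707381191182078 ∷ 77174475335613537784062 ∷ 25666105606683422041143 ∷
      150235363019589735475018 ∷ 232616460139870528924022 ∷ 56964442314564822747786 ∷
      77053594518543214382974 ∷ 77053639695934574868478 ∷ 77879563334351174217093 ∷
      115433376951984088121854 ∷ 115761713061117638152446 ∷ 147054890134337452879050 ∷
      347569485572780182137206 ∷ 171775926829983313412591 ∷ 56705186393008180217034 ∷
      56984772085955499215562 ∷ 147073122402745629387978 ∷ 146880468501951838530762 ∷
      77879580894558101552517 ∷ []
  }

opaque
  cap73 : Cap 68
  cap73 = mkCap (toWitness {a? = valid?} tt)
    (toWitness {a? = coded? nextSets (77881388244827809230213 ∷ 171775954825213570433519 ∷ 348935985287750074952054 ∷ [])} tt)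
    where open Certificate certificate73

certificate79 : Certificate 74
certificate79 = record
  { rotations =
      (1020304 ∷ 1050607 ∷ 100080910 ∷ 1001112 ∷ 1001314 ∷ 1011516 ∷ 101171819 ∷ 1012021 ∷
       1021422 ∷ 1022423 ∷ []) ∷
      (1022511 ∷ 1031026 ∷ 1032713 ∷ 104122928 ∷ 1043008 ∷ 1052131 ∷ 1053217 ∷ 1061633 ∷
       1063534 ∷ 106373620 ∷ []) ∷
      (1071938 ∷ 1073915 ∷ 1084024 ∷ 1094125 ∷ 109223836 ∷ 1102342 ∷ 1114227 ∷ 1122643 ∷
       1134430 ∷ 1134345 ∷ []) ∷
      (114284640 ∷ 115484732 ∷ 1163149 ∷ 1174935 ∷ 1185037 ∷ 1183351 ∷ 119524124 ∷ 1193453 ∷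
       1202439 ∷ 12138405448 ∷ []) ∷
      (1223039 ∷ 1233655 ∷ 125555626 ∷ 1275629 ∷ 1284557 ∷ 129585944 ∷ 1305754 ∷ 1316061 ∷
       1313962 ∷ 1326133 ∷ []) ∷
      (1345163 ∷ 13561646550 ∷ 1365366 ∷ 1376352 ∷ 1394667 ∷ 1416642 ∷ 142685843 ∷ 144706946 ∷
       145566871 ∷ 1457270 ∷ []) ∷
      (1476273 ∷ 1475149 ∷ 1486760 ∷ 1507453 ∷ 1517576 ∷ 1517774 ∷ 152746855 ∷ 1546962 ∷
       156667758 ∷ 1577367 ∷ []) ∷
      (1575978 ∷ 1587672 ∷ 1597175 ∷ 1606978 ∷ 1636566 ∷ 1647872 ∷ 1647177 ∷ 1657668 ∷ 1707573 ∷
       []) ∷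
      []
  ; nb-codes =
      48555550871295518409887807 ∷ 87281771339881347315171620 ∷ 47207907984922922766601342 ∷
      6203599499266222348868515 ∷ 4282198497673142070909859 ∷ 24346217793880214903501735 ∷ []
  ; edge-codes =
      4362416813124813913278311 ∷ 28654711499182772207882303 ∷ 24487758159335315137921517 ∷
      36170060504326809270391144 ∷ 43382779162591873134254564 ∷ 6198303979731668993258854 ∷
      28448268588853767980678826 ∷ 8880382082382628106473124 ∷ 3211648873246728558189475 ∷
      20414184090544980243438168 ∷ 2141156593181636953873315 ∷ 5410270620862269967086503 ∷
      12175060331296308601357487 ∷ 3101743887172350229126051 ∷ 10363959992211977612719011 ∷
      9297455969597369407190374 ∷ 24718427398470451483454386 ∷ 12634275231831494091766926 ∷
      43148255009972665150012784 ∷ 16198862821595484587913575 ∷ 42975317673046482105696731 ∷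
      43318095295800672063252677 ∷ 28650215512024229082058621 ∷ 8422095735710418221680523 ∷
      10799241872773571138668027 ∷ 2061868611574483989976099 ∷ 10843248357450820946860963 ∷
      8115405931293335626242983 ∷ 11704768536191832227750255 ∷ 12175060644205703525117807 ∷
      11704758673361172669414567 ∷ 3101797538809836944333731 ∷ 11675584213931444771378159 ∷
      6185680093329416293447128 ∷ 17074233133113478312442255 ∷ 7807394406974709068739495 ∷
      3211648873255004909575075 ∷ 6087530322089720093146607 ∷ 4516516534270482807676411 ∷
      8116706887530872400908351 ∷ 3800766202239193829820263 ∷ 35229113649373078247837759 ∷
      25611499032322456886970767 ∷ 18294685527036873416743109 ∷ 28650329616394131949886919 ∷
      29093923743861322752111620 ∷ 42982204524557916814514576 ∷ 12632221210998981345839463 ∷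
      16199546584440751466521839 ∷ 9406066634993285332116478 ∷ 42975317673046482105696749 ∷
      24123698916802819101068008 ∷ 19420025903471004988642880 ∷ 6174300337087439826821156 ∷
      7278113815878109929905059 ∷ 20414184090544975295994456 ∷ 5634802284250217487949272 ∷
      11710452575945034359919215 ∷ 11675537467886726618960879 ∷ 3211648873253773378296739 ∷
      12175060644052508698703855 ∷ 39448971439815529143727011 ∷ 5836764200255863323192999 ∷
      25580886889822981803850127 ∷ 27507832245325753493142388 ∷ 14684391003795234196030703 ∷
      1605824436622070839942051 ∷ 20427203730076704236343687 ∷ 4440219518942854271232358 ∷
      6093303529225261687679655 ∷ 16286752684395254490023783 ∷ 8383451423300206795919751 ∷
      18338554856093469948189460 ∷ 28444131513128146574089261 ∷ 13410456159603986637930595 ∷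
      6198303979730898466059622 ∷ 5588969682869818237453551 ∷ 3015476539652395233927716 ∷
      3038612890652251407725926 ∷ 1718168839755219568663459 ∷ 10843181363278279148280739 ∷
      12175025333790030466890095 ∷ 30092715115296579113432930 ∷ 3211648873246538984037283 ∷
      6087530322026380789459055 ∷ 30621276890737054987500120 ∷ 5837622156965882141699751 ∷
      6094961263440391115546459 ∷ 14563809679983393865001600 ∷ 39458048210352312919919015 ∷
      26299314293210348999144355 ∷ 11239182462019778227621871 ∷ 14109099952489927998113662 ∷
      24444473193379965324087887 ∷ 16090409823107508592233928 ∷ 16073841453238443068742040 ∷
      3006827242641812038090342 ∷ 9406066634351948513188222 ∷ 19252469942503467547228973 ∷
      28444131512393972822486957 ∷ 12186439605916859905369767 ∷ 11685036687193839071501607 ∷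
      3211648873246527517858723 ∷ 14444506306465075018791908 ∷ 11239872630633057713212071 ∷
      11675579669177097173226479 ∷ 12175060700195536650093935 ∷ 40921574489149217488865005 ∷
      11239182461897667425137391 ∷ 39447491218253495011027875 ∷ 8115366770971794962139047 ∷
      18338554830211557788924788 ∷ 12174890092880982916804847 ∷ 24754375136943391971243757 ∷
      3057561473456615820663715 ∷ 11676816482400306108787191 ∷ 11685036686179384976055591 ∷
      11676816482400306158868207 ∷ 12186439621552138940702151 ∷ 14091320464324182322766206 ∷
      8880447261154322978170726 ∷ 11675579036157741614912495 ∷ []
  }

opaque
  cap79 : Cap 74
  cap79 = mkCap (toWitness {a? = valid?} tt)
    (toWitness {a? = coded? nextSets (3101510832780310115359651 ∷ 8116706887530872662848239 ∷ 8452207836852133391554008 ∷ [])} tt)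
    where open Certificate certificate79

certificate82 : Certificate 77
certificate82 = record
  { rotations =
      (1020304 ∷ 1050607 ∷ 1000809 ∷ 1001011 ∷ 1001213 ∷ 1011415 ∷ 1011617 ∷ 101181920 ∷
       1021321 ∷ 1022210 ∷ []) ∷
      (1030923 ∷ 1032412 ∷ 104112625 ∷ 104272808 ∷ 1052029 ∷ 1053016 ∷ 1061531 ∷ 1063218 ∷
       1071733 ∷ 1073534 ∷ []) ∷
      (1073614 ∷ 1083722 ∷ 1092138 ∷ 1103824 ∷ 111233940 ∷ 112264127 ∷ 11240344225 ∷ 1132543 ∷
       113444537 ∷ 1144630 ∷ []) ∷
      (11529484947 ∷ 1164732 ∷ 1173150 ∷ 1185035 ∷ 119265136 ∷ 1193342 ∷ 1203446 ∷ 1212852 ∷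
       122525323 ∷ 124535455 ∷ []) ∷
      (124565726 ∷ 125585960 ∷ 1263558 ∷ 1276044 ∷ 1284361 ∷ 1286263 ∷ 1293664 ∷ 130656631 ∷
       130646768 ∷ 1306970 ∷ []) ∷
      (132665833 ∷ 1345764 ∷ 1376338 ∷ 1387139 ∷ 1397273 ∷ 139747556 ∷ 1405576 ∷ 1406751 ∷
       1414250 ∷ 1416677 ∷ []) ∷
      (1417843 ∷ 1447862 ∷ 1456172 ∷ 1457152 ∷ 1465148 ∷ 147707377 ∷ 1475950 ∷ 1485776 ∷
       1487969 ∷ 1496880 ∷ []) ∷
      (1498165 ∷ 1536372 ∷ 1547162 ∷ 1546574 ∷ 1557381 ∷ 1558079 ∷ 1567967 ∷ 1596578 ∷ 1607761 ∷
       1687675 ∷ []) ∷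
      (1697581 ∷ 1708074 ∷ []) ∷
      []
  ; nb-codes =
      634802347663045913402235615 ∷ 670812172199773543040523198 ∷ 643101193340705710299175486 ∷
      320600153005190830576226014 ∷ 270565852175994816705874924 ∷ 187244058659382512588861932 ∷ []
  ; edge-codes =
      7075903838244848571573503 ∷ 335406086099886771520261597 ∷ 287077027665098907773174970 ∷
      113719963007786707999808062 ∷ 18816474532199916791581934 ∷ 197187902522566313455382764 ∷
      140433093429696597024780268 ∷ 135282926087997407262428140 ∷ 125901733053336655496164415 ∷
      140433043994535389298602476 ∷ 83934481518264256574336063 ∷ 83934482690494310692862015 ∷
      106866717668396943517863646 ∷ 69811027697653169916495958 ∷ 126822229048056564074003834 ∷
      44008451781061714156276532 ∷ 142905617010194062085594492 ∷ 12925614575032209881643311 ∷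
      4508074051257711989276741 ∷ 84482475415714492086021105 ∷ 42241332680895947688370035 ∷
      32732001787834058501428083 ∷ 34305502222546703269739379 ∷ 121821712192248648686876741 ∷
      142731552819462890495925996 ∷ 135285186518974866876197356 ∷ 80150038251297704780469982 ∷
      142731405414133841449180908 ∷ 160300076502595411907780830 ∷ 160245966827927112490690942 ∷
      125901722529826156390722623 ∷ 409494744012444916922325474 ∷ 160271355740382278883887422 ∷
      84483467492201970941062383 ∷ 140433094690379724093898732 ∷ 141590764148970891286042141 ∷
      171593771121741786390289119 ∷ 10383344788808417094185511 ∷ 59178609283554263563957164 ∷
      223604057399924514346841078 ∷ 186664218431813367926285922 ∷ 127594866120857917223892330 ∷
      46811014660286796978369004 ∷ 35186063992703072582444559 ∷ 106863761184731283475840606 ∷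
      41967243947404518537144383 ∷ 57236870142296791549309007 ∷ 62950876738643804314236479 ∷
      240625614217725831486919608 ∷ 114204875978592572518032351 ∷ 114395847414344204486793951 ∷
      7860670268646613859644322 ∷ 240771551857810132579464051 ∷ 80150038251297707643862750 ∷
      53432709393760664924141566 ∷ 63361856363459929854111711 ∷ 41967243954594485785521215 ∷
      83934482087861444980321343 ∷ 135282926087997407602166764 ∷ 106859612070026317560544798 ∷
      83934481610247452640002295 ∷ 140433043994535650217865708 ∷ 93622062286464448259272684 ∷
      93622063876516900215812332 ∷ 125901733053327821539965503 ∷ 125901731864087097951841343 ∷
      346024628079327078916286710 ∷ 103097443322794127609926621 ∷ 161015496893698984460043816 ∷
      41454984822103130761430754 ∷ 49093271740670517498872418 ∷ 68726174719453606809714205 ∷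
      95114537516911239510879468 ∷ 106831287115711542501814622 ∷ 167065180582429306106292293 ∷
      24297695550333208383037299 ∷ 83934497997085946893375679 ∷ 126723739370520267848314095 ∷
      238862404016855268397264755 ∷ 36411206753918819157614451 ∷ 37002963073986972174525171 ∷
      420359020944698484027729762 ∷ 409240728039887505178389474 ∷ 409495004119967647232825826 ∷
      76153867046760214046219471 ∷ 83934488678190724206384191 ∷ 93622038574212172612288492 ∷
      83934486335712939580132415 ∷ 83934487909391399697517631 ∷ 188841931052759009801810860 ∷
      160289412220085538978496222 ∷ 101823851802437967218127340 ∷ 54182533052381058497353693 ∷
      160273554235067516115777214 ∷ 140433043994546738607075820 ∷ 171534037123755135268043903 ∷
      125102566101449412589065201 ∷ 113532839448555537899271906 ∷ 171239898632094172905713271 ∷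
      83934482239087959485312063 ∷ 83934487909391399657040959 ∷ 120593551375729971616035811 ∷
      180828026520165912823624291 ∷ 126723985592842225560743151 ∷ 274674872546027792789031717 ∷
      51379816044585163227101427 ∷ 126797244778123163323588467 ∷ 37002963237936115320240627 ∷
      171534037123755135268039583 ∷ 150540257619516127424116130 ∷ 139840851238223920877269228 ∷
      95113287844490182977107436 ∷ 125894596448945603325211564 ∷ 120547849043160181907542511 ∷
      81273799571616305008311901 ∷ 160289412219296519126482654 ∷ 189529739770688157911809263 ∷
      189629662024517159376059631 ∷ 409360196117654967608431778 ∷ 155672975565291127091780029 ∷
      183121291068894914119742380 ∷ 408251279803034594117290722 ∷ 409495144504597334483802594 ∷
      160289412216750224344055518 ∷ 160289418107904542916523870 ∷ 53227824957182700769763187 ∷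
      286324875816315065246071146 ∷ []
  }

opaque
  cap82 : Cap 77
  cap82 = mkCap (toWitness {a? = valid?} tt)
    (toWitness {a? = coded? nextSets (126724346916588560107334895 ∷ 126725208080369486337436911 ∷ 83934487909350038195072063 ∷ [])} tt)
    where open Certificate certificate82

-- Products for all orders

record Plan : Set where
  constructor plan
  field
    {k l}  : ℕ
    first  : Cap k
    middle : List (∃ Piece)
    final  : Cap l

  total : ℕ
  total = (5 + k) + sum (map proj₁ middle) + l

open Plan using (total)

extendAll : ∀ {n} (ps : List (∃ Piece)) → Good n → Good (n + sum (map proj₁ ps))
extendAll {n} []             g = subst Good (sym (+-identityʳ n)) g
extendAll {n} ((k , p) ∷ ps) g = subst Good (+-assoc n k _) (extendAll ps (Extend.extend g p))

extendTimes : ∀ {n} q → Good n → Good (n + q * 29)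
extendTimes {n} zero    g = subst Good (sym (+-identityʳ n)) g
extendTimes {n} (suc q) g = subst Good (+-assoc n 29 (q * 29)) (extendTimes q (Extend.extend g piece34))

-- The additional copies of `piece34` go in just before the final cap, since only inner factors may
-- lack the property around both special vertices.
realise : ∀ p q → Realised (total p + q * 29)
realise (plan {k} {l} c ps d) q = subst Realised (swap-last (5 + k + sum (map proj₁ ps)) (q * 29) l)
  (Finish.realised (extendTimes q (extendAll ps (start c))) d)
  where
  swap-last : ∀ x y z → (x + y) + z ≡ (x + z) + y
  swap-last = solve-∀

-- One product for each residue of the order modulo 29.
plans : List Plan
plans =
    plan cap40 (m34 ∷ []) cap70 ∷
    plan cap70 [] cap70 ∷
    plan cap40 (m34 ∷ m37 ∷ []) cap40 ∷
    plan cap49 (m49 ∷ []) cap49 ∷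
    plan cap70 [] cap73 ∷
    plan cap40 (m34 ∷ m40 ∷ []) cap40 ∷
    plan cap40 (m40 ∷ []) cap70 ∷
    plan cap73 [] cap73 ∷
    plan cap40 (m37 ∷ m40 ∷ []) cap40 ∷
    plan cap40 (m40 ∷ []) cap73 ∷
    plan cap70 [] cap79 ∷
    plan cap40 (m40 ∷ m40 ∷ []) cap40 ∷
    plan cap40 (m37 ∷ []) cap79 ∷
    plan cap70 [] cap82 ∷
    plan cap40 (m34 ∷ m49 ∷ []) cap40 ∷
    plan cap40 (m40 ∷ []) cap79 ∷
    plan cap73 [] cap82 ∷
    plan cap49 (m34 ∷ m34 ∷ []) cap49 ∷
    plan cap40 (m40 ∷ []) cap82 ∷
    plan cap79 [] cap79 ∷
    plan cap40 (m40 ∷ m49 ∷ []) cap40 ∷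
    plan cap49 (m37 ∷ []) cap79 ∷
    plan cap79 [] cap82 ∷
    plan cap49 (m37 ∷ m37 ∷ []) cap49 ∷
    plan cap49 (m49 ∷ []) cap70 ∷
    plan cap82 [] cap82 ∷
    plan cap40 (m37 ∷ m49 ∷ []) cap49 ∷
    plan cap49 (m49 ∷ []) cap73 ∷
    plan cap40 (m34 ∷ m34 ∷ m34 ∷ []) cap40 ∷ []
  where
  m34 m37 m40 m49 : ∃ Piece
  m34 = _ , piece34
  m37 = _ , piece37
  m40 = _ , Cap.piece cap40
  m49 = _ , Cap.piece cap49

-- The totals depend only on the size indices, so evaluation compares numbers and does not enter the
-- opaque factors.
plans-total : map (134 +_) (upTo 29) ≡ map total plans
plans-total = refl

opaque
  planFor : ∀ {r} → r < 29 → ∃[ p ] (134 + r ≡ total p)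
  planFor {r} r< with ∈-map⁻ total {xs = plans} (subst ((134 + r) ∈_) plans-total (∈-map⁺ (134 +_) (∈-upTo⁺ r<)))
  ... | p , _ , eq = p , eq

realise-134+ : ∀ m → Realised (134 + m)
realise-134+ m = subst Realised
  (trans (cong (_+ m / 29 * 29) (sym (proj₂ chosen))) (cong (134 +_) (sym (m≡m%n+[m/n]*n m 29))))
  (realise (proj₁ chosen) (m / 29))
  where
  chosen : ∃[ p ] (134 + m % 29 ≡ total p)
  chosen = planFor (m%n<n m 29)

theorem3 : ∀ (n : ℕ) → n ≥ 134 →
    ∃[ G ] (Connected {n} G × Planar G × K2-Hypohamiltonian G)
theorem3 n n≥134 = subst Realised (m+[n∸m]≡n n≥134) (realise-134+ (n ∸ 134))
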